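{- Let $k\ge 0$ and $\delta\ge k+2$ be integers, and let $n$ be sufficiently large (i.e. $n\ge n_0(k,\delta)$ for some $n_0$ depending only on $k$ and $\delta$). If $G$ is an $n$-vertex graph with minimum degree $\delta(G)\ge\delta$ and $$q(G)\ge 2(n-\delta+k-1),$$ then $G$ is $k$-Hamiltonian unless $G\in\mathcal{H}_{n,k,\delta}^{(1)}$ or $G\in\mathcal{L}_{n,k,\delta}^{(1)}$.
   Context: All graphs are finite and simple, considered up to isomorphism. $q(G)$ is the signless Laplacian spectral radius, i.e. the largest eigenvalue of $Q(G)=D(G)+A(G)$, where $A(G)$ is the adjacency matrix and $D(G)$ the diagonal matrix of vertex degrees. $K_s$ is the complete graph on $s$ vertices, $I_t$ is the edgeless graph on $t$ vertices, $G\cup H$ is the disjoint union, and $G\vee H$ is the join (obtained from $G\cup H$ by adding all edges between $G$ and $H$). A graph is Hamiltonian if it has a Hamilton cycle (a cycle through all vertices). A graph $G=(V,E)$ is $k$-Hamiltonian if for all $S\subseteq V$ with $|S|\le k$, the subgraph induced by $V\setminus S$ is Hamiltonian. Define $H_{n,k,\delta}:=K_\delta\vee(K_{n-2\delta+k}\cup I_{\delta-k})$. In it, let $X$ be the set of $\delta-k$ vertices (of degree $\delta$) of $I_{\delta-k}$, $Y$ the set of $\delta$ vertices (of degree $n-1$) of $K_\delta$, and $Z$ the set of the remaining $n-2\delta+k$ vertices (of degree $n-\delta+k-1$). Let $E_1(H_{n,k,\delta})$ be the set of edges with both endpoints in $Y\cup Z$, and $$\mathcal{H}_{n,k,\delta}^{(1)}=\{H_{n,k,\delta}\setminus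 E' : E'\subseteq E_1(H_{n,k,\delta}),\ |E'|\le\lfloor\delta(\delta-k)/4\rfloor\},$$ where $G\setminus E'$ means deleting the edges of $E'$. Define $L_{n,k,\delta}:=K_{k+1}\vee(K_{n-\delta-1}\cup K_{\delta-k})$. In it, let $X$ be the set of vertices (of degree $\delta$) of $K_{\delta-k}$, $Y$ the set of vertices (of degree $n-1$) of $K_{k+1}$, and $Z$ the set of the remaining $n-\delta-1$ vertices (of degree $n-\delta+k-1$). Let $E_1(L_{n,k,\delta})$ be the set of edges with both endpoints in $Y\cup Z$, and $$\mathcal{L}_{n,k,\delta}^{(1)}=\{L_{n,k,\delta}\setminus E' : E'\subseteq E_1(L_{n,k,\delta}),\ |E'|\le\lfloor(k+1)(\delta-k)/4\rfloor\}.$$ -}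

module Defs where

open import Data.Bool.Base using (Bool; true; false; _∧_; not; T; if_then_else_)
open import Data.Fin.Base as Fin using (Fin; _↑ˡ_; _↑ʳ_; splitAt)
import Data.Fin.Properties as Fin
open import Data.Fin.Permutation using (Permutation; _⟨$⟩ʳ_)
open import Data.Fin.Subset using (Subset; inside; outside; ∣_∣; ∁)
open import Data.Integer.Base as ℤ using (ℤ)
open import Data.List.Base as List using (List; _∷_; _∷ʳ_; length; allFin)
open import Data.List.Extrema.Nat using (min)
open import Data.List.Membership.Propositional using (_∈_)
open import Data.List.Relation.Unary.Linked using (Linked)
open import Data.List.Relation.Unary.Unique.Propositional using (Unique)
open import Data.Nat.Base as ℕ using (ℕ; suc; _∸_)
import Data.Nat.DivMod as ℕ
import Data.Nat.Properties as ℕ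
open import Data.Product.Base using (Σ-syntax; ∃-syntax; _×_; _,_; proj₁; proj₂)
open import Data.Rational.Base as ℚ using (ℚ; 0ℚ; 1ℚ; ½)
import Data.Rational.Properties as ℚ
open import Data.Rational.Solver using (module +-*-Solver)
open import Data.Sum.Base using (_⊎_; inj₁; inj₂)
open import Data.Vec.Base as Vec using (Vec; []; _∷_; lookup; tabulate)
import Data.Vec.Functional as Vector
open import Function.Base using (_∘_)
open import Relation.Binary.PropositionalEquality
  using (_≡_; refl; sym; trans; cong; cong₂; subst)
open import Relation.Nullary.Decidable using (does; _×-dec_; dec-true; dec-false; T?; yes; no)
open import Relation.Nullary.Negation using (¬_)

IsCauchy : (ℕ → ℚ) → Set
IsCauchy s = ∀ ε → 0ℚ ℚ.< ε →
  ∃[ N ] ∀ i j → N ℕ.≤ i → N ℕ.≤ j → ℚ.∣ s i ℚ.- s j ∣ ℚ.≤ ε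

record ℝ : Set where
  constructor mkℝ
  field
    seq      : ℕ → ℚ
    isCauchy : IsCauchy seq

open ℝ public

infix 4 _≈ℝ_ _≤ℝ_

_≈ℝ_ : ℝ → ℝ → Set
x ≈ℝ y = ∀ ε → 0ℚ ℚ.< ε →
  ∃[ N ] ∀ i → N ℕ.≤ i → ℚ.∣ seq x i ℚ.- seq y i ∣ ℚ.≤ ε

_≤ℝ_ : ℝ → ℝ → Set
x ≤ℝ y = ∀ ε → 0ℚ ℚ.< ε →
  ∃[ N ] ∀ i → N ℕ.≤ i → seq x i ℚ.≤ seq y i ℚ.+ ε

fromℚ : ℚ → ℝ
fromℚ p = mkℝ (λ _ → p) λ ε ε>0 →
  0 , λ _ _ _ _ → subst (λ r → ℚ.∣ r ∣ ℚ.≤ ε) (sym (ℚ.+-inverseʳ p)) (ℚ.<⇒≤ ε>0)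

fromℤ : ℤ → ℝ
fromℤ i = fromℚ (i ℚ./ 1)

0ℝ 1ℝ : ℝ
0ℝ = fromℚ 0ℚ
1ℝ = fromℚ 1ℚ

private
  half : ∀ {ε} → 0ℚ ℚ.< ε → 0ℚ ℚ.< ½ ℚ.* ε
  half {ε} ε>0 = ℚ.positive⁻¹ (½ ℚ.* ε)
    {{ℚ.pos*pos⇒pos ½ ε {{ℚ.positive ε>0}}}}

  halves : ∀ ε → ½ ℚ.* ε ℚ.+ ½ ℚ.* ε ≡ ε
  halves ε = trans (sym (ℚ.*-distribʳ-+ ε ½ ½)) (ℚ.*-identityˡ ε)

  regroup-+ : ∀ a b c d → (a ℚ.+ b) ℚ.- (c ℚ.+ d) ≡ (a ℚ.- c) ℚ.+ (b ℚ.- d)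
  regroup-+ = solve 4 (λ a b c d →
    (a :+ b) :- (c :+ d) := (a :- c) :+ (b :- d)) refl
    where open +-*-Solver

  regroup-* : ∀ a b c d →
    (a ℚ.* b) ℚ.- (c ℚ.* d) ≡ a ℚ.* (b ℚ.- d) ℚ.+ d ℚ.* (a ℚ.- c)
  regroup-* = solve 4 (λ a b c d →
    (a :* b) :- (c :* d) := a :* (b :- d) :+ d :* (a :- c)) refl
    where open +-*-Solver

  split : ∀ a b → a ≡ b ℚ.+ (a ℚ.- b)
  split = solve 2 (λ a b → a := b :+ (a :- b)) refl
    where open +-*-Solver

  bounded : ∀ x → Σ[ B ∈ ℚ ] (0ℚ ℚ.< B) ×
            (∃[ N ] ∀ i → N ℕ.≤ i → ℚ.∣ seq x i ∣ ℚ.≤ B)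
  bounded x with isCauchy x 1ℚ (ℚ.positive⁻¹ 1ℚ)
  ... | N , close = B , B>0 , N , bound
    where
    B = ℚ.∣ seq x N ∣ ℚ.+ 1ℚ
    B>0 : 0ℚ ℚ.< B
    B>0 = ℚ.+-mono-≤-< (ℚ.0≤∣p∣ (seq x N)) (ℚ.positive⁻¹ 1ℚ)
    open ℚ.≤-Reasoning
    bound : ∀ i → N ℕ.≤ i → ℚ.∣ seq x i ∣ ℚ.≤ B
    bound i N≤i = begin
      ℚ.∣ seq x i ∣
        ≡⟨ cong ℚ.∣_∣ (split (seq x i) (seq x N)) ⟩
      ℚ.∣ seq x N ℚ.+ (seq x i ℚ.- seq x N) ∣
        ≤⟨ ℚ.∣p+q∣≤∣p∣+∣q∣ (seq x N) (seq x i ℚ.- seq x N) ⟩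
      ℚ.∣ seq x N ∣ ℚ.+ ℚ.∣ seq x i ℚ.- seq x N ∣
        ≤⟨ ℚ.+-monoʳ-≤ ℚ.∣ seq x N ∣ (close i N N≤i ℕ.≤-refl) ⟩
      B ∎

  ∣*∣-mono : ∀ p q {P Q} → 0ℚ ℚ.< P →
             ℚ.∣ p ∣ ℚ.≤ P → ℚ.∣ q ∣ ℚ.≤ Q → ℚ.∣ p ℚ.* q ∣ ℚ.≤ P ℚ.* Q
  ∣*∣-mono p q {P} {Q} P>0 p≤P q≤Q = begin
    ℚ.∣ p ℚ.* q ∣         ≡⟨ ℚ.∣p*q∣≡∣p∣*∣q∣ p q ⟩
    ℚ.∣ p ∣ ℚ.* ℚ.∣ q ∣   ≤⟨ ℚ.*-monoʳ-≤-nonNeg ℚ.∣ q ∣ {{ℚ.nonNegative (ℚ.0≤∣p∣ q)}} p≤P ⟩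
    P ℚ.* ℚ.∣ q ∣         ≤⟨ ℚ.*-monoˡ-≤-nonNeg P {{ℚ.nonNegative (ℚ.<⇒≤ P>0)}} q≤Q ⟩
    P ℚ.* Q ∎
    where open ℚ.≤-Reasoning

infixl 6 _+ℝ_
infixl 7 _*ℝ_

_+ℝ_ : ℝ → ℝ → ℝ
x +ℝ y = mkℝ (λ i → seq x i ℚ.+ seq y i) cauchy
  where
  cauchy : IsCauchy (λ i → seq x i ℚ.+ seq y i)
  cauchy ε ε>0 with isCauchy x (½ ℚ.* ε) (half ε>0) | isCauchy y (½ ℚ.* ε) (half ε>0)
  ... | M , closeˣ | N , closeʸ = M ℕ.⊔ N , λ i j i≥ j≥ → begin
      ℚ.∣ (seq x i ℚ.+ seq y i) ℚ.- (seq x j ℚ.+ seq y j) ∣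
        ≡⟨ cong ℚ.∣_∣ (regroup-+ (seq x i) (seq y i) (seq x j) (seq y j)) ⟩
      ℚ.∣ (seq x i ℚ.- seq x j) ℚ.+ (seq y i ℚ.- seq y j) ∣
        ≤⟨ ℚ.∣p+q∣≤∣p∣+∣q∣ (seq x i ℚ.- seq x j) (seq y i ℚ.- seq y j) ⟩
      ℚ.∣ seq x i ℚ.- seq x j ∣ ℚ.+ ℚ.∣ seq y i ℚ.- seq y j ∣
        ≤⟨ ℚ.+-mono-≤ (closeˣ i j (ℕ.m⊔n≤o⇒m≤o M N i≥) (ℕ.m⊔n≤o⇒m≤o M N j≥))
                      (closeʸ i j (ℕ.m⊔n≤o⇒n≤o M N i≥) (ℕ.m⊔n≤o⇒n≤o M N j≥)) ⟩
      ½ ℚ.* ε ℚ.+ ½ ℚ.* ε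
        ≡⟨ halves ε ⟩
      ε ∎
    where open ℚ.≤-Reasoning

_*ℝ_ : ℝ → ℝ → ℝ
x *ℝ y = mkℝ (λ i → seq x i ℚ.* seq y i) cauchy
  where
  open ℚ.≤-Reasoning
  P = proj₁ (bounded x)
  Q = proj₁ (bounded y)
  P>0 = proj₁ (proj₂ (bounded x))
  Q>0 = proj₁ (proj₂ (bounded y))
  K = proj₁ (proj₂ (proj₂ (bounded x)))
  L = proj₁ (proj₂ (proj₂ (bounded y)))
  boundˣ = proj₂ (proj₂ (proj₂ (bounded x)))
  boundʸ = proj₂ (proj₂ (proj₂ (bounded y)))

  S = P ℚ.+ Q
  instance
    S-pos : ℚ.Positive S
    S-pos = ℚ.positive (ℚ.+-mono-< P>0 Q>0)
    S-nonZero : ℚ.NonZero S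
    S-nonZero = ℚ.pos⇒nonZero S

  cauchy : IsCauchy (λ i → seq x i ℚ.* seq y i)
  cauchy ε ε>0 = go (isCauchy x η η>0) (isCauchy y η η>0)
    where
    η = ℚ.1/ S ℚ.* ε
    η>0 : 0ℚ ℚ.< η
    η>0 = ℚ.positive⁻¹ η
      {{ℚ.pos*pos⇒pos (ℚ.1/ S) {{ℚ.1/pos⇒pos S}} ε {{ℚ.positive ε>0}}}}
    go : _ → _ → _
    go (M , closeˣ) (N , closeʸ) = (M ℕ.⊔ N) ℕ.⊔ (K ℕ.⊔ L) , λ i j i≥ j≥ →
      let i≥MN = ℕ.m⊔n≤o⇒m≤o (M ℕ.⊔ N) (K ℕ.⊔ L) i≥
          j≥MN = ℕ.m⊔n≤o⇒m≤o (M ℕ.⊔ N) (K ℕ.⊔ L) j≥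
          i≥KL = ℕ.m⊔n≤o⇒n≤o (M ℕ.⊔ N) (K ℕ.⊔ L) i≥
          j≥KL = ℕ.m⊔n≤o⇒n≤o (M ℕ.⊔ N) (K ℕ.⊔ L) j≥
          xᵢ = seq x i ; xⱼ = seq x j ; yᵢ = seq y i ; yⱼ = seq y j
      in begin
      ℚ.∣ xᵢ ℚ.* yᵢ ℚ.- xⱼ ℚ.* yⱼ ∣
        ≡⟨ cong ℚ.∣_∣ (regroup-* xᵢ yᵢ xⱼ yⱼ) ⟩
      ℚ.∣ xᵢ ℚ.* (yᵢ ℚ.- yⱼ) ℚ.+ yⱼ ℚ.* (xᵢ ℚ.- xⱼ) ∣
        ≤⟨ ℚ.∣p+q∣≤∣p∣+∣q∣ (xᵢ ℚ.* (yᵢ ℚ.- yⱼ)) (yⱼ ℚ.* (xᵢ ℚ.- xⱼ)) ⟩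
      ℚ.∣ xᵢ ℚ.* (yᵢ ℚ.- yⱼ) ∣ ℚ.+ ℚ.∣ yⱼ ℚ.* (xᵢ ℚ.- xⱼ) ∣
        ≤⟨ ℚ.+-mono-≤
             (∣*∣-mono xᵢ (yᵢ ℚ.- yⱼ) P>0 (boundˣ i (ℕ.m⊔n≤o⇒m≤o K L i≥KL))
               (closeʸ i j (ℕ.m⊔n≤o⇒n≤o M N i≥MN) (ℕ.m⊔n≤o⇒n≤o M N j≥MN)))
             (∣*∣-mono yⱼ (xᵢ ℚ.- xⱼ) Q>0 (boundʸ j (ℕ.m⊔n≤o⇒n≤o K L j≥KL))
               (closeˣ i j (ℕ.m⊔n≤o⇒m≤o M N i≥MN) (ℕ.m⊔n≤o⇒m≤o M N j≥MN))) ⟩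
      P ℚ.* η ℚ.+ Q ℚ.* η
        ≡⟨ sym (ℚ.*-distribʳ-+ η P Q) ⟩
      S ℚ.* η
        ≡⟨ sym (ℚ.*-assoc S (ℚ.1/ S) ε) ⟩
      S ℚ.* ℚ.1/ S ℚ.* ε
        ≡⟨ cong (ℚ._* ε) (ℚ.*-inverseʳ S) ⟩
      1ℚ ℚ.* ε
        ≡⟨ ℚ.*-identityˡ ε ⟩
      ε ∎

Matrix : ℕ → Set
Matrix n = Fin n → Fin n → ℝ

∑ : ∀ {n} → (Fin n → ℝ) → ℝ
∑ = Vector.foldr _+ℝ_ 0ℝ

IsEigenvalue : ∀ {n} → Matrix n → ℝ → Set
IsEigenvalue {n} M μ = Σ[ x ∈ (Fin n → ℝ) ]
  ¬ (∀ i → x i ≈ℝ 0ℝ) × (∀ i → ∑ (λ j → M i j *ℝ x j) ≈ℝ μ *ℝ x i)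

IsLargestEigenvalue : ∀ {n} → Matrix n → ℝ → Set
IsLargestEigenvalue M q = IsEigenvalue M q × (∀ μ → IsEigenvalue M μ → μ ≤ℝ q)

record Graph (n : ℕ) : Set where
  field
    adj        : Fin n → Fin n → Bool
    adj-sym    : ∀ u v → adj u v ≡ adj v u
    adj-irrefl : ∀ u → adj u u ≡ false

open Graph public

Adj : ∀ {n} → Graph n → Fin n → Fin n → Set
Adj G u v = T (adj G u v)

infix 4 _≅_

_≅_ : ∀ {m n} → Graph m → Graph n → Set
_≅_ {m} {n} G H = Σ[ σ ∈ Permutation m n ]
  ∀ u v → adj G u v ≡ adj H (σ ⟨$⟩ʳ u) (σ ⟨$⟩ʳ v)

neighbours : ∀ {n} → Graph n → Fin n → Subset n
neighbours G u = tabulate (adj G u)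

degree : ∀ {n} → Graph n → Fin n → ℕ
degree G u = ∣ neighbours G u ∣

-- The default value n exceeds every degree, so it is returned only if n = 0.
minDegree : ∀ {n} → Graph n → ℕ
minDegree {n} G = min n (List.map (degree G) (allFin n))

edges : ∀ {n} → Graph n → List (Fin n × Fin n)
edges {n} G = List.filter (λ (u , v) → (u Fin.<? v) ×-dec T? (adj G u v))
                          (List.cartesianProduct (allFin n) (allFin n))

edgeCount : ∀ {n} → Graph n → ℕ
edgeCount G = length (edges G)

adjacencyMatrix degreeMatrix signlessLaplacian : ∀ {n} → Graph n → Matrix n
adjacencyMatrix G u v = if adj G u v then 1ℝ else 0ℝ
degreeMatrix G u v = if does (u Fin.≟ v) then fromℤ (ℤ.+ degree G u) else 0ℝ
signlessLaplacian G u v = degreeMatrix G u v +ℝ adjacencyMatrix G u v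

IsSignlessLaplacianSpectralRadius : ∀ {n} → Graph n → ℝ → Set
IsSignlessLaplacianSpectralRadius G q = IsLargestEigenvalue (signlessLaplacian G) q

-- A Hamilton cycle is listed as v ∷ vs; it closes up by returning to v.
record Hamiltonian {n} (G : Graph n) : Set where
  field
    v        : Fin n
    vs       : List (Fin n)
    3≤length : 3 ℕ.≤ length (v ∷ vs)
    distinct : Unique (v ∷ vs)
    closed   : Linked (Adj G) (v ∷ vs ∷ʳ v)
    spanning : ∀ u → u ∈ v ∷ vs

elements : ∀ {n} (S : Subset n) → Vec (Fin n) ∣ S ∣
elements []            = []
elements (inside  ∷ S) = Fin.zero ∷ Vec.map Fin.suc (elements S)
elements (outside ∷ S) = Vec.map Fin.suc (elements S)

-- The i-th smallest element of S becomes vertex i.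
induced : ∀ {n} → Graph n → (S : Subset n) → Graph ∣ S ∣
induced G S = record
  { adj        = λ i j → adj G (lookup (elements S) i) (lookup (elements S) j)
  ; adj-sym    = λ i j → adj-sym G (lookup (elements S) i) (lookup (elements S) j)
  ; adj-irrefl = λ i → adj-irrefl G (lookup (elements S) i)
  }

_-Hamiltonian_ : ∀ {n} → ℕ → Graph n → Set
_-Hamiltonian_ {n} k G = ∀ (S : Subset n) → ∣ S ∣ ℕ.≤ k → Hamiltonian (induced G (∁ S))

K : ∀ s → Graph s
K s = record
  { adj        = λ u v → not (does (u Fin.≟ v))
  ; adj-sym    = λ u v → cong not (≟-sym u v)
  ; adj-irrefl = λ u → cong not (dec-true (u Fin.≟ u) refl)
  }
  where
  ≟-sym : (u v : Fin s) → does (u Fin.≟ v) ≡ does (v Fin.≟ u)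
  ≟-sym u v with u Fin.≟ v
  ... | yes p = sym (dec-true (v Fin.≟ u) (sym p))
  ... | no ¬p = sym (dec-false (v Fin.≟ u) (¬p ∘ sym))

I : ∀ t → Graph t
I t = record
  { adj = λ _ _ → false ; adj-sym = λ _ _ → refl ; adj-irrefl = λ _ → refl }

-- The vertices of G come first; every cross pair has adjacency value c.
combine : Bool → ∀ {m n} → Graph m → Graph n → Graph (m ℕ.+ n)
combine c {m} {n} G H = record
  { adj        = λ u v → a (splitAt m u) (splitAt m v)
  ; adj-sym    = λ u v → a-sym (splitAt m u) (splitAt m v)
  ; adj-irrefl = λ u → a-irrefl (splitAt m u)
  }
  where
  a : Fin m ⊎ Fin n → Fin m ⊎ Fin n → Bool
  a (inj₁ u) (inj₁ v) = adj G u v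
  a (inj₂ u) (inj₂ v) = adj H u v
  a (inj₁ _) (inj₂ _) = c
  a (inj₂ _) (inj₁ _) = c

  a-sym : ∀ u v → a u v ≡ a v u
  a-sym (inj₁ u) (inj₁ v) = adj-sym G u v
  a-sym (inj₂ u) (inj₂ v) = adj-sym H u v
  a-sym (inj₁ _) (inj₂ _) = refl
  a-sym (inj₂ _) (inj₁ _) = refl

  a-irrefl : ∀ u → a u u ≡ false
  a-irrefl (inj₁ u) = adj-irrefl G u
  a-irrefl (inj₂ u) = adj-irrefl H u

infixr 6 _∪_
infixr 5 _∨_
infixl 4 _∖_

_∪_ _∨_ : ∀ {m n} → Graph m → Graph n → Graph (m ℕ.+ n)
_∪_ = combine false
_∨_ = combine true

-- A set of edges is encoded as the spanning subgraph with those edges.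
_∖_ : ∀ {n} → Graph n → Graph n → Graph n
G ∖ E′ = record
  { adj        = λ u v → adj G u v ∧ not (adj E′ u v)
  ; adj-sym    = λ u v → cong₂ (λ p q → p ∧ not q) (adj-sym G u v) (adj-sym E′ u v)
  ; adj-irrefl = λ u → cong (_∧ not (adj E′ u u)) (adj-irrefl G u)
  }

-- Y ∪ Z in K a ∨ (K b ∪ R), where R has c vertices: Y consists of the
-- vertices of K a, Z of those of K b.
data Y∪Z (a b c : ℕ) : Fin (a ℕ.+ (b ℕ.+ c)) → Set where
  inY : (i : Fin a) → Y∪Z a b c (i ↑ˡ (b ℕ.+ c))
  inZ : (j : Fin b) → Y∪Z a b c (a ↑ʳ (j ↑ˡ c))

E₁ : ∀ a b c → Graph (a ℕ.+ (b ℕ.+ c)) →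
     Fin (a ℕ.+ (b ℕ.+ c)) → Fin (a ℕ.+ (b ℕ.+ c)) → Set
E₁ a b c G u v = Adj G u v × Y∪Z a b c u × Y∪Z a b c v

Deletions : ∀ a b c → Graph (a ℕ.+ (b ℕ.+ c)) → ℕ → ∀ {m} → Graph m → Set
Deletions a b c G t G′ = Σ[ E′ ∈ Graph (a ℕ.+ (b ℕ.+ c)) ]
  (∀ u v → Adj E′ u v → E₁ a b c G u v) × edgeCount E′ ℕ.≤ t × G′ ≅ (G ∖ E′)

-- Truncated subtraction is exact below once k ≤ δ and n is large
-- (2δ ≤ n + k for H, δ < n for L); only then do these have n vertices.
H : ∀ n k δ → Graph (δ ℕ.+ ((n ℕ.+ k ∸ 2 ℕ.* δ) ℕ.+ (δ ∸ k)))
H n k δ = K δ ∨ (K (n ℕ.+ k ∸ 2 ℕ.* δ) ∪ I (δ ∸ k))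

L : ∀ n k δ → Graph ((k ℕ.+ 1) ℕ.+ ((n ∸ δ ∸ 1) ℕ.+ (δ ∸ k)))
L n k δ = K (k ℕ.+ 1) ∨ (K (n ∸ δ ∸ 1) ∪ K (δ ∸ k))

𝓗⁽¹⁾ 𝓛⁽¹⁾ : (n k δ : ℕ) → ∀ {m} → Graph m → Set
𝓗⁽¹⁾ n k δ = Deletions δ (n ℕ.+ k ∸ 2 ℕ.* δ) (δ ∸ k) (H n k δ)
                       (δ ℕ.* (δ ∸ k) ℕ./ 4)
𝓛⁽¹⁾ n k δ = Deletions (k ℕ.+ 1) (n ∸ δ ∸ 1) (δ ∸ k) (L n k δ)
                       ((k ℕ.+ 1) ℕ.* (δ ∸ k) ℕ./ 4)

{-# OPTIONS --safe #-}

-- Write s = δ − k. Comparing q(G) with the row sums of D⁻¹ Q D shows that the complement of G has at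
-- most s (n − 1) edges. Suppose that G − S has no Hamilton cycle, where |S| ≤ k, and pass to a
-- supergraph of G − S that still has none but in which any two vertices whose degree sum is at least
-- the order are adjacent (Bondy–Chvátal). Its vertices of large degree form a clique, and counting
-- absent edges leaves exactly s other vertices, the set X. They have degree s and the same
-- neighbours Y′ in the clique, and |S| = k. For 1 < |Y′| < s, Ore's theorem would give a Hamilton
-- cycle; so with Y = S ∪ Y′ either |Y| = k + s = δ and X is independent, or |Y| = k + 1 and X is a
-- clique.
--
-- It remains to see that q(G) < 2 (n − s − 1) if more than |X| |Y| / 4 edges inside Y ∪ Z are absent.
-- Write a vector as a constant a on Y ∪ Z plus a deviation r. Compared with the complete graph on
-- Y ∪ Z, every absent edge lowers the quadratic form of Q by about 4 a², every edge between X and Y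
-- raises it by about a², and for large n all terms in r are dominated by n |r|².

module Submission where

open import Defs
open import Algebra.Bundles using (CommutativeRing)
import Algebra.Properties.Semiring.Mult
import Algebra.Properties.Semiring.Sum
open import Data.Bool.Base as Bool using (Bool; true; false; _∧_; not; T; if_then_else_)
import Data.Bool.Properties as Bool
open import Data.Empty using (⊥; ⊥-elim)
open import Data.Fin.Base as Fin using (Fin)
open import Data.Fin.Permutation using (Permutation; permutation)
import Data.Fin.Properties as Fin
open import Data.Fin.Subset using (Subset; inside; outside; ∁; ∣_∣)
open import Data.Integer.Base as ℤ using ()
import Data.Integer.Properties as ℤ
import Data.Integer.Tactic.RingSolver as ℤ
open import Data.List.Base as List using (List; []; _∷_; _++_; map; length; filterᵇ; allFin; cartesianProduct)
import Data.List.Extrema.Nat as Extrema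
import Data.List.Membership.DecPropositional as DecMembership
open import Data.List.Membership.Propositional using (_∈_)
import Data.List.Membership.Propositional.Properties as ∈
import Data.List.Properties as List
open import Data.List.Relation.Binary.Permutation.Propositional using (_↭_; ↭-refl; ↭-sym; ↭-trans; ↭-prep; ↭-reflexive)
import Data.List.Relation.Binary.Permutation.Propositional.Properties as ↭
open import Data.List.Relation.Unary.All as All using (All; []; _∷_)
import Data.List.Relation.Unary.All.Properties as All
open import Data.List.Relation.Unary.AllPairs using (AllPairs; []; _∷_)
open import Data.List.Relation.Unary.Any using (here; there)
open import Data.List.Relation.Unary.Linked using (Linked; []; [-]; _∷_)
open import Data.List.Relation.Unary.Unique.Propositional using (Unique)
import Data.List.Relation.Unary.Unique.Propositional.Properties as Unique
open import Data.Nat.Base using (ℕ; zero; suc; _+_; _*_; _∸_; _≤_; _<_; _⊔_; z≤n; s≤s; s≤s⁻¹; >-nonZero)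
open import Data.Nat.DivMod as DivMod using (_/_; _%_)
open import Data.Nat.ListAction using (sum)
import Data.Nat.ListAction.Properties as ℕ
import Data.Nat.Properties as ℕ
open import Data.Nat.Tactic.RingSolver using (solve-∀)
open import Data.Product.Base using (∃-syntax; _×_; _,_; proj₁; proj₂)
open import Data.Rational.Base as ℚ using (ℚ; 0ℚ; 1ℚ)
import Data.Rational.Properties as ℚ
import Data.Rational.Unnormalised.Base as ℚᵘ
import Data.Rational.Unnormalised.Properties as ℚᵘ
open import Data.Sum.Base using (_⊎_; inj₁; inj₂; [_,_]′) renaming (map to map⊎)
open import Data.Unit.Base using (tt)
open import Data.Vec.Base as Vec using (Vec; []; _∷_)
import Data.Vec.Properties as Vec
open import Function.Base using (_∘_; id; case_of_)
open import Function.Bundles using (mk⇔; Equivalence)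
open import Level using (0ℓ)
open import Relation.Binary.PropositionalEquality
open import Relation.Nullary.Decidable using (Dec; yes; no; does; map′; T?; _×-dec_; _⊎-dec_; ¬?; dec-true; dec-false; dec⇒maybe; does-⇔; decidable-stable)
open import Relation.Nullary.Negation using (¬_; contradiction)
import Tactic.RingSolver as Ring
open import Tactic.RingSolver.Core.AlmostCommutativeRing using (AlmostCommutativeRing; fromCommutativeRing)

-- Reals are Cauchy sequences here, so neither an eigenbasis nor a variational description of q is
-- at hand. Every spectral bound is therefore an inequality μ · `edgeForm` ≤ 2 ν · |y|² for rational
-- vectors y, and `not-eigenvalue` carries it over to real eigenvectors index by index. A strict gap
-- ν < μ κ absorbs the errors of approximation; all counts being integers, the gap is always at
-- least 1. The threshold κ = 2 (n - s - 1) is the value of q for the complete graph on n - s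
-- vertices. An exceptional graph differs from this clique only in boundedly many pairs inside Y ∪ Z
-- or touching X, so the comparison is decided by terms of bounded size, and the estimates must be
-- exact up to that order. Stability is rigid because four estimates meet: s ≤ degree in G - S ≤
-- degree in the supergraph ≤ |X| ≤ s. Equality throughout means that the supergraph has no new edge
-- at X, so that the structure found there belongs to G. It also shows that all but boundedly many
-- absent edges join X to Z.

-- With solve-∀ for the equation, this derives any linear consequence of an inequality.
linear : ∀ {a b c d} → a ≤ b → c + b ≡ d + a → c ≤ d
linear {a} {b} {c} {d} a≤b eq = ℕ.+-cancelʳ-≤ b c d (begin
  c + b ≡⟨ eq ⟩
  d + a ≤⟨ ℕ.+-monoʳ-≤ d a≤b ⟩
  d + b ∎)
  where open ℕ.≤-Reasoning

-- Sums and counts over lists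

private variable
  V V′ : Set

sumMap : (V → ℕ) → List V → ℕ
sumMap f xs = sum (map f xs)

#_ : Bool → ℕ
# b = if b then 1 else 0

count : (V → Bool) → List V → ℕ
count f = sumMap (λ x → # f x)

sumMap-++ : ∀ (f : V → ℕ) xs ys → sumMap f (xs ++ ys) ≡ sumMap f xs + sumMap f ys
sumMap-++ f xs ys = trans (cong sum (List.map-++ f xs ys)) (ℕ.sum-++ (map f xs) (map f ys))

sumMap-↭ : ∀ (f : V → ℕ) {xs ys} → xs ↭ ys → sumMap f xs ≡ sumMap f ys
sumMap-↭ f p = ℕ.sum-↭ (↭.map⁺ f p)

sumMap-mono : ∀ {f g : V → ℕ} xs → (∀ {x} → x ∈ xs → f x ≤ g x) → sumMap f xs ≤ sumMap g xs
sumMap-mono []       f≤g = z≤n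
sumMap-mono (x ∷ xs) f≤g = ℕ.+-mono-≤ (f≤g (here refl)) (sumMap-mono xs (f≤g ∘ there))

sumMap-cong : ∀ {f g : V → ℕ} xs → (∀ {x} → x ∈ xs → f x ≡ g x) → sumMap f xs ≡ sumMap g xs
sumMap-cong []       f≡g = refl
sumMap-cong (x ∷ xs) f≡g = cong₂ _+_ (f≡g (here refl)) (sumMap-cong xs (f≡g ∘ there))

sumMap-+ : ∀ (f g : V → ℕ) xs → sumMap (λ x → f x + g x) xs ≡ sumMap f xs + sumMap g xs
sumMap-+ f g []       = refl
sumMap-+ f g (x ∷ xs) = trans (cong (f x + g x +_) (sumMap-+ f g xs)) (interchange (f x) _ _ _)
  where
  interchange : ∀ a b c d → a + b + (c + d) ≡ a + c + (b + d)
  interchange = solve-∀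

sumMap-const : ∀ c (xs : List V) → sumMap (λ _ → c) xs ≡ length xs * c
sumMap-const c []       = refl
sumMap-const c (x ∷ xs) = cong (c +_) (sumMap-const c xs)

sumMap-swap : ∀ (f : V → V′ → ℕ) xs ys →
  sumMap (λ x → sumMap (f x) ys) xs ≡ sumMap (λ y → sumMap (λ x → f x y) xs) ys
sumMap-swap f []       ys = sym (trans (sumMap-const 0 ys) (ℕ.*-zeroʳ (length ys)))
sumMap-swap f (x ∷ xs) ys =
  trans (cong (sumMap (f x) ys +_) (sumMap-swap f xs ys)) (sym (sumMap-+ (f x) _ ys))

T-not⁺ : ∀ {b} → ¬ T b → T (not b)
T-not⁺ {true}  ¬b = ¬b tt
T-not⁺ {false} _  = tt

T-not⁻ : ∀ {b} → T (not b) → ¬ T b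
T-not⁻ {false} _ ()

#≤1 : ∀ b → # b ≤ 1
#≤1 true  = ℕ.≤-refl
#≤1 false = z≤n

#-T : ∀ {b} → T b → # b ≡ 1
#-T {true} _ = refl

#-¬T : ∀ {b} → ¬ T b → # b ≡ 0
#-¬T {true}  ¬b = ⊥-elim (¬b tt)
#-¬T {false} _  = refl

#-mono : ∀ {b c} → (T b → T c) → # b ≤ # c
#-mono {true}  {true}  _   = ℕ.≤-refl
#-mono {true}  {false} b⇒c = ⊥-elim (b⇒c tt)
#-mono {false}         _   = z≤n

count≤length : ∀ (f : V → Bool) xs → count f xs ≤ length xs
count≤length f xs = ℕ.≤-trans (sumMap-mono xs (λ {x} _ → #≤1 (f x)))
  (ℕ.≤-reflexive (trans (sumMap-const 1 xs) (ℕ.*-identityʳ _)))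

count-mono : ∀ {f g : V → Bool} xs → (∀ {x} → x ∈ xs → T (f x) → T (g x)) → count f xs ≤ count g xs
count-mono xs f⇒g = sumMap-mono xs (#-mono ∘ f⇒g)

count-not : ∀ (f : V → Bool) xs → count f xs + count (not ∘ f) xs ≡ length xs
count-not f []       = refl
count-not f (x ∷ xs) with f x
... | true  = cong suc (count-not f xs)
... | false = trans (ℕ.+-suc _ _) (cong suc (count-not f xs))

count-all : ∀ (f : V → Bool) xs → (∀ {x} → x ∈ xs → T (f x)) → count f xs ≡ length xs
count-all f xs all = trans (sumMap-cong xs (#-T ∘ all)) (trans (sumMap-const 1 xs) (ℕ.*-identityʳ _))

count-none : ∀ (f : V → Bool) xs → (∀ {x} → x ∈ xs → ¬ T (f x)) → count f xs ≡ 0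
count-none f xs none = trans (sumMap-cong xs (#-¬T ∘ none)) (trans (sumMap-const 0 xs) (ℕ.*-zeroʳ (length xs)))

count≡0⇒none : ∀ (f : V → Bool) xs → count f xs ≡ 0 → ∀ {x} → x ∈ xs → ¬ T (f x)
count≡0⇒none f (x ∷ xs) eq (here refl) fx = contradiction (trans (sym (#-T fx)) (ℕ.m+n≡0⇒m≡0 (# f x) eq)) λ ()
count≡0⇒none f (x ∷ xs) eq (there y∈) fy = count≡0⇒none f xs (ℕ.m+n≡0⇒n≡0 (# f x) eq) y∈ fy

count≡length⇒all : ∀ (f : V → Bool) xs → length xs ≤ count f xs → ∀ {x} → x ∈ xs → T (f x)
count≡length⇒all f xs le {x} x∈ = decidable-stable (T? (f x)) λ ¬fx →
  count≡0⇒none (not ∘ f) xs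
    (ℕ.n≤0⇒n≡0 (ℕ.+-cancelˡ-≤ (count f xs) _ _
      (subst₂ _≤_ (sym (count-not f xs)) (sym (ℕ.+-identityʳ _)) le)))
    x∈ (T-not⁺ ¬fx)

count-++ : ∀ (f : V → Bool) xs ys → count f (xs ++ ys) ≡ count f xs + count f ys
count-++ f = sumMap-++ (λ x → # f x)

-- Head and tail can only grow from `f` to `g`, so a total that does not grow lets neither of them
-- grow. This is how equal degrees show that the supergraph adds no edge at a vertex.
count-≤-agree : ∀ {f g : V → Bool} xs → (∀ {x} → x ∈ xs → T (f x) → T (g x)) →
  count g xs ≤ count f xs → ∀ {x} → x ∈ xs → T (g x) → T (f x)
count-≤-agree {f = f} {g} (y ∷ ys) f⇒g le x∈ gx = go x∈ gx
  where
  tails : count f ys ≤ count g ys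
  tails = count-mono ys (f⇒g ∘ there)
  heads : # f y ≤ # g y
  heads = #-mono (f⇒g (here refl))
  ≤tails : count g ys ≤ count f ys
  ≤tails = ℕ.+-cancelˡ-≤ (# f y) _ _ (ℕ.≤-trans (ℕ.+-monoˡ-≤ _ heads) le)
  ≤heads : # g y ≤ # f y
  ≤heads = ℕ.+-cancelʳ-≤ (count f ys) _ _ (ℕ.≤-trans (ℕ.+-monoʳ-≤ (# g y) tails) le)
  #⁻¹ : ∀ {b c} → # b ≤ # c → T b → T c
  #⁻¹ {true} {true} _ _ = tt
  go : ∀ {x} → x ∈ y ∷ ys → T (g x) → T (f x)
  go (here refl) gx = #⁻¹ ≤heads gx
  go (there x∈) gx = count-≤-agree ys (f⇒g ∘ there) ≤tails x∈ gx

partition-↭ : ∀ (f : V → Bool) xs → xs ↭ filterᵇ f xs ++ filterᵇ (not ∘ f) xs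
partition-↭ f []       = ↭-refl
partition-↭ f (x ∷ xs) with f x
... | true  = ↭-prep x (partition-↭ f xs)
... | false = ↭-trans (↭-prep x (partition-↭ f xs)) (↭-sym (↭.shift x (filterᵇ f xs) _))

length-filterᵇ : ∀ (f : V → Bool) xs → length (filterᵇ f xs) ≡ count f xs
length-filterᵇ f []       = refl
length-filterᵇ f (x ∷ xs) with f x
... | true  = cong suc (length-filterᵇ f xs)
... | false = length-filterᵇ f xs

∈-filterᵇ⁻ : ∀ (f : V → Bool) xs {x} → x ∈ filterᵇ f xs → x ∈ xs × T (f x)
∈-filterᵇ⁻ f xs = ∈.∈-filter⁻ (T? ∘ f)

length-allFin : ∀ n → length (allFin n) ≡ n
length-allFin n = List.length-tabulate {n = n} id

-- Deciding whether some permutation has a property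

insertion? : ∀ (P : List V → Set) → (∀ xs → Dec (P xs)) → ∀ x ys zs →
  Dec (∃[ us ] ∃[ vs ] zs ≡ us ++ vs × P (ys ++ us ++ x ∷ vs))
insertion? P P? x ys []       = map′ (λ p → [] , [] , refl , p) (λ { ([] , [] , refl , p) → p }) (P? (ys ++ x ∷ []))
insertion? P P? x ys (z ∷ zs) = map′
  (λ { (inj₁ p) → [] , z ∷ zs , refl , p
     ; (inj₂ (us , vs , refl , p)) → z ∷ us , vs , refl , subst P (List.++-assoc ys _ _) p })
  (λ { ([] , _ , refl , p) → inj₁ p
     ; (z ∷ us , vs , refl , p) → inj₂ (us , vs , refl , subst P (sym (List.++-assoc ys _ _)) p) })
  (P? (ys ++ x ∷ z ∷ zs) ⊎-dec insertion? P P? x (ys ++ z ∷ []) zs)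

-- A permutation of `x ∷ xs` is one of `xs` with `x` inserted somewhere, so the search recurses with
-- the property that some insertion of `x` succeeds. It makes Hamiltonicity decidable, on which the
-- arguments by contradiction and the greedy closure rest constructively.
permutation? : ∀ (P : List V → Set) → (∀ xs → Dec (P xs)) → ∀ xs → Dec (∃[ ys ] ys ↭ xs × P ys)
permutation? P P? []       = map′ (λ p → [] , ↭-refl , p)
  (λ (ys , ys↭ , p) → subst P (↭.↭-empty-inv ys↭) p) (P? [])
permutation? P P? (x ∷ xs) = map′
  (λ { (_ , ys↭ , us , vs , refl , p) → us ++ x ∷ vs , ↭-trans (↭.shift x us vs) (↭-prep x ys↭) , p })
  (λ (ys , ys↭ , p) → to ys↭ (∈.∈-∃++ (↭.∈-resp-↭ (↭-sym ys↭) (here refl))) p)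
  (permutation? _ (insertion? P P? x []) xs)
  where
  to : ∀ {ys} → ys ↭ x ∷ xs → (∃[ us ] ∃[ vs ] ys ≡ us ++ x ∷ vs) → P ys →
       ∃[ zs ] zs ↭ xs × ∃[ us ] ∃[ vs ] zs ≡ us ++ vs × P (us ++ x ∷ vs)
  to ys↭ (us , vs , refl) p = us ++ vs , ↭.drop-mid us [] ys↭ , us , vs , refl , p

-- Paths with gaps

-- Path R S g a b t: the list a ∷ t runs from a to b, its consecutive pairs being related by R
-- except for g of them (the gaps), which are related by S.
data Path {V : Set} (R S : V → V → Set) : ℕ → V → V → List V → Set where
  []    : ∀ {a} → Path R S 0 a a []
  _∷_   : ∀ {g a b c t} → R a b → Path R S g b c t → Path R S g a c (b ∷ t)
  gap∷_ : ∀ {g a b c t} → S a b × Path R S g b c t → Path R S (suc g) a c (b ∷ t)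

module _ {V : Set} {R S : V → V → Set} where

  path-++ : ∀ {g h a b c d t u} → Path R S g a b t → R b c → Path R S h c d u →
            Path R S (g + h) a d (t ++ c ∷ u)
  path-++ []             r q = r ∷ q
  path-++ (x ∷ p)        r q = x ∷ path-++ p r q
  path-++ (gap∷ (x , p)) r q = gap∷ (x , path-++ p r q)

  path-∷ʳ : ∀ {g a b c t} → Path R S g a b t → R b c → Path R S g a c (t ++ c ∷ [])
  path-∷ʳ []             r = r ∷ []
  path-∷ʳ (x ∷ p)        r = x ∷ path-∷ʳ p r
  path-∷ʳ (gap∷ (x , p)) r = gap∷ (x , path-∷ʳ p r)

  path-∷ʳ-gap : ∀ {g a b c t} → Path R S g a b t → S b c → Path R S (suc g) a c (t ++ c ∷ [])
  path-∷ʳ-gap []             r = gap∷ (r , [])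
  path-∷ʳ-gap (x ∷ p)        r = x ∷ path-∷ʳ-gap p r
  path-∷ʳ-gap (gap∷ (x , p)) r = gap∷ (x , path-∷ʳ-gap p r)

  path-reverse : (∀ {a b} → R a b → R b a) → (∀ {a b} → S a b → S b a) → ∀ {g a b t} →
    Path R S g a b t → ∃[ u ] Path R S g b a u × b ∷ u ↭ a ∷ t
  path-reverse R-sym S-sym [] = [] , [] , ↭-refl
  path-reverse R-sym S-sym {a = a} (x ∷ p) with path-reverse R-sym S-sym p
  ... | u , q , π = u ++ a ∷ [] , path-∷ʳ q (R-sym x) ,
    ↭-trans (↭.++-comm (_ ∷ u) (a ∷ [])) (↭-prep a π)
  path-reverse R-sym S-sym {a = a} (gap∷ (x , p)) with path-reverse R-sym S-sym p
  ... | u , q , π = u ++ a ∷ [] , path-∷ʳ-gap q (S-sym x) ,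
    ↭-trans (↭.++-comm (_ ∷ u) (a ∷ [])) (↭-prep a π)

  path-last : ∀ {g a b t} → Path R S g a b t → b ∈ a ∷ t
  path-last []             = here refl
  path-last (x ∷ p)        = there (path-last p)
  path-last (gap∷ (x , p)) = there (path-last p)

  split-at-gap : ∀ {g a b t} → Path R S (suc g) a b t →
    ∃[ x ] ∃[ y ] ∃[ u ] ∃[ v ] Path R S 0 a x u × S x y × Path R S g y b v × t ≡ u ++ y ∷ v
  split-at-gap (gap∷ (r , p)) = _ , _ , [] , _ , [] , r , p , refl
  split-at-gap (r ∷ p) with split-at-gap p
  ... | x , y , u , v , p₁ , s , p₂ , refl = x , y , _ ∷ u , v , r ∷ p₁ , s , p₂ , refl

  Crossing : (f h : V → Bool) → ℕ → V → V → List V → Set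
  Crossing f h g a b t = ∃[ x ] ∃[ y ] ∃[ u ] ∃[ v ] ∃[ g₁ ] ∃[ g₂ ] T (h x) × T (f y) ×
    Path R S g₁ a x u × Path R S g₂ y b v × t ≡ u ++ y ∷ v × g₁ + g₂ ≤ g

  module _ (f h : V → Bool) where

    crossing-∷ : ∀ d {g a b c t} → (∀ {g c t} → Path R S g b c t → Path R S (d + g) a c (b ∷ t)) →
      Crossing f h g b c t → Crossing f h (d + g) a c (b ∷ t)
    crossing-∷ d cons (x , y , u , v , g₁ , g₂ , hx , fy , p₁ , p₂ , refl , le) =
      x , y , _ ∷ u , v , d + g₁ , g₂ , hx , fy , cons p₁ , p₂ , refl ,
      ℕ.≤-trans (ℕ.≤-reflexive (ℕ.+-assoc d g₁ g₂)) (ℕ.+-monoʳ-≤ d le)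

    -- `d` is the number of gaps in the new first step. If `h` marks the start of this step and `f`
    -- its end, the crossing is here. Otherwise the step carries at most one mark, and dropping it
    -- shortens the path by one, so the surplus of marks survives.
    crossing-step : ∀ d {g a b c t} → (∀ {g c t} → Path R S g b c t → Path R S (d + g) a c (b ∷ t)) →
      Path R S g b c t → (length t < count f t + count h (b ∷ t) → Crossing f h g b c t) →
      length (b ∷ t) < count f (b ∷ t) + count h (a ∷ b ∷ t) → Crossing f h (d + g) a c (b ∷ t)
    crossing-step d {g} {a} {b} {t = t} cons p rest le with h a in ha | f b in fb
    ... | true  | true  = a , b , [] , t , 0 , g , subst T (sym ha) tt , subst T (sym fb) tt , [] , p , refl , ℕ.m≤n+m g d
    ... | true  | false = crossing-∷ d cons (rest (s≤s⁻¹ (subst (suc (length t) <_) (ℕ.+-suc _ _) le)))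
    ... | false | true  = crossing-∷ d cons (rest (s≤s⁻¹ le))
    ... | false | false = crossing-∷ d cons (rest (ℕ.<-trans (ℕ.n<1+n _) le))

    -- Pigeonhole: more than length t marks are distributed over the length t steps of the path.
    split-at-crossing : ∀ {g a b t} → Path R S g a b t → h b ≡ false →
      length t < count f t + count h (a ∷ t) → Crossing f h g a b t
    split-at-crossing []             hb le rewrite hb = contradiction le λ ()
    split-at-crossing (r ∷ p)        hb le = crossing-step 0 (r ∷_) p (split-at-crossing p hb) le
    split-at-crossing (gap∷ (r , p)) hb le = crossing-step 1 (λ q → gap∷ (r , q)) p (split-at-crossing p hb) le

-- Hamilton cycles with heavy pairs

private variable
  n : ℕ

degreeIn : Graph n → List (Fin n) → Fin n → ℕ
degreeIn G U u = count (adj G u) U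

Heavy : Graph n → List (Fin n) → Fin n → Fin n → Set
Heavy G U u v = length U ≤ degreeIn G U u + degreeIn G U v

-- With no gaps only edges of `G` occur; the second relation is carried along so that these cycles
-- and those of Ore's exchange share one type. An edge run back and forth counts as a cycle on two
-- vertices.
HamiltonianOn : Graph n → List (Fin n) → Set
HamiltonianOn G U = ∃[ a ] ∃[ b ] ∃[ t ] Path (Adj G) (Heavy G U) 0 a b t × Adj G b a × a ∷ t ↭ U

Adj-sym : ∀ (G : Graph n) {u v} → Adj G u v → Adj G v u
Adj-sym G {u} {v} = subst T (adj-sym G u v)

Adj⇒≢ : ∀ (G : Graph n) {u v} → Adj G u v → u ≢ v
Adj⇒≢ G {u} uu refl = subst T (adj-irrefl G u) uu

module _ (G : Graph n) (U : List (Fin n)) where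

  private
    GPath = Path (Adj G) (Heavy G U)
    Heavy-sym : ∀ {u v} → Heavy G U u v → Heavy G U v u
    Heavy-sym {u} {v} = subst (length U ≤_) (ℕ.+-comm (degreeIn G U u) (degreeIn G U v))

  -- Ore's exchange: the gap between b and a is closed by reversing a segment.
  close-gap : ∀ {g a b t} → GPath g a b t → Heavy G U b a → a ∷ t ↭ U →
    ∃[ h ] ∃[ c ] ∃[ u ] h ≤ g × GPath h a c u × Adj G c a × a ∷ u ↭ U
  close-gap {g} {a} {b} {t} p heavy π
    with split-at-crossing (adj G a) (adj G b) p (adj-irrefl G b) marks
    where
    marks : length t < count (adj G a) t + count (adj G b) (a ∷ t)
    marks = begin-strict
      length t                                       <⟨ ℕ.n<1+n _ ⟩
      length (a ∷ t)                                 ≡⟨ ↭.↭-length π ⟩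
      length U                                       ≤⟨ Heavy-sym heavy ⟩
      degreeIn G U a + degreeIn G U b                ≡⟨ cong₂ _+_ (sumMap-↭ _ π) (sumMap-↭ _ π) ⟨
      count (adj G a) (a ∷ t) + count (adj G b) (a ∷ t)
        ≡⟨ cong (λ c → # c + count (adj G a) t + count (adj G b) (a ∷ t)) (adj-irrefl G a) ⟩
      count (adj G a) t + count (adj G b) (a ∷ t)    ∎
      where open ℕ.≤-Reasoning
  ... | x , y , u , v , g₁ , g₂ , bx , ay , p₁ , p₂ , refl , le
    with path-reverse (Adj-sym G) (λ {a} {b} → Heavy-sym {a} {b}) p₂
  ...   | w , q , ρ = g₁ + g₂ , y , u ++ b ∷ w , le , path-++ p₁ (Adj-sym G bx) q , Adj-sym G ay ,
    ↭-trans (↭.++⁺ˡ (a ∷ u) ρ) π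

  -- Rotating the cycle makes one of its gaps the closing pair, which `close-gap` then replaces by
  -- an edge without creating gaps. The exchange may remove further gaps, so the recursion is on a
  -- bound `f` for their number.
  close-gaps : ∀ f {g a b t} → g ≤ f → GPath g a b t → Adj G b a → a ∷ t ↭ U → HamiltonianOn G U
  close-gaps f {zero}  g≤f p r π = _ , _ , _ , p , r , π
  close-gaps (suc f) {suc g} {a} (s≤s g≤f) p r π with split-at-gap p
  ... | x , y , u , v , p₁ , xy , p₂ , refl
    with close-gap (subst (λ h → GPath h _ _ _) (ℕ.+-identityʳ g) (path-++ p₂ r p₁)) xy
           (↭-trans (↭.++-comm (y ∷ v) (a ∷ u)) π)
  ...   | h , c , w , h≤g , q , cy , ρ = close-gaps f (ℕ.≤-trans h≤g g≤f) q cy ρ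

  private
    Link : Fin n → Fin n → Set
    Link u v = Adj G u v ⊎ Heavy G U u v

    mark-gaps : ∀ {S a b t} → Path Link S 0 a b t → ∃[ g ] GPath g a b t
    mark-gaps []             = 0 , []
    mark-gaps (inj₁ r ∷ p)   = _ , r ∷ proj₂ (mark-gaps p)
    mark-gaps (inj₂ r ∷ p)   = _ , gap∷ (r , proj₂ (mark-gaps p))

  -- All degrees are taken in `G` itself, so the heavy pairs of the cycle can all be treated as gaps
  -- at once. A heavy closing pair is exchanged first, since `close-gaps` starts from a cycle that
  -- closes along an edge.
  bondy-chvátal : ∀ {S a b t} → Path Link S 0 a b t → Link b a → a ∷ t ↭ U → HamiltonianOn G U
  bondy-chvátal p (inj₁ r) π = close-gaps _ ℕ.≤-refl (proj₂ (mark-gaps p)) r π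
  bondy-chvátal p (inj₂ r) π with close-gap (proj₂ (mark-gaps p)) r π
  ... | h , c , u , _ , q , ca , ρ = close-gaps _ ℕ.≤-refl q ca ρ

path-map : ∀ {V : Set} {R S R′ S′ : V → V → Set} → (∀ {x y} → R x y → R′ x y) →
  ∀ {a b t} → Path R S 0 a b t → Path R′ S′ 0 a b t
path-map f []      = []
path-map f (r ∷ p) = f r ∷ path-map f p

HamiltonianOn-mono : ∀ {G G′ : Graph n} {U} → (∀ {u v} → Adj G u v → Adj G′ u v) →
  HamiltonianOn G U → HamiltonianOn G′ U
HamiltonianOn-mono G⊆G′ (a , b , t , p , r , π) = a , b , t , path-map G⊆G′ p , G⊆G′ r , π

hamiltonianOn? : ∀ (G : Graph n) U → Dec (HamiltonianOn G U)
hamiltonianOn? {n} G U = map′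
  (λ { (a ∷ t , π , b , p , r) → a , b , t , p , r , π })
  (λ (a , b , t , p , r , π) → a ∷ t , π , b , p , r)
  (permutation? Cycle cycle? U)
  where
  Cycle : List (Fin n) → Set
  Cycle []      = ⊥
  Cycle (a ∷ t) = ∃[ b ] Path (Adj G) (Heavy G U) 0 a b t × Adj G b a
  walk? : ∀ z a t → Dec (∃[ b ] Path (Adj G) (Heavy G U) 0 a b t × Adj G b z)
  walk? z a []      = map′ (λ r → a , [] , r) (λ { (_ , [] , r) → r }) (T? (adj G a z))
  walk? z a (b ∷ t) = map′ (λ { (r , c , p , q) → c , r ∷ p , q }) (λ { (c , r ∷ p , q) → r , c , p , q })
    (T? (adj G a b) ×-dec walk? z b t)
  cycle? : ∀ xs → Dec (Cycle xs)
  cycle? []      = no λ ()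
  cycle? (a ∷ t) = walk? a a t

-- Adding edges and the Ore closure

T-does⁻ : (a? : Dec V) → T (does a?) → V
T-does⁻ (yes a) _ = a

T-does⁺ : (a? : Dec V) → V → T (does a?)
T-does⁺ (yes _) _ = tt
T-does⁺ (no ¬a) a = ⊥-elim (¬a a)

IsEdge : Fin n → Fin n → Fin n → Fin n → Set
IsEdge u v x y = x ≢ y × (x ≡ u × y ≡ v ⊎ x ≡ v × y ≡ u)

isEdge? : ∀ (u v x y : Fin n) → Dec (IsEdge u v x y)
isEdge? u v x y = ¬? (x Fin.≟ y) ×-dec
  ((x Fin.≟ u ×-dec y Fin.≟ v) ⊎-dec (x Fin.≟ v ×-dec y Fin.≟ u))

isEdge-sym : ∀ {u v x y : Fin n} → IsEdge u v x y → IsEdge u v y x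
isEdge-sym (x≢y , inj₁ (p , q)) = x≢y ∘ sym , inj₂ (q , p)
isEdge-sym (x≢y , inj₂ (p , q)) = x≢y ∘ sym , inj₁ (q , p)

_⟨_↔_⟩ : Graph n → Fin n → Fin n → Graph n
G ⟨ u ↔ v ⟩ = record
  { adj        = λ x y → adj G x y Bool.∨ does (isEdge? u v x y)
  ; adj-sym    = λ x y → cong₂ Bool._∨_ (adj-sym G x y)
      (does-⇔ (mk⇔ isEdge-sym isEdge-sym) (isEdge? u v x y) (isEdge? u v y x))
  ; adj-irrefl = λ x → cong₂ Bool._∨_ (adj-irrefl G x) (dec-false (isEdge? u v x x) λ (x≢x , _) → x≢x refl)
  }

module _ {u v : Fin n} where

  ∨ˡ : ∀ {b c} → T b → T (b Bool.∨ c)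
  ∨ˡ {true} _ = tt

  ↔-⊇ : ∀ (G : Graph n) {x y} → Adj G x y → Adj (G ⟨ u ↔ v ⟩) x y
  ↔-⊇ G = ∨ˡ

  ↔-mono : ∀ {G G′ : Graph n} → (∀ {x y} → Adj G x y → Adj G′ x y) →
    ∀ {x y} → Adj (G ⟨ u ↔ v ⟩) x y → Adj (G′ ⟨ u ↔ v ⟩) x y
  ↔-mono {G} {G′} G⊆G′ {x} {y} = Equivalence.from Bool.T-∨ ∘ map⊎ G⊆G′ id ∘ Equivalence.to Bool.T-∨

  ↔⁻ : ∀ (G : Graph n) {x y} → Adj (G ⟨ u ↔ v ⟩) x y → Adj G x y ⊎ IsEdge u v x y
  ↔⁻ G {x} {y} = map⊎ id (T-does⁻ (isEdge? u v x y)) ∘ Equivalence.to Bool.T-∨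

  ↔⁺ : ∀ (G : Graph n) → u ≢ v → Adj (G ⟨ u ↔ v ⟩) u v
  ↔⁺ G u≢v = Equivalence.from Bool.T-∨
    (inj₂ (T-does⁺ (isEdge? u v u v) (u≢v , inj₁ (refl , refl))))

module _ (U : List (Fin n)) where

  private
    Saturated : Graph n → Fin n → Fin n → Set
    Saturated G u v = Adj G u v ⊎ HamiltonianOn (G ⟨ u ↔ v ⟩) U

  -- Greedy: a pair is added unless that creates a Hamilton cycle. A rejected pair stays saturated
  -- later, because its cycle survives in every supergraph.
  maximal-nonHamiltonian : ∀ (G : Graph n) ps → ¬ HamiltonianOn G U →
    ∃[ G* ] (∀ {x y} → Adj G x y → Adj G* x y) × ¬ HamiltonianOn G* U ×
      (∀ {u v} → (u , v) ∈ ps → u ≢ v → Saturated G* u v)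
  maximal-nonHamiltonian G []             ¬ham = G , id , ¬ham , λ ()
  maximal-nonHamiltonian G ((u , v) ∷ ps) ¬ham with hamiltonianOn? (G ⟨ u ↔ v ⟩) U
  ... | yes ham with maximal-nonHamiltonian G ps ¬ham
  ...   | G* , G⊆ , ¬ham* , sat = G* , G⊆ , ¬ham* ,
    λ { (here refl) _ → inj₂ (HamiltonianOn-mono {G = G ⟨ u ↔ v ⟩} {G* ⟨ u ↔ v ⟩} (↔-mono {G = G} {G*} G⊆) ham)
      ; (there p) → sat p }
  maximal-nonHamiltonian G ((u , v) ∷ ps) ¬ham | no ¬ham′ with maximal-nonHamiltonian (G ⟨ u ↔ v ⟩) ps ¬ham′
  ...   | G* , G⊆ , ¬ham* , sat = G* , G⊆ ∘ ↔-⊇ G , ¬ham* ,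
    λ { (here refl) u≢v → inj₁ (G⊆ (↔⁺ G u≢v))
      ; (there p) → sat p }

  heavy-edge-redundant : ∀ (G : Graph n) {u v} → Heavy G U u v →
    HamiltonianOn (G ⟨ u ↔ v ⟩) U → HamiltonianOn G U
  heavy-edge-redundant G {u} {v} heavy (a , b , t , p , r , π) =
    bondy-chvátal G U {S = λ _ _ → ⊥} (path-map link p) (link r) π
    where
    link : ∀ {x y} → Adj (G ⟨ u ↔ v ⟩) x y → Adj G x y ⊎ Heavy G U x y
    link xy with ↔⁻ G xy
    ... | inj₁ adj                      = inj₁ adj
    ... | inj₂ (_ , inj₁ (refl , refl)) = inj₂ heavy
    ... | inj₂ (_ , inj₂ (refl , refl)) = inj₂ (subst (length U ≤_) (ℕ.+-comm (degreeIn G U u) _) heavy)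

  -- In a maximal graph without a Hamilton cycle, adding a missing pair creates one; for a heavy
  -- pair that cycle could be rerouted inside the graph itself. Degrees may thus be taken in the
  -- final graph, and no iteration with changing degrees is required.
  ore-closure : ∀ (G : Graph n) → ¬ HamiltonianOn G U →
    ∃[ G* ] (∀ {x y} → Adj G x y → Adj G* x y) × ¬ HamiltonianOn G* U ×
      (∀ {u v} → u ≢ v → Heavy G* U u v → Adj G* u v)
  ore-closure G ¬ham with maximal-nonHamiltonian G (cartesianProduct (allFin n) (allFin n)) ¬ham
  ... | G* , G⊆ , ¬ham* , sat = G* , G⊆ , ¬ham* , λ {u} {v} u≢v heavy →
    case sat (∈.∈-cartesianProduct⁺ (∈.∈-allFin u) (∈.∈-allFin v)) u≢v of λ where
      (inj₁ adj) → adj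
      (inj₂ ham) → contradiction (heavy-edge-redundant G* heavy ham) ¬ham*

clique-path : ∀ {R S : V → V → Set} a t → AllPairs R (a ∷ t) → ∃[ b ] Path R S 0 a b t
clique-path a []      _                   = a , []
clique-path a (b ∷ t) ((r ∷ _) ∷ rs) with clique-path b t rs
... | c , p = c , r ∷ p

AllPairs-distinct : ∀ {R : V → V → Set} {xs} → Unique xs →
  (∀ {x y} → x ∈ xs → y ∈ xs → x ≢ y → R x y) → AllPairs R xs
AllPairs-distinct []           f = []
AllPairs-distinct (x∉ ∷ uniq) f =
  All.tabulate (λ y∈ → f (here refl) (there y∈) (All.lookup x∉ y∈)) ∷
  AllPairs-distinct uniq (λ x∈ y∈ → f (there x∈) (there y∈))

complete⇒hamiltonianOn : ∀ (G : Graph n) {U} → Unique U → 2 ≤ length U →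
  (∀ {u v} → u ∈ U → v ∈ U → u ≢ v → Adj G u v) → HamiltonianOn G U
complete⇒hamiltonianOn G {a ∷ []} _ (s≤s ())
complete⇒hamiltonianOn G {a ∷ b ∷ t} uniq@(a∉ ∷ uniq′) _ complete
  with clique-path {S = Heavy G (a ∷ b ∷ t)} b t (AllPairs-distinct uniq′ (λ u∈ v∈ → complete (there u∈) (there v∈)))
... | c , p = a , c , b ∷ t , complete (here refl) (there (here refl)) (All.lookup a∉ (here refl)) ∷ p ,
  complete (there (path-last p)) (here refl) (All.lookup a∉ (path-last p) ∘ sym) , ↭-refl

-- Dense graphs without a Hamilton cycle

AllPairs-resp-↭ : ∀ {R : V → V → Set} → (∀ {x y} → R x y → R y x) → ∀ {xs ys} → xs ↭ ys →
  AllPairs R xs → AllPairs R ys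
AllPairs-resp-↭ R-sym _↭_.refl         rs                       = rs
AllPairs-resp-↭ R-sym (_↭_.prep x p)   (r ∷ rs)                 = ↭.All-resp-↭ p r ∷ AllPairs-resp-↭ R-sym p rs
AllPairs-resp-↭ R-sym (_↭_.swap x y p) ((r₁ ∷ r₂) ∷ r₃ ∷ rs)    =
  (R-sym r₁ ∷ ↭.All-resp-↭ p r₃) ∷ ↭.All-resp-↭ p r₂ ∷ AllPairs-resp-↭ R-sym p rs
AllPairs-resp-↭ R-sym (_↭_.trans p q)  rs                       = AllPairs-resp-↭ R-sym q (AllPairs-resp-↭ R-sym p rs)

Unique-resp-↭ : ∀ {xs ys : List V} → xs ↭ ys → Unique xs → Unique ys
Unique-resp-↭ = AllPairs-resp-↭ (_∘ sym)

AllPairs-++⁻ˡ : ∀ {R : V → V → Set} xs {ys} → AllPairs R (xs ++ ys) → AllPairs R xs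
AllPairs-++⁻ˡ []       rs       = []
AllPairs-++⁻ˡ (x ∷ xs) (r ∷ rs) = All.++⁻ˡ xs r ∷ AllPairs-++⁻ˡ xs rs

AllPairs-++⁻ʳ : ∀ {R : V → V → Set} xs {ys} → AllPairs R (xs ++ ys) → AllPairs R ys
AllPairs-++⁻ʳ []       rs       = rs
AllPairs-++⁻ʳ (x ∷ xs) (r ∷ rs) = AllPairs-++⁻ʳ xs rs

AllPairs-++⁻ : ∀ {R : V → V → Set} xs {ys} → AllPairs R (xs ++ ys) →
  ∀ {x y} → x ∈ xs → y ∈ ys → R x y
AllPairs-++⁻ (x ∷ xs) (r ∷ rs) (here refl) y∈ = All.lookup (All.++⁻ʳ xs r) y∈
AllPairs-++⁻ (x ∷ xs) (r ∷ rs) (there x∈)  y∈ = AllPairs-++⁻ xs rs x∈ y∈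

count-positive : ∀ (f : V → Bool) {xs x} → x ∈ xs → T (f x) → 1 ≤ count f xs
count-positive f {xs} x∈ fx = ℕ.n≢0⇒n>0 λ eq → count≡0⇒none f xs eq x∈ fx

count-two : ∀ (f : V → Bool) {xs x y} → x ∈ xs → y ∈ xs → x ≢ y → T (f x) → T (f y) → 2 ≤ count f xs
count-two f (here refl) (here refl) x≢y fx fy = contradiction refl x≢y
count-two f (here refl) (there y∈)  x≢y fx fy =
  ℕ.+-mono-≤ (ℕ.≤-reflexive (sym (#-T fx))) (count-positive f y∈ fy)
count-two f (there x∈)  (here refl) x≢y fx fy =
  ℕ.+-mono-≤ (ℕ.≤-reflexive (sym (#-T fy))) (count-positive f x∈ fx)
count-two f {z ∷ _} (there x∈) (there y∈) x≢y fx fy =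
  ℕ.≤-trans (count-two f x∈ y∈ x≢y fx fy) (ℕ.m≤n+m _ (# f z))

count-all-but-one : ∀ (f : V → Bool) {xs x} → Unique xs → (∀ {y} → y ∈ xs → x ≢ y → T (f y)) → x ∈ xs →
  length xs ≤ suc (count f xs)
count-all-but-one f {x ∷ xs} (x∉ ∷ uniq) all (here refl) = s≤s (ℕ.≤-trans
  (ℕ.≤-reflexive (sym (count-all f xs λ y∈ → all (there y∈) (All.lookup x∉ y∈)))) (ℕ.m≤n+m _ (# f x)))
count-all-but-one f {z ∷ xs} {x} (z∉ ∷ uniq) all (there x∈) = ℕ.≤-trans
  (s≤s (count-all-but-one f uniq (all ∘ there) x∈))
  (ℕ.≤-reflexive (cong (λ i → suc (i + count f xs)) (sym (#-T (all (here refl) (λ x≡z → All.lookup z∉ x∈ (sym x≡z)))))))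

rotate : ∀ (G : Graph n) {U x} → HamiltonianOn G U → x ∈ U →
  ∃[ b ] ∃[ t ] Path (Adj G) (Heavy G U) 0 x b t × Adj G b x × x ∷ t ↭ U
rotate G {U} {x} (a , b , t , p , ba , π) x∈ with ↭.∈-resp-↭ (↭-sym π) x∈
... | here refl = b , t , p , ba , π
... | there x∈t = go p x∈t
  where
  split : ∀ {a t} → Path (Adj G) (Heavy G U) 0 a b t → x ∈ t →
    ∃[ c ] ∃[ u ] ∃[ v ] Path (Adj G) (Heavy G U) 0 a c u × Adj G c x × Path (Adj G) (Heavy G U) 0 x b v × t ≡ u ++ x ∷ v
  split {a} (r ∷ p) (here refl) = a , [] , _ , [] , r , p , refl
  split (r ∷ p) (there x∈) with split p x∈
  ... | c , u , v , p₁ , cx , p₂ , refl = c , _ ∷ u , v , r ∷ p₁ , cx , p₂ , refl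
  go : Path (Adj G) (Heavy G U) 0 a b t → x ∈ t →
    ∃[ b ] ∃[ t ] Path (Adj G) (Heavy G U) 0 x b t × Adj G b x × x ∷ t ↭ U
  go p x∈ with split p x∈
  ... | c , u , v , p₁ , cx , p₂ , refl = c , v ++ a ∷ u , path-++ p₂ ba p₁ , cx ,
    ↭-trans (↭.++-comm (x ∷ v) (a ∷ u)) π

-- X, Y, Z are those of the paper; the two cases of XX are the subgraphs of H and of L.
record Structure (k s : ℕ) (G : Graph n) : Set where
  field
    X Y Z  : List (Fin n)
    cover  : Y ++ Z ++ X ↭ allFin n
    |X|    : length X ≡ s
    XY     : ∀ {x y} → x ∈ X → y ∈ Y → Adj G x y
    XZ     : ∀ {x z} → x ∈ X → z ∈ Z → ¬ Adj G x z
    XX     : (length Y ≡ k + s × (∀ {x y} → x ∈ X → y ∈ X → ¬ Adj G x y)) ⊎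
             (length Y ≡ k + 1 × (∀ {x y} → x ∈ X → y ∈ X → x ≢ y → Adj G x y))

-- Bounds the number of vertices of degree below m / 2, where m is the order of G - S. Each has more
-- than m / 2 non-neighbours, there are at most n + 2 s n ordered pairs of non-neighbours, and n ≤ 2
-- m: hence 4 (1 + 2 s).
lowBound : ℕ → ℕ
lowBound s = 4 + 8 * s

-- With c for `lowBound s`, the products 4 c² + 2 c k are the error terms in `|A|≤s`. The terms 2 c
-- + 2 k ensure that deleting `D` leaves 2 c < m and n ≤ 2 m.
stabilityBound : ℕ → ℕ → ℕ
stabilityBound k s = 4 * (lowBound s * lowBound s) + 2 * (lowBound s * k) + 2 * lowBound s + 2 * k

module Stability {n} (k s : ℕ) (1≤s : 1 ≤ s) (G G* : Graph n) (U D : List (Fin n))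
  (U++D : U ++ D ↭ allFin n) (|D|≤k : length D ≤ k)
  (minDeg : ∀ v → k + s ≤ degreeIn G (allFin n) v)
  (dense : n * n ≤ sumMap (degreeIn G (allFin n)) (allFin n) + (n + 2 * s * n))
  (large : stabilityBound k s < n)
  (G⊆G* : ∀ {u v} → Adj G u v → Adj G* u v)
  (¬ham : ¬ HamiltonianOn G* U)
  (heavy⇒adj : ∀ {u v} → u ≢ v → Heavy G* U u v → Adj G* u v)
  where

  open ℕ.≤-Reasoning

  m c : ℕ
  m = length U
  c = lowBound s

  d : Fin n → ℕ
  d = degreeIn G* U

  low : Fin n → Bool
  low u = does (2 * d u ℕ.<? m)

  A B : List (Fin n)
  A = filterᵇ low U
  B = filterᵇ (not ∘ low) U

  co : List (Fin n) → Fin n → ℕ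
  co xs u = count (not ∘ adj G* u) xs

  U↭A++B : U ↭ A ++ B
  U↭A++B = partition-↭ low U

  split-m : m ≡ length A + length B
  split-m = trans (↭.↭-length U↭A++B) (List.length-++ A)

  split-n : n ≡ m + length D
  split-n = trans (sym (length-allFin n)) (trans (sym (↭.↭-length U++D)) (List.length-++ U))

  split-d : ∀ u → d u ≡ degreeIn G* A u + degreeIn G* B u
  split-d u = trans (sumMap-↭ _ U↭A++B) (sumMap-++ _ A B)

  A-low : ∀ {a} → a ∈ A → 2 * d a < m
  A-low {a} a∈ = T-does⁻ (2 * d a ℕ.<? m) (proj₂ (∈-filterᵇ⁻ low U a∈))

  B-high : ∀ {b} → b ∈ B → m ≤ 2 * d b
  B-high {b} b∈ = ℕ.≮⇒≥ λ lt →
    T-not⁻ (proj₂ (∈-filterᵇ⁻ (not ∘ low) U b∈)) (T-does⁺ (2 * d b ℕ.<? m) lt)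

  A≢B : ∀ {a b} → a ∈ A → b ∈ B → a ≢ b
  A≢B a∈ b∈ refl = ℕ.<⇒≱ (A-low a∈) (B-high b∈)

  unique-AB : Unique (A ++ B)
  unique-AB = Unique-resp-↭ U↭A++B (AllPairs-++⁻ˡ U (Unique-resp-↭ (↭-sym U++D) (Unique.allFin⁺ n)))

  unique-B : Unique B
  unique-B = AllPairs-++⁻ʳ A unique-AB

  double-≤ : ∀ {a b m} → m ≤ 2 * a → m ≤ 2 * b → m ≤ a + b
  double-≤ {a} {b} {m} p q = ℕ.*-cancelˡ-≤ 2 (linear (ℕ.+-mono-≤ p q) (eq a b m))
    where
    eq : ∀ a b m → 2 * m + (2 * a + 2 * b) ≡ 2 * (a + b) + (m + m)
    eq = solve-∀

  B-adj : ∀ {b b′} → b ∈ B → b′ ∈ B → b ≢ b′ → Adj G* b b′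
  B-adj {b} {b′} b∈ b′∈ b≢b′ = heavy⇒adj b≢b′ (double-≤ {d b} {d b′} (B-high b∈) (B-high b′∈))

  B-clique : AllPairs (Adj G*) B
  B-clique = AllPairs-distinct unique-B B-adj

  degree+co : ∀ xs u → degreeIn G* xs u + co xs u ≡ length xs
  degree+co xs u = count-not (adj G* u) xs

  all : List (Fin n)
  all = allFin n

  -- `co` counts a vertex among its own non-neighbours; the summand n stands for this diagonal.
  co-all : sumMap (co all) all ≤ n + 2 * s * n
  co-all = linear dense* (trans (eq (sumMap (co all) all) dG (n + 2 * s * n)) (cong (n + 2 * s * n +_) total))
    where
    dG = sumMap (degreeIn G* all) all
    dense* : n * n ≤ dG + (n + 2 * s * n)
    dense* = ℕ.≤-trans dense (ℕ.+-monoˡ-≤ _ (sumMap-mono all λ _ → count-mono all λ _ → G⊆G*))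
    total : dG + sumMap (co all) all ≡ n * n
    total = trans (sym (sumMap-+ _ _ all)) (trans (sumMap-cong all λ {u} _ → trans (degree+co all u) (length-allFin n))
      (trans (sumMap-const n all) (cong (_* n) (length-allFin n))))
    eq : ∀ a b c → a + (b + c) ≡ c + (b + a)
    eq = solve-∀

  sumMap-⊆ : ∀ (f : Fin n → ℕ) → sumMap f U ≤ sumMap f all
  sumMap-⊆ f = begin
    sumMap f U                ≤⟨ ℕ.m≤m+n _ _ ⟩
    sumMap f U + sumMap f D   ≡⟨ sumMap-++ f U D ⟨
    sumMap f (U ++ D)         ≡⟨ sumMap-↭ f U++D ⟩
    sumMap f all              ∎

  co-U : sumMap (co U) U ≤ n + 2 * s * n
  co-U = begin
    sumMap (co U) U     ≤⟨ sumMap-mono U (λ _ → sumMap-⊆ _) ⟩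
    sumMap (co all) U   ≤⟨ sumMap-⊆ _ ⟩
    sumMap (co all) all ≤⟨ co-all ⟩
    n + 2 * s * n       ∎

  co-U-split : ∀ u → co U u ≡ co A u + co B u
  co-U-split u = trans (sumMap-↭ _ U↭A++B) (sumMap-++ _ A B)

  c≤bound : 2 * c + 2 * k < n
  c≤bound = ℕ.≤-<-trans (linear (z≤n {4 * (c * c) + 2 * (c * k)}) (eq c k)) large
    where
    eq : ∀ c k → 2 * c + 2 * k + (4 * (c * c) + 2 * (c * k)) ≡ 4 * (c * c) + 2 * (c * k) + 2 * c + 2 * k + 0
    eq = solve-∀

  m+k≥n : n ≤ m + k
  m+k≥n = ℕ.≤-trans (ℕ.≤-reflexive split-n) (ℕ.+-monoʳ-≤ m |D|≤k)

  2c<m : 2 * c < m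
  2c<m = linear (ℕ.≤-trans c≤bound (ℕ.≤-trans m+k≥n (ℕ.m≤m+n _ k))) (eq c k m)
    where
    eq : ∀ c k m → suc (2 * c) + (m + k + k) ≡ m + suc (2 * c + 2 * k)
    eq = solve-∀

  2k≤n : 2 * k ≤ n
  2k≤n = ℕ.≤-trans (ℕ.m≤n+m (2 * k) (2 * c)) (ℕ.<⇒≤ c≤bound)

  n≤2m : n ≤ 2 * m
  n≤2m = linear (ℕ.+-mono-≤ (ℕ.+-mono-≤ m+k≥n m+k≥n) 2k≤n) (eq n m k)
    where
    eq : ∀ n m k → n + (m + k + (m + k) + n) ≡ 2 * m + (n + n + 2 * k)
    eq = solve-∀

  |A| |B| : ℕ
  |A| = length A
  |B| = length B

  sumMap-A : ∀ (f : Fin n → ℕ) → sumMap f U ≡ sumMap f A + sumMap f B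
  sumMap-A f = trans (sumMap-↭ f U↭A++B) (sumMap-++ f A B)

  |A|≤c : |A| ≤ c
  |A|≤c = ℕ.*-cancelʳ-≤ |A| c n {{>-nonZero (ℕ.≤-<-trans z≤n large)}} (begin
    |A| * n                        ≤⟨ ℕ.*-monoʳ-≤ |A| n≤2m ⟩
    |A| * (2 * m)                  ≡⟨ eq₁ |A| m ⟩
    2 * (|A| * m)                  ≤⟨ ℕ.*-monoʳ-≤ 2 sum-A ⟩
    2 * (n + 2 * s * n + (n + 2 * s * n)) ≡⟨ eq₂ s n ⟩
    c * n                          ∎)
    where
    eq₁ : ∀ a m → a * (2 * m) ≡ 2 * (a * m)
    eq₁ = solve-∀
    eq₂ : ∀ s n → 2 * (n + 2 * s * n + (n + 2 * s * n)) ≡ (4 + 8 * s) * n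
    eq₂ = solve-∀
    co-large : ∀ {a} → a ∈ A → m ≤ co U a + co U a
    co-large {a} a∈ = subst (_≤ co U a + co U a) (degree+co U a)
      (linear (ℕ.<⇒≤ (subst (2 * d a <_) (sym (degree+co U a)) (A-low a∈))) (eq (d a) (co U a)))
      where
      eq : ∀ d c → d + c + (d + c) ≡ c + c + 2 * d
      eq = solve-∀
    sum-A : |A| * m ≤ n + 2 * s * n + (n + 2 * s * n)
    sum-A = begin
      |A| * m                               ≡⟨ sumMap-const m A ⟨
      sumMap (λ _ → m) A                    ≤⟨ sumMap-mono A co-large ⟩
      sumMap (λ a → co U a + co U a) A      ≡⟨ sumMap-+ (co U) (co U) A ⟩
      sumMap (co U) A + sumMap (co U) A     ≤⟨ ℕ.+-mono-≤ A≤ A≤ ⟩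
      n + 2 * s * n + (n + 2 * s * n)       ∎
      where
      A≤ : sumMap (co U) A ≤ n + 2 * s * n
      A≤ = begin
        sumMap (co U) A                     ≤⟨ ℕ.m≤m+n _ _ ⟩
        sumMap (co U) A + sumMap (co U) B   ≡⟨ sumMap-A (co U) ⟨
        sumMap (co U) U                     ≤⟨ co-U ⟩
        n + 2 * s * n                       ∎

  B-degree : ∀ {b} → b ∈ B → |B| ≤ suc (degreeIn G* B b)
  B-degree {b} b∈ = count-all-but-one (adj G* b) unique-B (B-adj b∈) b∈

  -- A vertex of `A` with more than |A| neighbours forms a heavy pair with each vertex of the clique
  -- `B`, whose degree is at least |B| - 1. It is then adjacent to all of `B`, which is more than
  -- half of the graph, although its degree is below half.
  A-degree : ∀ {a} → a ∈ A → d a ≤ |A|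
  A-degree {a} a∈ = ℕ.≮⇒≥ λ |A|<d → ℕ.<⇒≱ 2c<m (begin
      m               ≡⟨ split-m ⟩
      |A| + |B|       ≤⟨ linear (ℕ.<⇒≤ (subst (2 * d a <_) split-m (A-low a∈)) ⟨+⟩ (|B|≤d |A|<d ⟨+⟩ |B|≤d |A|<d))
          (eq |A| |B| (d a)) ⟩
      |A| + |A|       ≤⟨ ℕ.+-mono-≤ |A|≤c |A|≤c ⟩
      c + c           ≡⟨ cong (c +_) (ℕ.+-identityʳ c) ⟨
      2 * c           ∎)
    where
    _⟨+⟩_ = ℕ.+-mono-≤
    eq : ∀ a b d → a + b + (a + b + (d + d)) ≡ a + a + (2 * d + (b + b))
    eq = solve-∀
    heavy : |A| < d a → ∀ {b} → b ∈ B → Heavy G* U a b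
    heavy |A|<d {b} b∈ = begin
      m                                  ≡⟨ split-m ⟩
      |A| + |B|                          ≤⟨ ℕ.+-monoʳ-≤ |A| (B-degree b∈) ⟩
      |A| + suc (degreeIn G* B b)        ≡⟨ ℕ.+-suc |A| _ ⟩
      suc |A| + degreeIn G* B b          ≤⟨ ℕ.+-mono-≤ |A|<d
          (ℕ.≤-trans (ℕ.m≤n+m _ (degreeIn G* A b)) (ℕ.≤-reflexive (sym (split-d b)))) ⟩
      d a + d b                          ∎
    |B|≤d : |A| < d a → |B| ≤ d a
    |B|≤d |A|<d = begin
      |B|                                ≡⟨ count-all (adj G* a) B (λ b∈ → heavy⇒adj (A≢B a∈ b∈) (heavy |A|<d b∈)) ⟨
      degreeIn G* B a                    ≤⟨ ℕ.m≤n+m _ (degreeIn G* A a) ⟩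
      degreeIn G* A a + degreeIn G* B a  ≡⟨ split-d a ⟨
      d a                                ∎

  AB-deficit : 2 * sumMap (co B) A ≤ n + 2 * s * n
  AB-deficit = begin
    2 * sumMap (co B) A                       ≡⟨ cong (sumMap (co B) A +_) (ℕ.+-identityʳ _) ⟩
    sumMap (co B) A + sumMap (co B) A         ≡⟨ cong (sumMap (co B) A +_)
        (trans (sumMap-swap _ A B) (sumMap-cong B λ {b} _ → sumMap-cong A λ {a} _ → cong (#_ ∘ not) (adj-sym G* a b)))
        ⟩
    sumMap (co B) A + sumMap (co A) B         ≤⟨ ℕ.+-mono-≤
      (sumMap-mono A λ {a} _ → ℕ.≤-trans (ℕ.m≤n+m _ (co A a)) (ℕ.≤-reflexive (sym (co-U-split a))))
      (sumMap-mono B λ {b} _ → ℕ.≤-trans (ℕ.m≤m+n _ (co B b)) (ℕ.≤-reflexive (sym (co-U-split b)))) ⟩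
    sumMap (co U) A + sumMap (co U) B         ≡⟨ sumMap-A (co U) ⟨
    sumMap (co U) U                           ≤⟨ co-U ⟩
    n + 2 * s * n                             ∎

  -- Each vertex of `A` misses all but at most |A| vertices of `B`. With s + 1 or more such
  -- vertices, these absent pairs, counted in both orders, number about 2 (s + 1) n, against at most
  -- (2 s + 1) n in all. The surplus n would have to be covered by terms bounded in k and s.
  |A|≤s : |A| ≤ s
  |A|≤s = ℕ.≮⇒≥ λ s<|A| → ℕ.<⇒≱ large (begin
    n                                 ≤⟨ linear
        (ℕ.+-mono-≤ (ℕ.+-mono-≤ (ℕ.*-monoʳ-≤ 2 AB) AB-deficit)
        (ℕ.+-mono-≤ (ℕ.*-monoˡ-≤ n (ℕ.*-monoʳ-≤ 2 s<|A|)) (ℕ.*-monoʳ-≤ (2 * |A|) m+k≥n)))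
        (eq₁ n s k |A| |B| m (sumMap (co B) A) split-m) ⟩
    4 * (|A| * |A|) + 2 * (|A| * k)   ≤⟨ ℕ.+-mono-≤ (ℕ.*-monoʳ-≤ 4 (ℕ.*-mono-≤ |A|≤c |A|≤c))
        (ℕ.*-monoʳ-≤ 2 (ℕ.*-monoˡ-≤ k |A|≤c)) ⟩
    4 * (c * c) + 2 * (c * k)         ≤⟨ linear (z≤n {2 * c + 2 * k}) (eq₂ (4 * (c * c) + 2 * (c * k)) c k) ⟩
    stabilityBound k s                ∎)
    where
    eq₁ : ∀ n s k a b m x → m ≡ a + b → n + (2 * (a * a + x) + (n + 2 * s * n) + (2 * a * n + 2 * a * (m + k)))
      ≡ 4 * (a * a) + 2 * (a * k) + (2 * (a * b) + 2 * x + (2 * suc s * n + 2 * a * n))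
    eq₁ n s k a b m x refl = eq n s k a b x
      where
      eq : ∀ n s k a b x → n + (2 * (a * a + x) + (n + 2 * s * n) + (2 * a * n + 2 * a * (a + b + k)))
        ≡ 4 * (a * a) + 2 * (a * k) + (2 * (a * b) + 2 * x + (2 * suc s * n + 2 * a * n))
      eq = solve-∀
    eq₂ : ∀ x c k → x + (2 * c + 2 * k) ≡ x + 2 * c + 2 * k + 0
    eq₂ = solve-∀
    AB : |A| * |B| ≤ |A| * |A| + sumMap (co B) A
    AB = begin
      |A| * |B|                              ≡⟨ sumMap-const |B| A ⟨
      sumMap (λ _ → |B|) A                   ≤⟨ sumMap-mono A (λ {a} a∈ → begin
        |B|                                    ≡⟨ degree+co B a ⟨
        degreeIn G* B a + co B a               ≤⟨ ℕ.+-monoˡ-≤ (co B a)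
            (ℕ.≤-trans (ℕ.m≤n+m _ (degreeIn G* A a)) (ℕ.≤-trans (ℕ.≤-reflexive (sym (split-d a))) (A-degree a∈))) ⟩
        |A| + co B a                           ∎) ⟩
      sumMap (λ a → |A| + co B a) A          ≡⟨ sumMap-+ (λ _ → |A|) (co B) A ⟩
      sumMap (λ _ → |A|) A + sumMap (co B) A ≡⟨ cong (_+ sumMap (co B) A) (sumMap-const |A| A) ⟩
      |A| * |A| + sumMap (co B) A            ∎

  uniqueᵁ : Unique U
  uniqueᵁ = Unique-resp-↭ (↭-sym U↭A++B) unique-AB

  1≤c : 1 ≤ c
  1≤c = s≤s z≤n

  2≤m : 2 ≤ m
  2≤m = ℕ.≤-trans (ℕ.*-monoʳ-≤ 2 1≤c) (ℕ.<⇒≤ 2c<m)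

  A-inhabited : ∃[ a ] a ∈ A
  A-inhabited = go A refl
    where
    go : ∀ xs → A ≡ xs → ∃[ a ] a ∈ A
    go (x ∷ _) A≡ = x , subst (x ∈_) (sym A≡) (here refl)
    go []      A≡ = contradiction
      (complete⇒hamiltonianOn G* uniqueᵁ 2≤m λ u∈ v∈ → B-adj (in-B A≡ u∈) (in-B A≡ v∈)) ¬ham
      where
      in-B : A ≡ [] → ∀ {u} → u ∈ U → u ∈ B
      in-B A≡[] {u} u∈ = subst (λ xs → u ∈ xs ++ B) A≡[] (↭.∈-resp-↭ U↭A++B u∈)

  a₀ : Fin n
  a₀ = proj₁ A-inhabited

  a₀∈A : a₀ ∈ A
  a₀∈A = proj₂ A-inhabited

  A⊆U : ∀ {a} → a ∈ A → a ∈ U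
  A⊆U a∈ = proj₁ (∈-filterᵇ⁻ low U a∈)

  B⊆U : ∀ {b} → b ∈ B → b ∈ U
  B⊆U b∈ = proj₁ (∈-filterᵇ⁻ (not ∘ low) U b∈)

  degree-mono : ∀ u → degreeIn G U u ≤ d u
  degree-mono u = count-mono U λ _ → G⊆G*

  minDegree-split : ∀ a → k + s ≤ degreeIn G U a + degreeIn G D a
  minDegree-split a = ℕ.≤-trans (minDeg a)
    (ℕ.≤-reflexive (trans (sym (sumMap-↭ _ U++D)) (sumMap-++ _ U D)))

  degree-D≤k : ∀ a → degreeIn G D a ≤ k
  degree-D≤k a = ℕ.≤-trans (count≤length (adj G a) D) |D|≤k

  s≤degree : ∀ a → s ≤ degreeIn G U a
  s≤degree a = ℕ.+-cancelˡ-≤ k _ _ (begin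
    k + s                             ≤⟨ minDegree-split a ⟩
    degreeIn G U a + degreeIn G D a   ≤⟨ ℕ.+-monoʳ-≤ (degreeIn G U a) (degree-D≤k a) ⟩
    degreeIn G U a + k                ≡⟨ ℕ.+-comm _ k ⟩
    k + degreeIn G U a                ∎)

  -- The chain s ≤ degree in G ≤ degree in `G*` ≤ |A| ≤ s closes up. Its other equalities are used
  -- below: `D` has k vertices, each adjacent to all of `A`, and `G*` has no new edge at `A`.
  |A|≡s : |A| ≡ s
  |A|≡s = ℕ.≤-antisym |A|≤s (ℕ.≤-trans (s≤degree a₀) (ℕ.≤-trans (degree-mono a₀) (A-degree a₀∈A)))

  d≤s : ∀ {a} → a ∈ A → d a ≤ s
  d≤s a∈ = ℕ.≤-trans (A-degree a∈) |A|≤s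

  d≡s : ∀ {a} → a ∈ A → d a ≡ s
  d≡s {a} a∈ = ℕ.≤-antisym (d≤s a∈) (ℕ.≤-trans (s≤degree a) (degree-mono a))

  k≤degree-D : ∀ {a} → a ∈ A → k ≤ degreeIn G D a
  k≤degree-D {a} a∈ = ℕ.+-cancelʳ-≤ s _ _ (begin
    k + s                             ≤⟨ minDegree-split a ⟩
    degreeIn G U a + degreeIn G D a   ≤⟨ ℕ.+-monoˡ-≤ _ (ℕ.≤-trans (degree-mono a) (d≤s a∈)) ⟩
    s + degreeIn G D a                ≡⟨ ℕ.+-comm s _ ⟩
    degreeIn G D a + s                ∎)

  |D|≡k : length D ≡ k
  |D|≡k = ℕ.≤-antisym |D|≤k (ℕ.≤-trans (k≤degree-D a₀∈A) (count≤length (adj G a₀) D))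

  A-D : ∀ {a v} → a ∈ A → v ∈ D → Adj G a v
  A-D {a} a∈ = count≡length⇒all (adj G a) D (ℕ.≤-trans |D|≤k (k≤degree-D a∈))

  G*⊆G : ∀ {a v} → a ∈ A → v ∈ U → Adj G* a v → Adj G a v
  G*⊆G {a} a∈ = count-≤-agree U (λ _ → G⊆G*) (ℕ.≤-trans (d≤s a∈) (s≤degree a))

  -- One neighbour in `A` lifts the degree of b from |B| - 1 to |B|. Every vertex of `A` has degree
  -- |A|, so b forms a heavy pair with each of them.
  common : ∀ {a a′ b} → a ∈ A → a′ ∈ A → b ∈ B → Adj G* a b → Adj G* a′ b
  common {a} {a′} {b} a∈ a′∈ b∈ ab = heavy⇒adj (A≢B a′∈ b∈) (begin
    m                                          ≡⟨ split-m ⟩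
    |A| + |B|                                  ≤⟨ ℕ.+-mono-≤ (ℕ.≤-reflexive (trans |A|≡s (sym (d≡s a′∈)))) (B-degree b∈) ⟩
    d a′ + suc (degreeIn G* B b)               ≤⟨ ℕ.+-monoʳ-≤ (d a′)
        (ℕ.+-monoˡ-≤ _ (count-positive (adj G* b) a∈ (Adj-sym G* ab))) ⟩
    d a′ + (degreeIn G* A b + degreeIn G* B b) ≡⟨ cong (d a′ +_) (split-d b) ⟨
    d a′ + d b                                 ∎)

  Y′ Z : List (Fin n)
  Y′ = filterᵇ (adj G* a₀) B
  Z  = filterᵇ (not ∘ adj G* a₀) B

  B↭Y′++Z : B ↭ Y′ ++ Z
  B↭Y′++Z = partition-↭ (adj G* a₀) B

  Y′⊆B : ∀ {y} → y ∈ Y′ → y ∈ B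
  Y′⊆B y∈ = proj₁ (∈-filterᵇ⁻ (adj G* a₀) B y∈)

  A-Y′ : ∀ {a y} → a ∈ A → y ∈ Y′ → Adj G* a y
  A-Y′ a∈ y∈ = let y∈B , a₀y = ∈-filterᵇ⁻ (adj G* a₀) B y∈ in common a₀∈A a∈ y∈B a₀y

  A-Z : ∀ {a z} → a ∈ A → z ∈ Z → ¬ Adj G* a z
  A-Z a∈ z∈ az = let z∈B , ¬a₀z = ∈-filterᵇ⁻ (not ∘ adj G* a₀) B z∈ in T-not⁻ ¬a₀z (common a∈ a₀∈A z∈B az)

  degree-B : ∀ {a} → a ∈ A → degreeIn G* B a ≡ length Y′
  degree-B {a} a∈ = begin-equality
    degreeIn G* B a                       ≡⟨ sumMap-↭ _ B↭Y′++Z ⟩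
    degreeIn G* (Y′ ++ Z) a               ≡⟨ sumMap-++ _ Y′ Z ⟩
    degreeIn G* Y′ a + degreeIn G* Z a    ≡⟨ cong₂ _+_ (count-all (adj G* a) Y′ (A-Y′ a∈))
        (count-none (adj G* a) Z (A-Z a∈)) ⟩
    length Y′ + 0                         ≡⟨ ℕ.+-identityʳ _ ⟩
    length Y′                             ∎

  degree-A : ∀ {a} → a ∈ A → degreeIn G* A a + length Y′ ≡ s
  degree-A {a} a∈ = trans (cong (degreeIn G* A a +_) (sym (degree-B a∈))) (trans (sym (split-d a)) (d≡s a∈))

  -- For 2 ≤ |Y′| < s, Ore's theorem gives a Hamilton cycle on A and Y′ without y₂;
  -- the clique y₂ ∷ Z is then spliced in.
  module Splice (y₁ y₂ : Fin n) (Y″ : List (Fin n)) (Y′≡ : Y′ ≡ y₁ ∷ y₂ ∷ Y″)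
    (short : length Y′ < s) where

    P : List (Fin n)
    P = (y₁ ∷ Y″) ++ A

    clique : AllPairs (Adj G*) (y₁ ∷ y₂ ∷ Y″ ++ Z)
    clique = subst (λ Y → AllPairs (Adj G*) (Y ++ Z)) Y′≡ (AllPairs-resp-↭ (Adj-sym G*) B↭Y′++Z B-clique)

    split-U : P ++ y₂ ∷ Z ↭ U
    split-U = ↭-trans (↭-reflexive (List.++-assoc (y₁ ∷ Y″) A (y₂ ∷ Z)))
      (↭-trans (↭.shifts (y₁ ∷ Y″) A)
      (↭-trans (↭.++⁺ˡ A (↭-trans (↭.shift y₂ (y₁ ∷ Y″) Z)
        (↭-trans (_↭_.swap y₂ y₁ ↭-refl) (↭-sym (subst (λ Y → B ↭ Y ++ Z) Y′≡ B↭Y′++Z)))))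
      (↭-sym U↭A++B)))

    ⊆Y′ : ∀ {y} → y ∈ y₁ ∷ Y″ → y ∈ Y′
    ⊆Y′ {y} y∈ = subst (y ∈_) (sym Y′≡) (skip y∈)
      where
      skip : y ∈ y₁ ∷ Y″ → y ∈ y₁ ∷ y₂ ∷ Y″
      skip (here eq)  = here eq
      skip (there y∈) = there (there y∈)

    y₂∈Y′ : y₂ ∈ Y′
    y₂∈Y′ = subst (y₂ ∈_) (sym Y′≡) (there (here refl))

    degree-P : ∀ {a} → a ∈ A → suc (degreeIn G* P a) ≡ s
    degree-P {a} a∈ = begin-equality
      suc (degreeIn G* P a)                                  ≡⟨ cong suc (sumMap-++ _ (y₁ ∷ Y″) A) ⟩
      suc (degreeIn G* (y₁ ∷ Y″) a + degreeIn G* A a)        ≡⟨ cong (λ i → suc (i + degreeIn G* A a))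
          (count-all (adj G* a) (y₁ ∷ Y″) (A-Y′ a∈ ∘ ⊆Y′)) ⟩
      suc (suc (length Y″)) + degreeIn G* A a                ≡⟨ ℕ.+-comm _ (degreeIn G* A a) ⟩
      degreeIn G* A a + suc (suc (length Y″))                ≡⟨ cong (λ Y → degreeIn G* A a + length Y) Y′≡ ⟨
      degreeIn G* A a + length Y′                            ≡⟨ degree-A a∈ ⟩
      s                                                      ∎

    -- Inside `P` each vertex of `A` has degree s - 1, having lost `y₂`. Two of them are heavy as
    -- soon as 2 (s - 1) ≥ |Y′| - 1 + s, which is exactly |Y′| < s. All other pairs are adjacent
    -- already, so the Ore closure is complete.
    hamiltonian-P : HamiltonianOn G* P
    hamiltonian-P = decidable-stable (hamiltonianOn? G* P) λ ¬ham → contra (ore-closure P G* ¬ham)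
      where
      contra : (∃[ G′ ] (∀ {x y} → Adj G* x y → Adj G′ x y) × ¬ HamiltonianOn G′ P ×
               (∀ {u v} → u ≢ v → Heavy G′ P u v → Adj G′ u v)) → ⊥
      contra (G′ , G*⊆G′ , ¬ham′ , heavy⇒adj′) = ¬ham′ (complete⇒hamiltonianOn G′
        (AllPairs-++⁻ˡ P (Unique-resp-↭ (↭-sym split-U) uniqueᵁ))
        (s≤s (ℕ.≤-trans 1≤s (ℕ.≤-trans (ℕ.≤-reflexive (sym |A|≡s))
            (ℕ.≤-trans (ℕ.m≤n+m _ (length Y″)) (ℕ.≤-reflexive (sym (List.length-++ Y″)))))))
        λ u∈ v∈ → join (∈.∈-++⁻ (y₁ ∷ Y″) u∈) (∈.∈-++⁻ (y₁ ∷ Y″) v∈))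
        where
        heavy : ∀ {a a′} → a ∈ A → a′ ∈ A → Heavy G′ P a a′
        heavy {a} {a′} a∈ a′∈ = begin
          length P                               ≡⟨ List.length-++ (y₁ ∷ Y″) ⟩
          suc (length Y″) + |A|                  ≡⟨ cong (suc (length Y″) +_) |A|≡s ⟩
          suc (length Y″) + s                    ≤⟨ linear short
              (eq (length Y″) (degreeIn G* P a) (degreeIn G* P a′) (length Y′) s (cong length Y′≡) (degree-P a∈)
              (degree-P a′∈)) ⟩
          degreeIn G* P a + degreeIn G* P a′     ≤⟨ ℕ.+-mono-≤ (count-mono P λ _ → G*⊆G′) (count-mono P λ _ → G*⊆G′) ⟩
          degreeIn G′ P a + degreeIn G′ P a′     ∎
          where
          eq : ∀ w x x′ y s → y ≡ suc (suc w) → suc x ≡ s → suc x′ ≡ s → suc w + s + s ≡ x + x′ + suc y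
          eq w x x′ y s refl refl p rewrite ℕ.suc-injective p = solve′ w x
            where
            solve′ : ∀ w x → suc w + suc x + suc x ≡ x + x + suc (suc (suc w))
            solve′ = solve-∀
        join : ∀ {u v} → u ∈ y₁ ∷ Y″ ⊎ u ∈ A → v ∈ y₁ ∷ Y″ ⊎ v ∈ A → u ≢ v → Adj G′ u v
        join (inj₁ u∈) (inj₁ v∈) u≢v = G*⊆G′ (B-adj (Y′⊆B (⊆Y′ u∈)) (Y′⊆B (⊆Y′ v∈)) u≢v)
        join (inj₁ u∈) (inj₂ v∈) u≢v = G*⊆G′ (Adj-sym G* (A-Y′ v∈ (⊆Y′ u∈)))
        join (inj₂ u∈) (inj₁ v∈) u≢v = G*⊆G′ (A-Y′ u∈ (⊆Y′ v∈))
        join (inj₂ u∈) (inj₂ v∈) u≢v = heavy⇒adj′ u≢v (heavy u∈ v∈)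

    adj-y₂ : ∀ {v} → v ∈ P → Adj G* v y₂
    adj-y₂ v∈ = go clique (∈.∈-++⁻ (y₁ ∷ Y″) v∈)
      where
      go : ∀ {v} → AllPairs (Adj G*) (y₁ ∷ y₂ ∷ Y″ ++ Z) → v ∈ y₁ ∷ Y″ ⊎ v ∈ A → Adj G* v y₂
      go ((y₁y₂ ∷ _) ∷ _)  (inj₁ (here refl)) = y₁y₂
      go (_ ∷ y₂-adj ∷ _)  (inj₁ (there v∈))  = Adj-sym G* (All.lookup y₂-adj (∈.∈-++⁺ˡ v∈))
      go _                 (inj₂ v∈)          = A-Y′ v∈ y₂∈Y′

    hamiltonian : HamiltonianOn G* U
    hamiltonian = splice clique (rotate G* hamiltonian-P (here refl))
      where
      splice : AllPairs (Adj G*) (y₁ ∷ y₂ ∷ Y″ ++ Z) →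
        (∃[ b ] ∃[ t ] Path (Adj G*) (Heavy G* P) 0 y₁ b t × Adj G* b y₁ × y₁ ∷ t ↭ P) → HamiltonianOn G* U
      -- The cycle on `P` is cut just before it returns to `y₁`. Its last vertex sees `y₂`, and the
      -- clique path through `y₂ ∷ Z` ends at a vertex that sees `y₁`.
      splice (y₁-adj ∷ y₂-adj ∷ rest) (b , t , p , _ , π)
        with clique-path {S = Heavy G* U} y₂ Z (All.++⁻ʳ Y″ y₂-adj ∷ AllPairs-++⁻ʳ Y″ rest)
      ... | e , q = y₁ , e , t ++ y₂ ∷ Z ,
        path-++ (path-map id p) (adj-y₂ (↭.∈-resp-↭ π (path-last p))) q ,
        Adj-sym G* (All.lookup y₁-adj (skip (path-last q))) ,
        ↭-trans (↭.++⁺ʳ (y₂ ∷ Z) π) split-U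
        where
        skip : ∀ {v} → v ∈ y₂ ∷ Z → v ∈ y₂ ∷ Y″ ++ Z
        skip (here eq)  = here eq
        skip (there v∈) = there (∈.∈-++⁺ʳ Y″ v∈)

  structure : Structure k s G
  structure = go Y′ refl
    where
    cover : (D ++ Y′) ++ Z ++ A ↭ all
    cover = ↭-trans (↭-reflexive (List.++-assoc D Y′ (Z ++ A)))
      (↭-trans (↭.++⁺ˡ D (↭-trans (↭-reflexive (sym (List.++-assoc Y′ Z A)))
        (↭-trans (↭.++⁺ʳ A (↭-sym B↭Y′++Z)) (↭-trans (↭.++-comm B A) (↭-sym U↭A++B)))))
      (↭-trans (↭.++-comm D U) U++D))

    |D++Y′| : length (D ++ Y′) ≡ k + length Y′
    |D++Y′| = trans (List.length-++ D) (cong (_+ length Y′) |D|≡k)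

    build : (length (D ++ Y′) ≡ k + s × (∀ {x y} → x ∈ A → y ∈ A → ¬ Adj G x y)) ⊎
            (length (D ++ Y′) ≡ k + 1 × (∀ {x y} → x ∈ A → y ∈ A → x ≢ y → Adj G x y)) → Structure k s G
    build XX = record
      { X = A ; Y = D ++ Y′ ; Z = Z ; cover = cover ; |X| = |A|≡s
      ; XY = λ x∈ y∈ → case ∈.∈-++⁻ D y∈ of λ where
          (inj₁ y∈D)  → A-D x∈ y∈D
          (inj₂ y∈Y′) → G*⊆G x∈ (B⊆U (Y′⊆B y∈Y′)) (A-Y′ x∈ y∈Y′)
      ; XZ = λ x∈ z∈ → A-Z x∈ z∈ ∘ G⊆G*
      ; XX = XX
      }

    go : ∀ Ys → Y′ ≡ Ys → Structure k s G
    -- Without neighbours in `B`, the vertex `a₀` would have s = |A| neighbours inside `A`, itself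
    -- among them.
    go [] Y′≡ = contradiction (count≡length⇒all (adj G* a₀) A full a₀∈A) λ aa → Adj⇒≢ G* aa refl
      where
      full : |A| ≤ degreeIn G* A a₀
      full = ℕ.≤-reflexive (trans |A|≡s (trans (sym (degree-A a₀∈A))
          (trans (cong (λ Y → degreeIn G* A a₀ + length Y) Y′≡) (ℕ.+-identityʳ _))))
    go (y ∷ []) Y′≡ = build (inj₂ (trans |D++Y′| (cong (λ Y → k + length Y) Y′≡) , A-complete))
      where
      -- A vertex has s - 1 neighbours in `A` when |Y′| = 1, and the one missing is the vertex
      -- itself.
      one-missing : ∀ {a} → a ∈ A → co A a ≤ 1
      one-missing {a} a∈ = ℕ.+-cancelˡ-≤ (degreeIn G* A a) _ _ (ℕ.≤-reflexive
        (trans (degree+co A a) (trans |A|≡s (trans (sym (degree-A a∈)) (cong (λ Y → degreeIn G* A a + length Y) Y′≡)))))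
      A-complete : ∀ {x y} → x ∈ A → y ∈ A → x ≢ y → Adj G x y
      A-complete {x} {y} x∈ y∈ x≢y = G*⊆G x∈ (A⊆U y∈) (decidable-stable (T? (adj G* x y)) λ ¬xy →
        ℕ.<⇒≱ (count-two (not ∘ adj G* x) x∈ y∈ x≢y (T-not⁺ λ xx → Adj⇒≢ G* xx refl) (T-not⁺ ¬xy)) (one-missing x∈))
    go (y₁ ∷ y₂ ∷ Y″) Y′≡ with length Y′ ℕ.<? s
    ... | yes short = contradiction (Splice.hamiltonian y₁ y₂ Y″ Y′≡ short) ¬ham
    ... | no ¬short = build (inj₁ (trans |D++Y′| (cong (k +_) |Y′|≡s) , λ {x} x∈ y∈ xy →
            count≡0⇒none (adj G* x) A (degree-A≡0 x∈) y∈ (G⊆G* xy)))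
      where
      |Y′|≡s : length Y′ ≡ s
      |Y′|≡s = ℕ.≤-antisym (ℕ.≤-trans (ℕ.m≤n+m _ (degreeIn G* A a₀)) (ℕ.≤-reflexive (degree-A a₀∈A))) (ℕ.≮⇒≥ ¬short)
      degree-A≡0 : ∀ {a} → a ∈ A → degreeIn G* A a ≡ 0
      degree-A≡0 {a} a∈ = ℕ.+-cancelʳ-≡ s (degreeIn G* A a) 0 (trans (cong (degreeIn G* A a +_) (sym |Y′|≡s)) (degree-A a∈))

nonHamiltonian⇒structure : ∀ (k s : ℕ) → 1 ≤ s → (G : Graph n) (U D : List (Fin n)) →
  U ++ D ↭ allFin n → length D ≤ k → (∀ v → k + s ≤ degreeIn G (allFin n) v) →
  n * n ≤ sumMap (degreeIn G (allFin n)) (allFin n) + (n + 2 * s * n) →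
  stabilityBound k s < n → ¬ HamiltonianOn G U → Structure k s G
nonHamiltonian⇒structure k s 1≤s G U D U++D |D|≤k minDeg dense large ¬ham with ore-closure U G ¬ham
... | G* , G⊆G* , ¬ham* , heavy⇒adj =
  Stability.structure k s 1≤s G G* U D U++D |D|≤k minDeg dense large G⊆G* ¬ham* heavy⇒adj

-- Rational quadratic forms

module ℚ-Sum = Algebra.Properties.Semiring.Sum (CommutativeRing.semiring ℚ.+-*-commutativeRing)
open ℚ-Sum using () renaming (sum to Σℚ)
module ℚ-Mult = Algebra.Properties.Semiring.Mult (CommutativeRing.semiring ℚ.+-*-commutativeRing)

ℚ-ring : AlmostCommutativeRing 0ℓ 0ℓ
ℚ-ring = fromCommutativeRing ℚ.+-*-commutativeRing λ x → dec⇒maybe (0ℚ ℚ.≟ x)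

-- As a multiple of 1ℚ, `ι (suc n)` unfolds to `1ℚ ℚ.+ ι n`, which suits both induction and the ring
-- solver; a fraction over 1 would be normalised instead.
ι : ℕ → ℚ
ι n = n ℚ-Mult.× 1ℚ

2ℚ : ℚ
2ℚ = 1ℚ ℚ.+ 1ℚ

ι-+ : ∀ m n → ι (m + n) ≡ ι m ℚ.+ ι n
ι-+ = ℚ-Mult.×-homo-+ 1ℚ

ι-* : ∀ m n → ι (m * n) ≡ ι m ℚ.* ι n
ι-* = ℚ-Mult.×1-homo-*

0≤ι : ∀ n → 0ℚ ℚ.≤ ι n
0≤ι zero    = ℚ.≤-refl
0≤ι (suc n) = ℚ.+-mono-≤ (ℚ.nonNegative⁻¹ 1ℚ) (0≤ι n)

0<ι : ∀ n → 0ℚ ℚ.< ι (suc n)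
0<ι n = ℚ.+-mono-<-≤ (ℚ.positive⁻¹ 1ℚ) (0≤ι n)

ι-mono : ∀ {m n} → m ≤ n → ι m ℚ.≤ ι n
ι-mono {n = n} z≤n = 0≤ι n
ι-mono (s≤s m≤n)   = ℚ.+-monoʳ-≤ 1ℚ (ι-mono m≤n)

ι-mono-< : ∀ {m n} → m < n → ι m ℚ.< ι n
ι-mono-< {m} m<n = ℚ.<-≤-trans (subst (ℚ._< ι (suc m)) (ℚ.+-identityˡ (ι m)) (ℚ.+-monoˡ-< (ι m) (ℚ.positive⁻¹ 1ℚ)))
    (ι-mono m<n)

/1≡ι : ∀ n → (ℤ.+ n) ℚ./ 1 ≡ ι n
/1≡ι zero    = refl
/1≡ι (suc n) = ℚ.toℚᵘ-injective (begin
  ℚ.toℚᵘ ((ℤ.+ suc n) ℚ./ 1)                    ≈⟨ ℚ.toℚᵘ-fromℚᵘ (ℚᵘ.mkℚᵘ (ℤ.+ suc n) 0) ⟩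
  ℚᵘ.mkℚᵘ (ℤ.+ suc n) 0                          ≈⟨ ℚᵘ.*≡* (eq (ℤ.+ n)) ⟩
  ℚᵘ.1ℚᵘ ℚᵘ.+ ℚᵘ.mkℚᵘ (ℤ.+ n) 0                  ≈⟨ ℚᵘ.+-congʳ ℚᵘ.1ℚᵘ (ℚ.toℚᵘ-fromℚᵘ (ℚᵘ.mkℚᵘ (ℤ.+ n) 0)) ⟨
  ℚᵘ.1ℚᵘ ℚᵘ.+ ℚ.toℚᵘ ((ℤ.+ n) ℚ./ 1)             ≈⟨ ℚ.toℚᵘ-homo-+ 1ℚ ((ℤ.+ n) ℚ./ 1) ⟨
  ℚ.toℚᵘ (1ℚ ℚ.+ (ℤ.+ n) ℚ./ 1)                  ≡⟨ cong (λ p → ℚ.toℚᵘ (1ℚ ℚ.+ p)) (/1≡ι n) ⟩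
  ℚ.toℚᵘ (1ℚ ℚ.+ ι n)                          ∎)
  where
  open ℚᵘ.≃-Reasoning
  eq : ∀ i → (ℤ.+ 1 ℤ.+ i) ℤ.* ℤ.+ 1 ≡ (ℤ.+ 1 ℤ.* ℤ.+ 1 ℤ.+ i ℤ.* ℤ.+ 1) ℤ.* ℤ.+ 1
  eq = ℤ.solve-∀

linearℚ : ∀ {a b c d} → a ℚ.≤ b → c ℚ.+ b ≡ d ℚ.+ a → c ℚ.≤ d
linearℚ {a} {b} {c} {d} a≤b eq = subst₂ ℚ._≤_ (cancel c b) (cancel d b) (ℚ.+-monoˡ-≤ (ℚ.- b) (begin
  c ℚ.+ b ≡⟨ eq ⟩
  d ℚ.+ a ≤⟨ ℚ.+-monoʳ-≤ d a≤b ⟩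
  d ℚ.+ b ∎))
  where
  open ℚ.≤-Reasoning
  cancel : ∀ x y → x ℚ.+ y ℚ.+ ℚ.- y ≡ x
  cancel = Ring.solve-∀ ℚ-ring

≤-by : ∀ {c d} e → 0ℚ ℚ.≤ e → d ≡ c ℚ.+ e → c ℚ.≤ d
≤-by {c} {d} e 0≤e eq = subst₂ ℚ._≤_ (ℚ.+-identityʳ c) (sym eq) (ℚ.+-monoʳ-≤ c 0≤e)

0≤- : ∀ {p q} → p ℚ.≤ q → 0ℚ ℚ.≤ q ℚ.- p
0≤- {p} {q} p≤q = linearℚ p≤q (eq p q)
  where
  eq : ∀ p q → 0ℚ ℚ.+ q ≡ (q ℚ.- p) ℚ.+ p
  eq = Ring.solve-∀ ℚ-ring

∣p∣*∣p∣≡p*p : ∀ p → ℚ.∣ p ∣ ℚ.* ℚ.∣ p ∣ ≡ p ℚ.* p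
∣p∣*∣p∣≡p*p p with ℚ.∣p∣≡p∨∣p∣≡-p p
... | inj₁ eq = cong₂ ℚ._*_ eq eq
... | inj₂ eq = trans (cong₂ ℚ._*_ eq eq) (neg² p)
  where
  neg² : ∀ p → (ℚ.- p) ℚ.* (ℚ.- p) ≡ p ℚ.* p
  neg² = Ring.solve-∀ ℚ-ring

0≤square : ∀ p → 0ℚ ℚ.≤ p ℚ.* p
0≤square p = subst (0ℚ ℚ.≤_) (trans (ℚ.∣p*q∣≡∣p∣*∣q∣ p p) (∣p∣*∣p∣≡p*p p)) (ℚ.0≤∣p∣ (p ℚ.* p))

*-monoˡ : ∀ {r p q} → 0ℚ ℚ.≤ r → p ℚ.≤ q → r ℚ.* p ℚ.≤ r ℚ.* q
*-monoˡ {r} 0≤r = ℚ.*-monoˡ-≤-nonNeg r {{ℚ.nonNegative 0≤r}}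

*-monoʳ : ∀ {r p q} → 0ℚ ℚ.≤ r → p ℚ.≤ q → p ℚ.* r ℚ.≤ q ℚ.* r
*-monoʳ {r} 0≤r = ℚ.*-monoʳ-≤-nonNeg r {{ℚ.nonNegative 0≤r}}

*-cancelˡ : ∀ {r p q} → 0ℚ ℚ.< r → r ℚ.* p ℚ.≤ r ℚ.* q → p ℚ.≤ q
*-cancelˡ {r} 0<r = ℚ.*-cancelˡ-≤-pos r {{ℚ.positive 0<r}}

0≤* : ∀ {p q} → 0ℚ ℚ.≤ p → 0ℚ ℚ.≤ q → 0ℚ ℚ.≤ p ℚ.* q
0≤* {p} {q} 0≤p 0≤q = subst (ℚ._≤ p ℚ.* q) (ℚ.*-zeroʳ p) (*-monoˡ 0≤p 0≤q)

0≤+ : ∀ {p q} → 0ℚ ℚ.≤ p → 0ℚ ℚ.≤ q → 0ℚ ℚ.≤ p ℚ.+ q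
0≤+ = ℚ.+-mono-≤

Σ-mono : ∀ {n} {f g : Fin n → ℚ} → (∀ i → f i ℚ.≤ g i) → Σℚ f ℚ.≤ Σℚ g
Σ-mono {zero}  f≤g = ℚ.≤-refl
Σ-mono {suc n} f≤g = ℚ.+-mono-≤ (f≤g Fin.zero) (Σ-mono (f≤g ∘ Fin.suc))

Σ-cong : ∀ {n} {f g : Fin n → ℚ} → (∀ i → f i ≡ g i) → Σℚ f ≡ Σℚ g
Σ-cong = ℚ-Sum.sum-cong-≗

Σ-+ : ∀ {n} (f g : Fin n → ℚ) → Σℚ (λ i → f i ℚ.+ g i) ≡ Σℚ f ℚ.+ Σℚ g
Σ-+ = ℚ-Sum.∑-distrib-+

Σ-*ˡ : ∀ {n} c (f : Fin n → ℚ) → Σℚ (λ i → c ℚ.* f i) ≡ c ℚ.* Σℚ f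
Σ-*ˡ c f = sym (ℚ-Sum.*-distribˡ-sum c f)

Σ-*ʳ : ∀ {n} c (f : Fin n → ℚ) → Σℚ (λ i → f i ℚ.* c) ≡ Σℚ f ℚ.* c
Σ-*ʳ c f = sym (ℚ-Sum.*-distribʳ-sum c f)

Σ-≥0 : ∀ {n} {f : Fin n → ℚ} → (∀ i → 0ℚ ℚ.≤ f i) → 0ℚ ℚ.≤ Σℚ f
Σ-≥0 {zero}  0≤f = ℚ.≤-refl
Σ-≥0 {suc n} 0≤f = 0≤+ (0≤f Fin.zero) (Σ-≥0 (0≤f ∘ Fin.suc))

Σ-term : ∀ {n} {f : Fin n → ℚ} → (∀ i → 0ℚ ℚ.≤ f i) → ∀ i → f i ℚ.≤ Σℚ f
Σ-term {f = f} 0≤f Fin.zero    = ≤-by _ (Σ-≥0 (0≤f ∘ Fin.suc)) refl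
Σ-term {f = f} 0≤f (Fin.suc i) = ℚ.≤-trans (Σ-term (0≤f ∘ Fin.suc) i)
  (≤-by (f Fin.zero) (0≤f Fin.zero) (ℚ.+-comm (f Fin.zero) _))

Σ-const : ∀ {n} c → Σℚ {n} (λ _ → c) ≡ ι n ℚ.* c
Σ-const {zero}  c = sym (ℚ.*-zeroˡ c)
Σ-const {suc n} c = trans (cong (c ℚ.+_) (Σ-const {n} c)) (eq c (ι n))
  where
  eq : ∀ c m → c ℚ.+ m ℚ.* c ≡ (1ℚ ℚ.+ m) ℚ.* c
  eq = Ring.solve-∀ ℚ-ring

sumMap-tabulate : ∀ {n} {V : Set} (f : V → ℕ) (g : Fin n → V) → Σℚ (λ i → ι (f (g i))) ≡ ι (sumMap f (List.tabulate g))
sumMap-tabulate {zero}  f g = refl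
sumMap-tabulate {suc n} f g = trans (cong (ι (f (g Fin.zero)) ℚ.+_) (sumMap-tabulate f (g ∘ Fin.suc)))
    (sym (ι-+ (f (g Fin.zero)) _))

Σ-ι : ∀ {n} (f : Fin n → ℕ) → Σℚ (λ i → ι (f i)) ≡ ι (sumMap f (allFin n))
Σ-ι f = sumMap-tabulate f id

𝟙[_] : Bool → ℚ
𝟙[ b ] = ι (# b)

0≤𝟙[_] : ∀ b → 0ℚ ℚ.≤ 𝟙[ b ]
0≤𝟙[ b ] = 0≤ι (# b)

Σ-pick : ∀ {n} (i : Fin n) (f : Fin n → ℚ) → Σℚ (λ j → 𝟙[ does (i Fin.≟ j) ] ℚ.* f j) ≡ f i
Σ-pick {suc n} Fin.zero f = trans (cong₂ ℚ._+_ (ℚ.*-identityˡ (f Fin.zero))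
    (trans (Σ-cong λ j → ℚ.*-zeroˡ (f (Fin.suc j))) (ℚ-Sum.sum-replicate-zero n))) (ℚ.+-identityʳ _)
Σ-pick {suc n} (Fin.suc i) f = trans (cong₂ ℚ._+_ (ℚ.*-zeroˡ (f Fin.zero)) (Σ-pick i (f ∘ Fin.suc))) (ℚ.+-identityˡ _)

Σ₂ : ∀ {n} → (Fin n → Fin n → ℚ) → ℚ
Σ₂ f = Σℚ λ i → Σℚ (f i)

Σ₂-mono : ∀ {n} {f g : Fin n → Fin n → ℚ} → (∀ i j → f i j ℚ.≤ g i j) → Σ₂ f ℚ.≤ Σ₂ g
Σ₂-mono f≤g = Σ-mono λ i → Σ-mono (f≤g i)

Σ₂-cong : ∀ {n} {f g : Fin n → Fin n → ℚ} → (∀ i j → f i j ≡ g i j) → Σ₂ f ≡ Σ₂ g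
Σ₂-cong f≡g = Σ-cong λ i → Σ-cong (f≡g i)

Σ₂-+ : ∀ {n} (f g : Fin n → Fin n → ℚ) → Σ₂ (λ i j → f i j ℚ.+ g i j) ≡ Σ₂ f ℚ.+ Σ₂ g
Σ₂-+ f g = trans (Σ-cong λ i → Σ-+ (f i) (g i)) (Σ-+ (Σℚ ∘ f) (Σℚ ∘ g))

Σ₂-*ˡ : ∀ {n} c (f : Fin n → Fin n → ℚ) → Σ₂ (λ i j → c ℚ.* f i j) ≡ c ℚ.* Σ₂ f
Σ₂-*ˡ c f = trans (Σ-cong λ i → Σ-*ˡ c (f i)) (Σ-*ˡ c (Σℚ ∘ f))

Σ₂-*ʳ : ∀ {n} c (f : Fin n → Fin n → ℚ) → Σ₂ (λ i j → f i j ℚ.* c) ≡ Σ₂ f ℚ.* c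
Σ₂-*ʳ c f = trans (Σ-cong λ i → Σ-*ʳ c (f i)) (Σ-*ʳ c (Σℚ ∘ f))

Σ₂-swap : ∀ {n} (f : Fin n → Fin n → ℚ) → Σ₂ f ≡ Σ₂ (λ i j → f j i)
Σ₂-swap = ℚ-Sum.∑-comm

-- Twice the quadratic form of Q, because each edge occurs in both orders. This is the origin of the
-- factor 2 in every form bound.
edgeForm : ∀ {n} → Graph n → (Fin n → ℚ) → ℚ
edgeForm G y = Σ₂ λ i j → 𝟙[ adj G i j ] ℚ.* ((y i ℚ.+ y j) ℚ.* (y i ℚ.+ y j))

norm² : ∀ {n} → (Fin n → ℚ) → ℚ
norm² y = Σℚ λ i → y i ℚ.* y i

symmetrize : ∀ {n} (G : Graph n) (f g : Fin n → Fin n → ℚ) →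
  (∀ i j → g i j ≡ f i j ℚ.+ f j i) →
  Σ₂ (λ i j → 𝟙[ adj G i j ] ℚ.* g i j) ≡ 2ℚ ℚ.* Σ₂ (λ i j → 𝟙[ adj G i j ] ℚ.* f i j)
symmetrize {n} G f g g≡ = begin
  Σ₂ (λ i j → 𝟙[ adj G i j ] ℚ.* g i j)                         ≡⟨ Σ₂-cong
      (λ i j → trans (cong (𝟙[ adj G i j ] ℚ.*_) (g≡ i j)) (ℚ.*-distribˡ-+ 𝟙[ adj G i j ] (f i j) (f j i))) ⟩
  Σ₂ (λ i j → 𝟙[ adj G i j ] ℚ.* f i j ℚ.+ 𝟙[ adj G i j ] ℚ.* f j i) ≡⟨ Σ₂-+ {n} _ _ ⟩
  Sf ℚ.+ Σ₂ (λ i j → 𝟙[ adj G i j ] ℚ.* f j i)                  ≡⟨ cong (Sf ℚ.+_)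
      (trans (Σ₂-cong λ i j → cong (λ b → 𝟙[ b ] ℚ.* f j i) (adj-sym G i j)) (Σ₂-swap {n} _)) ⟩
  Sf ℚ.+ Sf                                                    ≡⟨ double Sf ⟩
  2ℚ ℚ.* Sf                                           ∎
  where
  open ≡-Reasoning
  Sf = Σ₂ (λ i j → 𝟙[ adj G i j ] ℚ.* f i j)
  double : ∀ x → x ℚ.+ x ≡ 2ℚ ℚ.* x
  double = Ring.solve-∀ ℚ-ring

Σ-adj : ∀ {n} (G : Graph n) i → Σℚ (λ j → 𝟙[ adj G i j ]) ≡ ι (degreeIn G (allFin n) i)
Σ-adj G i = Σ-ι (λ j → # adj G i j)

-- Quotients enter only through such a witness, so the ring solver never meets an inverse.
divide : ∀ {d} → 0ℚ ℚ.< d → ∀ y → ∃[ z ] y ≡ d ℚ.* z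
divide {d} 0<d y = ℚ.1/ d ℚ.* y , sym (begin
  d ℚ.* (ℚ.1/ d ℚ.* y) ≡⟨ ℚ.*-assoc d (ℚ.1/ d) y ⟨
  d ℚ.* ℚ.1/ d ℚ.* y   ≡⟨ cong (ℚ._* y) (ℚ.*-inverseʳ d) ⟩
  1ℚ ℚ.* y             ≡⟨ ℚ.*-identityˡ y ⟩
  y                    ∎)
  where
  open ≡-Reasoning
  instance d≢0 = ℚ.>-nonZero 0<d

-- The bound by the maximal row sum of D⁻¹ Q D: with y = D z, weigh each product 2 yᵢ yⱼ by AM-GM.
edgeForm-degree-bound : ∀ {n} (G : Graph n) (p t e : ℕ) →
  (∀ i → 1 ≤ degreeIn G (allFin n) i) →
  (∀ i → p * (degreeIn G (allFin n) i * degreeIn G (allFin n) i +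
                sumMap (λ j → # adj G i j * degreeIn G (allFin n) j) (allFin n))
         + degreeIn G (allFin n) i * e ≤ degreeIn G (allFin n) i * t) →
  ∀ y → ι p ℚ.* edgeForm G y ℚ.≤ 2ℚ ℚ.* (ι t ℚ.- ι e) ℚ.* norm² y
edgeForm-degree-bound {n} G p t e 1≤D rows y = begin
  ι p ℚ.* edgeForm G y
    ≤⟨ *-monoˡ (0≤ι p) (Σ₂-mono λ i j → *-monoˡ 0≤𝟙[ adj G i j ] (≤-by _ (gap i j) (weigh i j))) ⟩
  ι p ℚ.* Σ₂ (λ i j → 𝟙[ adj G i j ] ℚ.* (f i j ℚ.+ f j i))
    ≡⟨ cong (ι p ℚ.*_) (symmetrize G f _ λ _ _ → refl) ⟩
  ι p ℚ.* (2ℚ ℚ.* Σ₂ (λ i j → 𝟙[ adj G i j ] ℚ.* f i j))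
    ≡⟨ cong (λ s → ι p ℚ.* (2ℚ ℚ.* s)) (Σ-cong row) ⟩
  ι p ℚ.* (2ℚ ℚ.* Σℚ (λ i → (D i ℚ.* D i ℚ.+ ι (S i)) ℚ.* c i))
    ≡⟨ comm-2 (ι p) _ ⟩
  2ℚ ℚ.* (ι p ℚ.* Σℚ (λ i → (D i ℚ.* D i ℚ.+ ι (S i)) ℚ.* c i))
    ≡⟨ cong (2ℚ ℚ.*_) (Σ-*ˡ {n} (ι p) _) ⟨
  2ℚ ℚ.* Σℚ (λ i → ι p ℚ.* ((D i ℚ.* D i ℚ.+ ι (S i)) ℚ.* c i))
    ≤⟨ *-monoˡ (0≤ι 2) (Σ-mono bound) ⟩
  2ℚ ℚ.* Σℚ (λ i → ν ℚ.* (y i ℚ.* y i))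
    ≡⟨ cong (2ℚ ℚ.*_) (Σ-*ˡ {n} ν _) ⟩
  2ℚ ℚ.* (ν ℚ.* norm² y)
    ≡⟨ ℚ.*-assoc 2ℚ ν (norm² y) ⟨
  2ℚ ℚ.* ν ℚ.* norm² y ∎
  where
  open ℚ.≤-Reasoning
  deg S : Fin n → ℕ
  deg = degreeIn G (allFin n)
  S i = sumMap (λ j → # adj G i j * deg j) (allFin n)
  ν = ι t ℚ.- ι e
  D z c : Fin n → ℚ
  D i = ι (deg i)
  0<D : ∀ i → 0ℚ ℚ.< D i
  0<D i = ℚ.<-≤-trans (0<ι 0) (ι-mono (1≤D i))
  z i = proj₁ (divide (0<D i) (y i))
  y≡Dz : ∀ i → y i ≡ D i ℚ.* z i
  y≡Dz i = proj₂ (divide (0<D i) (y i))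
  c i = D i ℚ.* (z i ℚ.* z i)
  0≤c : ∀ i → 0ℚ ℚ.≤ c i
  0≤c i = 0≤* (0≤ι (deg i)) (0≤square (z i))
  f : Fin n → Fin n → ℚ
  f i j = y i ℚ.* y i ℚ.+ D j ℚ.* c i
  gap : ∀ i j → 0ℚ ℚ.≤ D i ℚ.* D j ℚ.* ((z i ℚ.- z j) ℚ.* (z i ℚ.- z j))
  gap i j = 0≤* (0≤* (0≤ι (deg i)) (0≤ι (deg j))) (0≤square (z i ℚ.- z j))
  weigh : ∀ i j → f i j ℚ.+ f j i ≡ (y i ℚ.+ y j) ℚ.* (y i ℚ.+ y j) ℚ.+ D i ℚ.* D j ℚ.* ((z i ℚ.- z j) ℚ.* (z i ℚ.- z j))
  weigh i j = eq (D i) (D j) (z i) (z j) (y≡Dz i) (y≡Dz j)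
    where
    eq′ : ∀ a b x y → a ℚ.* x ℚ.* (a ℚ.* x) ℚ.+ b ℚ.* (a ℚ.* (x ℚ.* x)) ℚ.+
        (b ℚ.* y ℚ.* (b ℚ.* y) ℚ.+ a ℚ.* (b ℚ.* (y ℚ.* y)))
      ≡ (a ℚ.* x ℚ.+ b ℚ.* y) ℚ.* (a ℚ.* x ℚ.+ b ℚ.* y) ℚ.+ a ℚ.* b ℚ.* ((x ℚ.- y) ℚ.* (x ℚ.- y))
    eq′ = Ring.solve-∀ ℚ-ring
    eq : ∀ a b x y {u v} → u ≡ a ℚ.* x → v ≡ b ℚ.* y →
      u ℚ.* u ℚ.+ b ℚ.* (a ℚ.* (x ℚ.* x)) ℚ.+ (v ℚ.* v ℚ.+ a ℚ.* (b ℚ.* (y ℚ.* y)))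
      ≡ (u ℚ.+ v) ℚ.* (u ℚ.+ v) ℚ.+ a ℚ.* b ℚ.* ((x ℚ.- y) ℚ.* (x ℚ.- y))
    eq a b x y refl refl = eq′ a b x y
  comm-2 : ∀ p s → p ℚ.* (2ℚ ℚ.* s) ≡ 2ℚ ℚ.* (p ℚ.* s)
  comm-2 = Ring.solve-∀ ℚ-ring
  row : ∀ i → Σℚ (λ j → 𝟙[ adj G i j ] ℚ.* f i j) ≡ (D i ℚ.* D i ℚ.+ ι (S i)) ℚ.* c i
  row i = begin-equality
    Σℚ (λ j → 𝟙[ adj G i j ] ℚ.* f i j)
      ≡⟨ Σ-cong (λ j → eq₁ 𝟙[ adj G i j ] (y i ℚ.* y i) (D j) (c i)) ⟩
    Σℚ (λ j → 𝟙[ adj G i j ] ℚ.* (y i ℚ.* y i) ℚ.+ 𝟙[ adj G i j ] ℚ.* D j ℚ.* c i)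
      ≡⟨ Σ-+ {n} _ _ ⟩
    Σℚ (λ j → 𝟙[ adj G i j ] ℚ.* (y i ℚ.* y i)) ℚ.+ Σℚ (λ j → 𝟙[ adj G i j ] ℚ.* D j ℚ.* c i)
      ≡⟨ cong₂ ℚ._+_ (trans (Σ-*ʳ {n} (y i ℚ.* y i) _) (cong (ℚ._* (y i ℚ.* y i)) (Σ-adj G i)))
           (trans (Σ-*ʳ {n} (c i) _) (cong (ℚ._* c i) (trans (Σ-cong λ j → sym (ι-* (# adj G i j) (deg j))) (Σ-ι {n} _)))) ⟩
    D i ℚ.* (y i ℚ.* y i) ℚ.+ ι (S i) ℚ.* c i
      ≡⟨ cong (λ x → D i ℚ.* (x ℚ.* x) ℚ.+ ι (S i) ℚ.* c i) (y≡Dz i) ⟩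
    D i ℚ.* (D i ℚ.* z i ℚ.* (D i ℚ.* z i)) ℚ.+ ι (S i) ℚ.* c i
      ≡⟨ eq₂ (D i) (ι (S i)) (z i) ⟩
    (D i ℚ.* D i ℚ.+ ι (S i)) ℚ.* c i ∎
    where
    eq₁ : ∀ a y d c → a ℚ.* (y ℚ.+ d ℚ.* c) ≡ a ℚ.* y ℚ.+ a ℚ.* d ℚ.* c
    eq₁ = Ring.solve-∀ ℚ-ring
    eq₂ : ∀ d s z → d ℚ.* (d ℚ.* z ℚ.* (d ℚ.* z)) ℚ.+ s ℚ.* (d ℚ.* (z ℚ.* z)) ≡ (d ℚ.* d ℚ.+ s) ℚ.* (d ℚ.* (z ℚ.* z))
    eq₂ = Ring.solve-∀ ℚ-ring
  rowsℚ : ∀ i → ι p ℚ.* (D i ℚ.* D i ℚ.+ ι (S i)) ℚ.≤ D i ℚ.* ν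
  rowsℚ i = linearℚ (subst₂ ℚ._≤_ lhs (ι-* (deg i) t) (ι-mono (rows i)))
      (eq (ι p ℚ.* (D i ℚ.* D i ℚ.+ ι (S i))) (D i) (ι t) (ι e))
    where
    lhs : ι (p * (deg i * deg i + S i) + deg i * e) ≡ ι p ℚ.* (D i ℚ.* D i ℚ.+ ι (S i)) ℚ.+ D i ℚ.* ι e
    lhs = trans (ι-+ (p * (deg i * deg i + S i)) (deg i * e)) (cong₂ ℚ._+_
      (trans (ι-* p _) (cong (ι p ℚ.*_) (trans (ι-+ (deg i * deg i) (S i)) (cong (ℚ._+ ι (S i)) (ι-* (deg i) (deg i))))))
      (ι-* (deg i) e))
    eq : ∀ x d t e → x ℚ.+ d ℚ.* t ≡ d ℚ.* (t ℚ.- e) ℚ.+ (x ℚ.+ d ℚ.* e)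
    eq = Ring.solve-∀ ℚ-ring
  bound : ∀ i → ι p ℚ.* ((D i ℚ.* D i ℚ.+ ι (S i)) ℚ.* c i) ℚ.≤ ν ℚ.* (y i ℚ.* y i)
  bound i = begin
    ι p ℚ.* ((D i ℚ.* D i ℚ.+ ι (S i)) ℚ.* c i)   ≡⟨ ℚ.*-assoc (ι p) _ (c i) ⟨
    ι p ℚ.* (D i ℚ.* D i ℚ.+ ι (S i)) ℚ.* c i     ≤⟨ *-monoʳ (0≤c i) (rowsℚ i) ⟩
    D i ℚ.* ν ℚ.* c i                             ≡⟨ eq (D i) ν (z i) ⟩
    ν ℚ.* (D i ℚ.* z i ℚ.* (D i ℚ.* z i))         ≡⟨ cong (λ x → ν ℚ.* (x ℚ.* x)) (y≡Dz i) ⟨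
    ν ℚ.* (y i ℚ.* y i)                           ∎
    where
    eq : ∀ d v z → d ℚ.* v ℚ.* (d ℚ.* (z ℚ.* z)) ≡ v ℚ.* (d ℚ.* z ℚ.* (d ℚ.* z))
    eq = Ring.solve-∀ ℚ-ring

-- The quadratic form near a constant vector on a part

module WeightedMean {n} (χ : Fin n → Bool) (y : Fin n → ℚ) (M : ℕ) (|χ| : count χ (allFin n) ≡ suc M) where

  N : ℚ
  N = ι (suc M)

  ω : Fin n → ℚ
  ω i = 𝟙[ χ i ]

  ω-idem : ∀ i → ω i ℚ.* ω i ≡ ω i
  ω-idem i with χ i
  ... | true  = refl
  ... | false = refl

  Σω : Σℚ ω ≡ N
  Σω = trans (Σ-ι (λ i → # χ i)) (cong ι |χ|)

  -- Subtracting the mean makes `r` orthogonal to the indicator `ω`, so the terms linear in `r`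
  -- vanish when summed over the part.
  mean : ∃[ a ] Σℚ (λ i → ω i ℚ.* y i) ≡ N ℚ.* a
  mean = divide (0<ι M) _

  a : ℚ
  a = proj₁ mean

  r : Fin n → ℚ
  r i = y i ℚ.- ω i ℚ.* a

  y≡ : ∀ i → y i ≡ ω i ℚ.* a ℚ.+ r i
  y≡ i = eq (y i) (ω i ℚ.* a)
    where
    eq : ∀ y w → y ≡ w ℚ.+ (y ℚ.- w)
    eq = Ring.solve-∀ ℚ-ring

  Σωr : Σℚ (λ i → ω i ℚ.* r i) ≡ 0ℚ
  Σωr = begin
    Σℚ (λ i → ω i ℚ.* r i)                          ≡⟨ Σ-cong (λ i → eq₁ (ω i) (y i) a (ω-idem i)) ⟩
    Σℚ (λ i → ω i ℚ.* y i ℚ.+ ω i ℚ.* (ℚ.- a))      ≡⟨ Σ-+ {n} _ _ ⟩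
    Σℚ (λ i → ω i ℚ.* y i) ℚ.+ Σℚ (λ i → ω i ℚ.* (ℚ.- a)) ≡⟨ cong₂ ℚ._+_ (proj₂ mean)
        (trans (Σ-*ʳ {n} (ℚ.- a) ω) (cong (ℚ._* (ℚ.- a)) Σω)) ⟩
    N ℚ.* a ℚ.+ N ℚ.* (ℚ.- a)                       ≡⟨ eq₂ N a ⟩
    0ℚ                                              ∎
    where
    open ≡-Reasoning
    eq₁′ : ∀ w y a → w ℚ.* (y ℚ.- w ℚ.* a) ≡ w ℚ.* y ℚ.+ w ℚ.* w ℚ.* (ℚ.- a)
    eq₁′ = Ring.solve-∀ ℚ-ring
    eq₁ : ∀ w y a → w ℚ.* w ≡ w → w ℚ.* (y ℚ.- w ℚ.* a) ≡ w ℚ.* y ℚ.+ w ℚ.* (ℚ.- a)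
    eq₁ w y a idem = trans (eq₁′ w y a) (cong (λ v → w ℚ.* y ℚ.+ v ℚ.* (ℚ.- a)) idem)
    eq₂ : ∀ n a → n ℚ.* a ℚ.+ n ℚ.* (ℚ.- a) ≡ 0ℚ
    eq₂ = Ring.solve-∀ ℚ-ring

  R Rᵂ : ℚ
  R  = norm² r
  Rᵂ = Σℚ (λ i → ω i ℚ.* (r i ℚ.* r i))

  0≤R : 0ℚ ℚ.≤ R
  0≤R = Σ-≥0 (λ i → 0≤square (r i))

  r²≤R : ∀ i → r i ℚ.* r i ℚ.≤ R
  r²≤R = Σ-term (λ i → 0≤square (r i))

  0≤Rᵂ : 0ℚ ℚ.≤ Rᵂ
  0≤Rᵂ = Σ-≥0 (λ i → 0≤* 0≤𝟙[ χ i ] (0≤square (r i)))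

  Rᵂ≤R : Rᵂ ℚ.≤ R
  Rᵂ≤R = Σ-mono λ i → bound (χ i) (0≤square (r i))
    where
    bound : ∀ b {x} → 0ℚ ℚ.≤ x → 𝟙[ b ] ℚ.* x ℚ.≤ x
    bound true  {x} 0≤x = ℚ.≤-reflexive (ℚ.*-identityˡ x)
    bound false {x} 0≤x = ℚ.≤-trans (ℚ.≤-reflexive (ℚ.*-zeroˡ x)) 0≤x

  Σω-shift : ∀ s → Σℚ (λ i → ω i ℚ.* ((s ℚ.+ r i) ℚ.* (s ℚ.+ r i))) ≡ N ℚ.* (s ℚ.* s) ℚ.+ Rᵂ
  Σω-shift s = begin
    Σℚ (λ i → ω i ℚ.* ((s ℚ.+ r i) ℚ.* (s ℚ.+ r i)))
      ≡⟨ Σ-cong (λ i → eq (ω i) s (r i)) ⟩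
    Σℚ (λ i → ω i ℚ.* (s ℚ.* s) ℚ.+ (ω i ℚ.* r i ℚ.* (2ℚ ℚ.* s) ℚ.+ ω i ℚ.* (r i ℚ.* r i)))
      ≡⟨ trans (Σ-+ {n} _ _) (cong₂ ℚ._+_ (Σ-*ʳ {n} (s ℚ.* s) ω)
          (trans (Σ-+ {n} _ _) (cong (ℚ._+ Rᵂ) (Σ-*ʳ {n} (2ℚ ℚ.* s) _)))) ⟩
    Σℚ ω ℚ.* (s ℚ.* s) ℚ.+ (Σℚ (λ i → ω i ℚ.* r i) ℚ.* (2ℚ ℚ.* s) ℚ.+ Rᵂ)
      ≡⟨ cong₂ (λ u v → u ℚ.* (s ℚ.* s) ℚ.+ (v ℚ.* (2ℚ ℚ.* s) ℚ.+ Rᵂ)) Σω Σωr ⟩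
    N ℚ.* (s ℚ.* s) ℚ.+ (0ℚ ℚ.* (2ℚ ℚ.* s) ℚ.+ Rᵂ)
      ≡⟨ cong (N ℚ.* (s ℚ.* s) ℚ.+_) (trans (cong (ℚ._+ Rᵂ) (ℚ.*-zeroˡ (2ℚ ℚ.* s))) (ℚ.+-identityˡ Rᵂ)) ⟩
    N ℚ.* (s ℚ.* s) ℚ.+ Rᵂ ∎
    where
    open ≡-Reasoning
    eq : ∀ w s r → w ℚ.* ((s ℚ.+ r) ℚ.* (s ℚ.+ r)) ≡ w ℚ.* (s ℚ.* s) ℚ.+ (w ℚ.* r ℚ.* (2ℚ ℚ.* s) ℚ.+ w ℚ.* (r ℚ.* r))
    eq = Ring.solve-∀ ℚ-ring

  norm²-split : norm² y ≡ N ℚ.* (a ℚ.* a) ℚ.+ R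
  norm²-split = begin
    norm² y
      ≡⟨ Σ-cong (λ i → eq (ω i) a (r i) (y≡ i) (ω-idem i)) ⟩
    Σℚ (λ i → ω i ℚ.* (a ℚ.* a) ℚ.+ (ω i ℚ.* r i ℚ.* (2ℚ ℚ.* a) ℚ.+ r i ℚ.* r i))
      ≡⟨ trans (Σ-+ {n} _ _) (cong₂ ℚ._+_ (Σ-*ʳ {n} (a ℚ.* a) ω)
          (trans (Σ-+ {n} _ _) (cong (ℚ._+ R) (Σ-*ʳ {n} (2ℚ ℚ.* a) _)))) ⟩
    Σℚ ω ℚ.* (a ℚ.* a) ℚ.+ (Σℚ (λ i → ω i ℚ.* r i) ℚ.* (2ℚ ℚ.* a) ℚ.+ R)
      ≡⟨ cong₂ (λ u v → u ℚ.* (a ℚ.* a) ℚ.+ (v ℚ.* (2ℚ ℚ.* a) ℚ.+ R)) Σω Σωr ⟩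
    N ℚ.* (a ℚ.* a) ℚ.+ (0ℚ ℚ.* (2ℚ ℚ.* a) ℚ.+ R)
      ≡⟨ cong (N ℚ.* (a ℚ.* a) ℚ.+_) (trans (cong (ℚ._+ R) (ℚ.*-zeroˡ (2ℚ ℚ.* a))) (ℚ.+-identityˡ R)) ⟩
    N ℚ.* (a ℚ.* a) ℚ.+ R ∎
    where
    open ≡-Reasoning
    eq′ : ∀ w a r → (w ℚ.* a ℚ.+ r) ℚ.* (w ℚ.* a ℚ.+ r) ≡ w ℚ.* w ℚ.* (a ℚ.* a) ℚ.+ (w ℚ.* r ℚ.* (2ℚ ℚ.* a) ℚ.+ r ℚ.* r)
    eq′ = Ring.solve-∀ ℚ-ring
    eq : ∀ w a r {y} → y ≡ w ℚ.* a ℚ.+ r → w ℚ.* w ≡ w → y ℚ.* y ≡ w ℚ.* (a ℚ.* a) ℚ.+ (w ℚ.* r ℚ.* (2ℚ ℚ.* a) ℚ.+ r ℚ.* r)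
    eq w a r refl idem = trans (eq′ w a r) (cong (λ v → v ℚ.* (a ℚ.* a) ℚ.+ (w ℚ.* r ℚ.* (2ℚ ℚ.* a) ℚ.+ r ℚ.* r)) idem)

  q : Fin n → Fin n → ℚ
  q i j = (2ℚ ℚ.* a ℚ.+ r i ℚ.+ r j) ℚ.* (2ℚ ℚ.* a ℚ.+ r i ℚ.+ r j)

  δ : Fin n → Fin n → ℚ
  δ i j = 𝟙[ does (i Fin.≟ j) ]

  -- The form of the complete graph on the part, written as all ordered pairs minus the diagonal so
  -- that each of the two sums factors.
  offDiagonal : Fin n → Fin n → ℚ
  offDiagonal i j = ω i ℚ.* (ω j ℚ.* q i j) ℚ.+ (ℚ.- 1ℚ) ℚ.* (δ i j ℚ.* (ω i ℚ.* q i j))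

  Σ₂-offDiagonal : Σ₂ offDiagonal ≡
    N ℚ.* (N ℚ.* (2ℚ ℚ.* a ℚ.* (2ℚ ℚ.* a)) ℚ.+ Rᵂ) ℚ.+ N ℚ.* Rᵂ ℚ.+ (ℚ.- 1ℚ) ℚ.* (2ℚ ℚ.* 2ℚ ℚ.* (N ℚ.* (a ℚ.* a) ℚ.+ Rᵂ))
  Σ₂-offDiagonal = trans (Σ₂-+ {n} _ _) (cong₂ ℚ._+_ full (trans (Σ₂-*ˡ {n} (ℚ.- 1ℚ) _) (cong ((ℚ.- 1ℚ) ℚ.*_) diagonal)))
    where
    open ≡-Reasoning
    full : Σ₂ (λ i j → ω i ℚ.* (ω j ℚ.* q i j)) ≡ N ℚ.* (N ℚ.* (2ℚ ℚ.* a ℚ.* (2ℚ ℚ.* a)) ℚ.+ Rᵂ) ℚ.+ N ℚ.* Rᵂ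
    full = begin
      Σ₂ (λ i j → ω i ℚ.* (ω j ℚ.* q i j))
        ≡⟨ Σ-cong (λ i → trans (Σ-*ˡ {n} (ω i) _) (cong (ω i ℚ.*_) (Σω-shift (2ℚ ℚ.* a ℚ.+ r i)))) ⟩
      Σℚ (λ i → ω i ℚ.* (N ℚ.* ((2ℚ ℚ.* a ℚ.+ r i) ℚ.* (2ℚ ℚ.* a ℚ.+ r i)) ℚ.+ Rᵂ))
        ≡⟨ Σ-cong (λ i → eq (ω i) N _ Rᵂ) ⟩
      Σℚ (λ i → N ℚ.* (ω i ℚ.* ((2ℚ ℚ.* a ℚ.+ r i) ℚ.* (2ℚ ℚ.* a ℚ.+ r i))) ℚ.+ ω i ℚ.* Rᵂ)
        ≡⟨ trans (Σ-+ {n} _ _) (cong₂ ℚ._+_ (trans (Σ-*ˡ {n} N _) (cong (N ℚ.*_) (Σω-shift (2ℚ ℚ.* a))))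
            (trans (Σ-*ʳ {n} Rᵂ ω) (cong (ℚ._* Rᵂ) Σω))) ⟩
      N ℚ.* (N ℚ.* (2ℚ ℚ.* a ℚ.* (2ℚ ℚ.* a)) ℚ.+ Rᵂ) ℚ.+ N ℚ.* Rᵂ ∎
      where
      eq : ∀ w n s x → w ℚ.* (n ℚ.* s ℚ.+ x) ≡ n ℚ.* (w ℚ.* s) ℚ.+ w ℚ.* x
      eq = Ring.solve-∀ ℚ-ring
    diagonal : Σ₂ (λ i j → δ i j ℚ.* (ω i ℚ.* q i j)) ≡ 2ℚ ℚ.* 2ℚ ℚ.* (N ℚ.* (a ℚ.* a) ℚ.+ Rᵂ)
    diagonal = begin
      Σ₂ (λ i j → δ i j ℚ.* (ω i ℚ.* q i j))
        ≡⟨ Σ-cong (λ i → Σ-pick i (λ j → ω i ℚ.* q i j)) ⟩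
      Σℚ (λ i → ω i ℚ.* q i i)
        ≡⟨ Σ-cong (λ i → eq (ω i) a (r i)) ⟩
      Σℚ (λ i → 2ℚ ℚ.* 2ℚ ℚ.* (ω i ℚ.* ((a ℚ.+ r i) ℚ.* (a ℚ.+ r i))))
        ≡⟨ trans (Σ-*ˡ {n} (2ℚ ℚ.* 2ℚ) _) (cong (2ℚ ℚ.* 2ℚ ℚ.*_) (Σω-shift a)) ⟩
      2ℚ ℚ.* 2ℚ ℚ.* (N ℚ.* (a ℚ.* a) ℚ.+ Rᵂ) ∎
      where
      eq : ∀ w a r → w ℚ.* ((2ℚ ℚ.* a ℚ.+ r ℚ.+ r) ℚ.* (2ℚ ℚ.* a ℚ.+ r ℚ.+ r))
        ≡ 2ℚ ℚ.* 2ℚ ℚ.* (w ℚ.* ((a ℚ.+ r) ℚ.* (a ℚ.+ r)))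
      eq = Ring.solve-∀ ℚ-ring

  -- The products `r i ℚ.* r j` cancel in the sum, so `R` receives only the coefficient 2 N, about
  -- half of the 4 (N - 1) that the constant part has per unit of norm. All later error terms in `R`
  -- are absorbed in this difference.
  offDiagonal-bound : Σ₂ offDiagonal ℚ.≤ 2ℚ ℚ.* 2ℚ ℚ.* (N ℚ.* N ℚ.- N) ℚ.* (a ℚ.* a) ℚ.+ 2ℚ ℚ.* N ℚ.* R
  offDiagonal-bound = ℚ.≤-trans (ℚ.≤-reflexive Σ₂-offDiagonal)
    (≤-by (2ℚ ℚ.* 2ℚ ℚ.* Rᵂ ℚ.+ 2ℚ ℚ.* N ℚ.* (R ℚ.- Rᵂ))
      (0≤+ (0≤* (0≤ι 4) 0≤Rᵂ) (0≤* (0≤* (0≤ι 2) (0≤ι (suc M))) (0≤- Rᵂ≤R))) (eq N a Rᵂ R))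
    where
    eq : ∀ n a w r → 2ℚ ℚ.* 2ℚ ℚ.* (n ℚ.* n ℚ.- n) ℚ.* (a ℚ.* a) ℚ.+ 2ℚ ℚ.* n ℚ.* r
      ≡ n ℚ.* (n ℚ.* (2ℚ ℚ.* a ℚ.* (2ℚ ℚ.* a)) ℚ.+ w) ℚ.+ n ℚ.* w ℚ.+ (ℚ.- 1ℚ) ℚ.* (2ℚ ℚ.* 2ℚ ℚ.* (n ℚ.* (a ℚ.* a) ℚ.+ w))
        ℚ.+ (2ℚ ℚ.* 2ℚ ℚ.* w ℚ.+ 2ℚ ℚ.* n ℚ.* (r ℚ.- w))
    eq = Ring.solve-∀ ℚ-ring

-- Comparison with the complete graph on a part

pairs : ∀ {n} → (Fin n → Fin n → Bool) → ℕ
pairs {n} b = sumMap (λ i → count (b i) (allFin n)) (allFin n)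

Σ₂-𝟙 : ∀ {n} (b : Fin n → Fin n → Bool) → Σ₂ (λ i j → 𝟙[ b i j ]) ≡ ι (pairs b)
Σ₂-𝟙 {n} b = trans (Σ-cong λ i → Σ-ι (λ j → # b i j)) (Σ-ι (λ i → count (b i) (allFin n)))

-- Functions of Booleans instead of vertices, so that `pair-bound` can proceed by cases and compute.
-- The counts built from them are over ordered pairs, hence twice the numbers of edges.
is-absent is-across is-outside : (within within′ equal adjacent : Bool) → Bool
is-absent  u v e b = (u ∧ v) ∧ (not e ∧ not b)
is-across  u v e b = b ∧ (u Bool.xor v)
is-outside u v e b = b ∧ (not u ∧ not v)

-- Up to c₀, which absorbs all terms quadratic in r, c₁ is what an absent edge inside the part costs
-- and c₂ what an edge leaving the part gains, compared with the complete graph on the part.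
module PairBound (k a R : ℚ) (0≤k : 0ℚ ℚ.≤ k) where

  c₀ c₁ c₂ : ℚ
  -- Weighted AM-GM: k (u + e)² ≤ (k + 1) u² + k (k + 1) e². Here e is a sum of two entries of `r`,
  -- so e² ≤ 4 R. Everything is multiplied by k to avoid division.
  c₀  = k ℚ.* (k ℚ.+ 1ℚ) ℚ.* (2ℚ ℚ.* 2ℚ ℚ.* R)
  c₁ = c₀ ℚ.- 2ℚ ℚ.* 2ℚ ℚ.* (k ℚ.- 1ℚ) ℚ.* (a ℚ.* a)
  c₂ = (k ℚ.+ 1ℚ) ℚ.* (a ℚ.* a) ℚ.+ c₀

  bound : (w w′ d β γ ρ Q : ℚ) → ℚ
  bound w w′ d β γ ρ Q = k ℚ.* (w ℚ.* (w′ ℚ.* Q) ℚ.+ (ℚ.- 1ℚ) ℚ.* (d ℚ.* (w ℚ.* Q))) ℚ.+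
      (β ℚ.* c₁ ℚ.+ (γ ℚ.* c₂ ℚ.+ ρ ℚ.* c₀))

  module _ (x x′ : ℚ) (x≤ : x ℚ.* x ℚ.≤ R) (x′≤ : x′ ℚ.* x′ ℚ.≤ R) where

    e Q : ℚ
    e = x ℚ.+ x′
    Q = (2ℚ ℚ.* a ℚ.+ x ℚ.+ x′) ℚ.* (2ℚ ℚ.* a ℚ.+ x ℚ.+ x′)

    slack : ℚ
    slack = c₀ ℚ.- k ℚ.* (k ℚ.+ 1ℚ) ℚ.* (e ℚ.* e)

    0≤slack : 0ℚ ℚ.≤ slack
    0≤slack = ℚ.≤-trans
      (0≤* (0≤* 0≤k (0≤+ 0≤k (0≤ι 1)))
        (0≤+ (0≤+ (0≤* (0≤ι 2) (0≤- x≤)) (0≤* (0≤ι 2) (0≤- x′≤))) (0≤square (x ℚ.- x′))))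
      (ℚ.≤-reflexive (eq k R x x′))
      where
      eq : ∀ k R x y → k ℚ.* (k ℚ.+ 1ℚ) ℚ.* (2ℚ ℚ.* (R ℚ.- x ℚ.* x) ℚ.+ 2ℚ ℚ.* (R ℚ.- y ℚ.* y) ℚ.+ (x ℚ.- y) ℚ.* (x ℚ.- y))
        ≡ k ℚ.* (k ℚ.+ 1ℚ) ℚ.* (2ℚ ℚ.* 2ℚ ℚ.* R) ℚ.- k ℚ.* (k ℚ.+ 1ℚ) ℚ.* ((x ℚ.+ y) ℚ.* (x ℚ.+ y))
      eq = Ring.solve-∀ ℚ-ring

    absent-core : 0ℚ ℚ.≤ k ℚ.* Q ℚ.+ c₁
    absent-core = ℚ.≤-trans
      (0≤+ (0≤+ (0≤square (2ℚ ℚ.* a ℚ.+ k ℚ.* e)) (0≤* (0≤* (0≤ι 2) 0≤k) (0≤square e))) 0≤slack)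
      (ℚ.≤-reflexive (eq k a x x′ c₀))
      where
      eq : ∀ k a x y c₀ → (2ℚ ℚ.* a ℚ.+ k ℚ.* (x ℚ.+ y)) ℚ.* (2ℚ ℚ.* a ℚ.+ k ℚ.* (x ℚ.+ y)) ℚ.+ 2ℚ ℚ.* k ℚ.*
          ((x ℚ.+ y) ℚ.* (x ℚ.+ y))
          ℚ.+ (c₀ ℚ.- k ℚ.* (k ℚ.+ 1ℚ) ℚ.* ((x ℚ.+ y) ℚ.* (x ℚ.+ y)))
        ≡ k ℚ.* ((2ℚ ℚ.* a ℚ.+ x ℚ.+ y) ℚ.* (2ℚ ℚ.* a ℚ.+ x ℚ.+ y)) ℚ.+ (c₀ ℚ.- 2ℚ ℚ.* 2ℚ ℚ.* (k ℚ.- 1ℚ) ℚ.* (a ℚ.* a))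
      eq = Ring.solve-∀ ℚ-ring

    across-core : k ℚ.* ((a ℚ.+ e) ℚ.* (a ℚ.+ e)) ℚ.≤ c₂
    across-core = ≤-by _ (0≤+ (0≤square (a ℚ.- k ℚ.* e)) 0≤slack) (eq k a e c₀)
      where
      eq : ∀ k a e c₀ → (k ℚ.+ 1ℚ) ℚ.* (a ℚ.* a) ℚ.+ c₀ ≡ k ℚ.* ((a ℚ.+ e) ℚ.* (a ℚ.+ e))
        ℚ.+ ((a ℚ.- k ℚ.* e) ℚ.* (a ℚ.- k ℚ.* e) ℚ.+ (c₀ ℚ.- k ℚ.* (k ℚ.+ 1ℚ) ℚ.* (e ℚ.* e)))
      eq = Ring.solve-∀ ℚ-ring

    outside-core : k ℚ.* (e ℚ.* e) ℚ.≤ c₀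
    outside-core = ≤-by _ (0≤+ (0≤* (0≤* 0≤k 0≤k) (0≤square e)) 0≤slack) (eq k e c₀)
      where
      eq : ∀ k e c₀ → c₀ ≡ k ℚ.* (e ℚ.* e) ℚ.+ (k ℚ.* k ℚ.* (e ℚ.* e) ℚ.+ (c₀ ℚ.- k ℚ.* (k ℚ.+ 1ℚ) ℚ.* (e ℚ.* e)))
      eq = Ring.solve-∀ ℚ-ring

    private
      both : ∀ k a x y → k ℚ.* (1ℚ ℚ.* ((1ℚ ℚ.* a ℚ.+ x ℚ.+ (1ℚ ℚ.* a ℚ.+ y)) ℚ.*
          (1ℚ ℚ.* a ℚ.+ x ℚ.+ (1ℚ ℚ.* a ℚ.+ y)))) ≡ k ℚ.* ((2ℚ ℚ.* a ℚ.+ x ℚ.+ y) ℚ.* (2ℚ ℚ.* a ℚ.+ x ℚ.+ y))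
      both = Ring.solve-∀ ℚ-ring
      left : ∀ k a x y → k ℚ.* (1ℚ ℚ.* ((1ℚ ℚ.* a ℚ.+ x ℚ.+ (0ℚ ℚ.* a ℚ.+ y)) ℚ.*
          (1ℚ ℚ.* a ℚ.+ x ℚ.+ (0ℚ ℚ.* a ℚ.+ y)))) ≡ k ℚ.* ((a ℚ.+ (x ℚ.+ y)) ℚ.* (a ℚ.+ (x ℚ.+ y)))
      left = Ring.solve-∀ ℚ-ring
      right : ∀ k a x y → k ℚ.* (1ℚ ℚ.* ((0ℚ ℚ.* a ℚ.+ x ℚ.+ (1ℚ ℚ.* a ℚ.+ y)) ℚ.*
          (0ℚ ℚ.* a ℚ.+ x ℚ.+ (1ℚ ℚ.* a ℚ.+ y)))) ≡ k ℚ.* ((a ℚ.+ (x ℚ.+ y)) ℚ.* (a ℚ.+ (x ℚ.+ y)))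
      right = Ring.solve-∀ ℚ-ring
      neither : ∀ k a x y → k ℚ.* (1ℚ ℚ.* ((0ℚ ℚ.* a ℚ.+ x ℚ.+ (0ℚ ℚ.* a ℚ.+ y)) ℚ.*
          (0ℚ ℚ.* a ℚ.+ x ℚ.+ (0ℚ ℚ.* a ℚ.+ y)))) ≡ k ℚ.* ((x ℚ.+ y) ℚ.* (x ℚ.+ y))
      neither = Ring.solve-∀ ℚ-ring
      none : ∀ k s → k ℚ.* (0ℚ ℚ.* s) ≡ 0ℚ
      none = Ring.solve-∀ ℚ-ring
      bound-both : ∀ k Q c c′ c₀ → k ℚ.* Q ≡ k ℚ.* (1ℚ ℚ.* (1ℚ ℚ.* Q) ℚ.+ (ℚ.- 1ℚ) ℚ.* (0ℚ ℚ.* (1ℚ ℚ.* Q))) ℚ.+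
          (0ℚ ℚ.* c ℚ.+ (0ℚ ℚ.* c′ ℚ.+ 0ℚ ℚ.* c₀))
      bound-both = Ring.solve-∀ ℚ-ring
      bound-absent : ∀ k Q c c′ c₀ → k ℚ.* Q ℚ.+ c ≡ k ℚ.* (1ℚ ℚ.* (1ℚ ℚ.* Q) ℚ.+ (ℚ.- 1ℚ) ℚ.* (0ℚ ℚ.* (1ℚ ℚ.* Q)))
          ℚ.+ (1ℚ ℚ.* c ℚ.+ (0ℚ ℚ.* c′ ℚ.+ 0ℚ ℚ.* c₀))
      bound-absent = Ring.solve-∀ ℚ-ring
      bound-diagonal : ∀ k Q c c′ c₀ → 0ℚ ≡ k ℚ.* (1ℚ ℚ.* (1ℚ ℚ.* Q) ℚ.+ (ℚ.- 1ℚ) ℚ.* (1ℚ ℚ.* (1ℚ ℚ.* Q))) ℚ.+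
          (0ℚ ℚ.* c ℚ.+ (0ℚ ℚ.* c′ ℚ.+ 0ℚ ℚ.* c₀))
      bound-diagonal = Ring.solve-∀ ℚ-ring
      bound-left : ∀ γ k Q c c′ c₀ → γ ℚ.* c′ ≡ k ℚ.* (1ℚ ℚ.* (0ℚ ℚ.* Q) ℚ.+ (ℚ.- 1ℚ) ℚ.* (0ℚ ℚ.* (1ℚ ℚ.* Q))) ℚ.+
          (0ℚ ℚ.* c ℚ.+ (γ ℚ.* c′ ℚ.+ 0ℚ ℚ.* c₀))
      bound-left = Ring.solve-∀ ℚ-ring
      bound-right : ∀ w′ d γ ρ k Q c c′ c₀ → γ ℚ.* c′ ℚ.+ ρ ℚ.* c₀ ≡ k ℚ.*
          (0ℚ ℚ.* (w′ ℚ.* Q) ℚ.+ (ℚ.- 1ℚ) ℚ.* (d ℚ.* (0ℚ ℚ.* Q))) ℚ.+ (0ℚ ℚ.* c ℚ.+ (γ ℚ.* c′ ℚ.+ ρ ℚ.* c₀))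
      bound-right = Ring.solve-∀ ℚ-ring
      c₂-only : ∀ c′ c₀ → c′ ≡ 1ℚ ℚ.* c′ ℚ.+ 0ℚ ℚ.* c₀
      c₂-only = Ring.solve-∀ ℚ-ring
      c₀-only : ∀ c′ c₀ → c₀ ≡ 0ℚ ℚ.* c′ ℚ.+ 1ℚ ℚ.* c₀
      c₀-only = Ring.solve-∀ ℚ-ring
      nothing : ∀ c′ c₀ → 0ℚ ≡ 0ℚ ℚ.* c′ ℚ.+ 0ℚ ℚ.* c₀
      nothing = Ring.solve-∀ ℚ-ring
      chain : ∀ {p q s t} → p ≡ q → q ℚ.≤ s → s ≡ t → p ℚ.≤ t
      chain refl q≤s refl = q≤s

    sum² : Bool → Bool → ℚ
    sum² u v = (𝟙[ u ] ℚ.* a ℚ.+ x ℚ.+ (𝟙[ v ] ℚ.* a ℚ.+ x′)) ℚ.* (𝟙[ u ] ℚ.* a ℚ.+ x ℚ.+ (𝟙[ v ] ℚ.* a ℚ.+ x′))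

    pair-bound : ∀ u v d b → (d ≡ true → u ≡ v × b ≡ false) →
      k ℚ.* (𝟙[ b ] ℚ.* sum² u v) ℚ.≤
      bound 𝟙[ u ] 𝟙[ v ] 𝟙[ d ] 𝟙[ is-absent u v d b ] 𝟙[ is-across u v d b ] 𝟙[ is-outside u v d b ] Q
    pair-bound u     v     true  true  diag with diag refl
    ... | _ , ()
    pair-bound true  true  true  false diag = chain (none k (sum² true true)) ℚ.≤-refl (bound-diagonal k Q c₁ c₂ c₀)
    pair-bound true  false true  b     diag with diag refl
    ... | () , _
    pair-bound false true  true  b     diag with diag refl
    ... | () , _
    pair-bound true  true  false true  _ = chain (both k a x x′) ℚ.≤-refl (bound-both k Q c₁ c₂ c₀)
    pair-bound true  true  false false _ = chain (none k (sum² true true)) absent-core (bound-absent k Q c₁ c₂ c₀)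
    pair-bound true  false false true  _ = chain (left k a x x′) across-core
        (trans (sym (ℚ.*-identityˡ c₂)) (bound-left 1ℚ k Q c₁ c₂ c₀))
    pair-bound true  false false false _ = chain (none k (sum² true false)) ℚ.≤-refl
        (trans (sym (ℚ.*-zeroˡ c₂)) (bound-left 0ℚ k Q c₁ c₂ c₀))
    pair-bound false true  false true  _ = chain (right k a x x′) across-core
        (trans (c₂-only c₂ c₀) (bound-right 1ℚ 0ℚ 1ℚ 0ℚ k Q c₁ c₂ c₀))
    pair-bound false true  false false _ = chain (none k (sum² false true)) ℚ.≤-refl
        (trans (nothing c₂ c₀) (bound-right 1ℚ 0ℚ 0ℚ 0ℚ k Q c₁ c₂ c₀))
    pair-bound false false false true  _ = chain (neither k a x x′) outside-core
        (trans (c₀-only c₂ c₀) (bound-right 0ℚ 0ℚ 0ℚ 1ℚ k Q c₁ c₂ c₀))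
    pair-bound false false false false _ = chain (none k (sum² false false)) ℚ.≤-refl
        (trans (nothing c₂ c₀) (bound-right 0ℚ 0ℚ 0ℚ 0ℚ k Q c₁ c₂ c₀))
    pair-bound false false true  false _ = chain (none k (sum² false false)) ℚ.≤-refl
        (trans (nothing c₂ c₀) (bound-right 0ℚ 1ℚ 0ℚ 0ℚ k Q c₁ c₂ c₀))

module _ {n} (G : Graph n) (χ : Fin n → Bool) where

  absentWithin presentAcross presentOutside : Fin n → Fin n → Bool
  absentWithin   i j = is-absent  (χ i) (χ j) (does (i Fin.≟ j)) (adj G i j)
  presentAcross  i j = is-across  (χ i) (χ j) (does (i Fin.≟ j)) (adj G i j)
  presentOutside i j = is-outside (χ i) (χ j) (does (i Fin.≟ j)) (adj G i j)

  -- The excess of 2 is shared out. `K` is the AM-GM weight: a relative loss of 1 / K on at most `K`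
  -- units of a² costs at most one unit, and the other one is the -1 in `F-bound`. `P` bounds the
  -- number of pairs that contribute a multiple of `R`, and `M-large` makes these multiples fit into
  -- the room left by `offDiagonal-bound`.
  module PartBound (K P M : ℕ) (|χ| : count χ (allFin n) ≡ suc M)
    (excess : pairs presentAcross + 2 ≤ 4 * pairs absentWithin)
    (K-large : pairs presentAcross + 4 * pairs absentWithin ≤ K)
    (P-large : pairs absentWithin + pairs presentAcross + pairs presentOutside ≤ P)
    (M-large : 4 * (suc K * P) + 5 ≤ 2 * suc M)
    (y : Fin n → ℚ) where

    open WeightedMean χ y M |χ|
    open ℚ.≤-Reasoning

    k β γ ρ F A : ℚ
    k = ι K
    β = ι (pairs absentWithin)
    γ = ι (pairs presentAcross)
    ρ = ι (pairs presentOutside)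
    F = edgeForm G y
    A = a ℚ.* a

    open PairBound k a R (0≤ι K)

    pointwise : ∀ i j → k ℚ.* (𝟙[ adj G i j ] ℚ.* ((y i ℚ.+ y j) ℚ.* (y i ℚ.+ y j))) ℚ.≤
      bound (ω i) (ω j) (δ i j) 𝟙[ absentWithin i j ] 𝟙[ presentAcross i j ] 𝟙[ presentOutside i j ] (q i j)
    pointwise i j = subst₂ (λ u v → k ℚ.* (𝟙[ adj G i j ] ℚ.* ((u ℚ.+ v) ℚ.* (u ℚ.+ v))) ℚ.≤
        bound (ω i) (ω j) (δ i j) 𝟙[ absentWithin i j ] 𝟙[ presentAcross i j ] 𝟙[ presentOutside i j ] (q i j))
      (sym (y≡ i)) (sym (y≡ j))
      (pair-bound (r i) (r j) (r²≤R i) (r²≤R j) (χ i) (χ j) (does (i Fin.≟ j)) (adj G i j) diag)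
      where
      diag : does (i Fin.≟ j) ≡ true → χ i ≡ χ j × adj G i j ≡ false
      diag eq with i Fin.≟ j
      ... | yes refl = refl , adj-irrefl G i
      diag () | no _

    summed : k ℚ.* F ℚ.≤ k ℚ.* (2ℚ ℚ.* 2ℚ ℚ.* (N ℚ.* N ℚ.- N) ℚ.* A ℚ.+ 2ℚ ℚ.* N ℚ.* R) ℚ.+
        (β ℚ.* c₁ ℚ.+ (γ ℚ.* c₂ ℚ.+ ρ ℚ.* c₀))
    summed = begin
      k ℚ.* F
        ≡⟨ Σ₂-*ˡ {n} k _ ⟨
      Σ₂ (λ i j → k ℚ.* (𝟙[ adj G i j ] ℚ.* ((y i ℚ.+ y j) ℚ.* (y i ℚ.+ y j))))
        ≤⟨ Σ₂-mono pointwise ⟩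
      Σ₂ (λ i j → bound (ω i) (ω j) (δ i j) 𝟙[ absentWithin i j ] 𝟙[ presentAcross i j ] 𝟙[ presentOutside i j ] (q i j))
        ≡⟨ trans (Σ₂-+ {n} _ _) (cong₂ ℚ._+_ (Σ₂-*ˡ {n} k offDiagonal)
            (trans (Σ₂-+ {n} _ _) (cong₂ ℚ._+_ (weigh c₁ absentWithin)
            (trans (Σ₂-+ {n} _ _) (cong₂ ℚ._+_ (weigh c₂ presentAcross) (weigh c₀ presentOutside)))))) ⟩
      k ℚ.* Σ₂ offDiagonal ℚ.+ (β ℚ.* c₁ ℚ.+ (γ ℚ.* c₂ ℚ.+ ρ ℚ.* c₀))
        ≤⟨ ℚ.+-monoˡ-≤ (β ℚ.* c₁ ℚ.+ (γ ℚ.* c₂ ℚ.+ ρ ℚ.* c₀)) (*-monoˡ (0≤ι K) offDiagonal-bound) ⟩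
      k ℚ.* (2ℚ ℚ.* 2ℚ ℚ.* (N ℚ.* N ℚ.- N) ℚ.* A ℚ.+ 2ℚ ℚ.* N ℚ.* R) ℚ.+ (β ℚ.* c₁ ℚ.+ (γ ℚ.* c₂ ℚ.+ ρ ℚ.* c₀)) ∎
      where
      weigh : ∀ c (b : Fin n → Fin n → Bool) → Σ₂ (λ i j → 𝟙[ b i j ] ℚ.* c) ≡ ι (pairs b) ℚ.* c
      weigh c b = trans (Σ₂-*ʳ {n} c _) (cong (ℚ._* c) (Σ₂-𝟙 b))

    0<k : 0ℚ ℚ.< k
    0<k = ℚ.<-≤-trans (0<ι 0) (ι-mono (ℕ.≤-trans (ℕ.≤-trans (s≤s z≤n) (ℕ.m≤n+m 2 (pairs presentAcross)))
      (ℕ.≤-trans excess (ℕ.≤-trans (ℕ.m≤n+m _ (pairs presentAcross)) K-large))))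

    ι-4* : ∀ m → ι (4 * m) ≡ 2ℚ ℚ.* 2ℚ ℚ.* ι m
    ι-4* m = ι-* 4 m

    excessℚ : 0ℚ ℚ.≤ 2ℚ ℚ.* 2ℚ ℚ.* β ℚ.- (γ ℚ.+ 2ℚ)
    excessℚ = 0≤- (subst₂ ℚ._≤_ (ι-+ (pairs presentAcross) 2) (ι-4* (pairs absentWithin)) (ι-mono excess))

    K-largeℚ : 0ℚ ℚ.≤ k ℚ.- (γ ℚ.+ 2ℚ ℚ.* 2ℚ ℚ.* β)
    K-largeℚ = 0≤- (subst (ℚ._≤ k) (trans (ι-+ (pairs presentAcross) _) (cong (γ ℚ.+_) (ι-4* (pairs absentWithin))))
        (ι-mono K-large))

    P-largeℚ : 0ℚ ℚ.≤ ι P ℚ.- (β ℚ.+ γ ℚ.+ ρ)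
    P-largeℚ = 0≤- (subst (ℚ._≤ ι P) (trans (ι-+ (pairs absentWithin + pairs presentAcross) _)
        (cong (ℚ._+ ρ) (ι-+ (pairs absentWithin) _))) (ι-mono P-large))

    M-largeℚ : 0ℚ ℚ.≤ 2ℚ ℚ.* N ℚ.- (2ℚ ℚ.* 2ℚ ℚ.* ((1ℚ ℚ.+ k) ℚ.* ι P) ℚ.+ ι 5)
    M-largeℚ = 0≤- (subst₂ ℚ._≤_ (trans (ι-+ (4 * (suc K * P)) 5)
        (cong (ℚ._+ ι 5) (trans (ι-4* (suc K * P)) (cong (2ℚ ℚ.* 2ℚ ℚ.*_) (ι-* (suc K) P)))))
      (ι-* 2 (suc M)) (ι-mono M-large))

    F-bound : F ℚ.≤ (2ℚ ℚ.* 2ℚ ℚ.* (N ℚ.* N ℚ.- N) ℚ.- 1ℚ) ℚ.* A ℚ.+ (2ℚ ℚ.* N ℚ.+ 2ℚ ℚ.* 2ℚ ℚ.* ((1ℚ ℚ.+ k) ℚ.* ι P)) ℚ.* R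
    F-bound = *-cancelˡ 0<k (ℚ.≤-trans summed (≤-by _
      (0≤+ (0≤* (0≤square a) (0≤+ (0≤* (0≤ι K) excessℚ) K-largeℚ))
          (0≤* P-largeℚ (0≤* (0≤* (0≤ι K) (0≤+ (0≤ι K) (0≤ι 1))) (0≤* (0≤ι 4) 0≤R))))
      (eq k N a R β γ ρ (ι P))))
      where
      eq : ∀ k N a R β γ ρ P → k ℚ.* ((2ℚ ℚ.* 2ℚ ℚ.* (N ℚ.* N ℚ.- N) ℚ.- 1ℚ) ℚ.* (a ℚ.* a) ℚ.+
          (2ℚ ℚ.* N ℚ.+ 2ℚ ℚ.* 2ℚ ℚ.* ((1ℚ ℚ.+ k) ℚ.* P)) ℚ.* R)
        ≡ k ℚ.* (2ℚ ℚ.* 2ℚ ℚ.* (N ℚ.* N ℚ.- N) ℚ.* (a ℚ.* a) ℚ.+ 2ℚ ℚ.* N ℚ.* R)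
          ℚ.+ (β ℚ.* (k ℚ.* (k ℚ.+ 1ℚ) ℚ.* (2ℚ ℚ.* 2ℚ ℚ.* R) ℚ.- 2ℚ ℚ.* 2ℚ ℚ.* (k ℚ.- 1ℚ) ℚ.* (a ℚ.* a))
            ℚ.+ (γ ℚ.* ((k ℚ.+ 1ℚ) ℚ.* (a ℚ.* a) ℚ.+ k ℚ.* (k ℚ.+ 1ℚ) ℚ.* (2ℚ ℚ.* 2ℚ ℚ.* R))
            ℚ.+ ρ ℚ.* (k ℚ.* (k ℚ.+ 1ℚ) ℚ.* (2ℚ ℚ.* 2ℚ ℚ.* R))))
          ℚ.+ (a ℚ.* a ℚ.* (k ℚ.* (2ℚ ℚ.* 2ℚ ℚ.* β ℚ.- (γ ℚ.+ 2ℚ)) ℚ.+ (k ℚ.- (γ ℚ.+ 2ℚ ℚ.* 2ℚ ℚ.* β)))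
            ℚ.+ (P ℚ.- (β ℚ.+ γ ℚ.+ ρ)) ℚ.* (k ℚ.* (k ℚ.+ 1ℚ) ℚ.* (2ℚ ℚ.* 2ℚ ℚ.* R)))
      eq = Ring.solve-∀ ℚ-ring

    -- The ratio ν / μ is 2 (N - 1) - 1 / (2 N), just below the value of the complete graph; the
    -- multiplier 2 N clears its denominator.
    edgeForm-part-bound : ι (2 * suc M) ℚ.* edgeForm G y ℚ.≤ 2ℚ ℚ.*
        (ι (4 * (suc M * suc M)) ℚ.- ι (4 * suc M + 1)) ℚ.* norm² y
    edgeForm-part-bound = begin
      ι (2 * suc M) ℚ.* F
        ≡⟨ cong (ℚ._* F) (ι-* 2 (suc M)) ⟩
      2ℚ ℚ.* N ℚ.* F
        ≤⟨ *-monoˡ (0≤* (0≤ι 2) (0≤ι (suc M))) F-bound ⟩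
      2ℚ ℚ.* N ℚ.* ((2ℚ ℚ.* 2ℚ ℚ.* (N ℚ.* N ℚ.- N) ℚ.- 1ℚ) ℚ.* A ℚ.+ (2ℚ ℚ.* N ℚ.+ 2ℚ ℚ.* 2ℚ ℚ.* ((1ℚ ℚ.+ k) ℚ.* ι P)) ℚ.* R)
        -- For the coefficients of `R`, 4 (1 + k) P may be at most 2 N - 4 - 1 / N; the 5 in
        -- `M-large` covers 4 + 1 / N.
        ≤⟨ ≤-by _ (0≤* 0≤R (0≤+ (0≤* (0≤* (0≤ι 2) (0≤ι (suc M))) M-largeℚ)
            (0≤* (0≤ι 2) (0≤- (ι-mono {1} {suc M} (s≤s z≤n)))))) (eq N A R (ι P) k) ⟩
      2ℚ ℚ.* (2ℚ ℚ.* 2ℚ ℚ.* (N ℚ.* N) ℚ.- (2ℚ ℚ.* 2ℚ ℚ.* N ℚ.+ 1ℚ)) ℚ.* (N ℚ.* A ℚ.+ R)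
        ≡⟨ cong₂ (λ u v → 2ℚ ℚ.* (u ℚ.- v) ℚ.* (N ℚ.* A ℚ.+ R))
            (trans (ι-4* (suc M * suc M)) (cong (2ℚ ℚ.* 2ℚ ℚ.*_) (ι-* (suc M) (suc M))))
            (trans (ι-+ (4 * suc M) 1) (cong (ℚ._+ 1ℚ) (ι-4* (suc M)))) ⟨
      2ℚ ℚ.* (ι (4 * (suc M * suc M)) ℚ.- ι (4 * suc M + 1)) ℚ.* (N ℚ.* A ℚ.+ R)
        ≡⟨ cong (2ℚ ℚ.* (ι (4 * (suc M * suc M)) ℚ.- ι (4 * suc M + 1)) ℚ.*_) norm²-split ⟨
      2ℚ ℚ.* (ι (4 * (suc M * suc M)) ℚ.- ι (4 * suc M + 1)) ℚ.* norm² y ∎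
      where
      eq : ∀ N A R P k → 2ℚ ℚ.* (2ℚ ℚ.* 2ℚ ℚ.* (N ℚ.* N) ℚ.- (2ℚ ℚ.* 2ℚ ℚ.* N ℚ.+ 1ℚ)) ℚ.* (N ℚ.* A ℚ.+ R)
        ≡ 2ℚ ℚ.* N ℚ.* ((2ℚ ℚ.* 2ℚ ℚ.* (N ℚ.* N ℚ.- N) ℚ.- 1ℚ) ℚ.* A ℚ.+
            (2ℚ ℚ.* N ℚ.+ 2ℚ ℚ.* 2ℚ ℚ.* ((1ℚ ℚ.+ k) ℚ.* P)) ℚ.* R)
          ℚ.+ R ℚ.* (2ℚ ℚ.* N ℚ.* (2ℚ ℚ.* N ℚ.- (2ℚ ℚ.* 2ℚ ℚ.* ((1ℚ ℚ.+ k) ℚ.* P) ℚ.+ (1ℚ ℚ.+ (1ℚ ℚ.+ (1ℚ ℚ.+ 2ℚ)))))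
              ℚ.+ 2ℚ ℚ.* (N ℚ.- 1ℚ))
      eq = Ring.solve-∀ ℚ-ring

-- Eigenvalues of the signless Laplacian

∣tabulate∣ : ∀ {n} (f : Fin n → Bool) → ∣ Vec.tabulate f ∣ ≡ count f (allFin n)
∣tabulate∣ {n} f = go f id
  where
  go : ∀ {n} {V : Set} (f : V → Bool) (g : Fin n → V) → ∣ Vec.tabulate (f ∘ g) ∣ ≡ count f (List.tabulate g)
  go {zero}  f g = refl
  go {suc n} f g with f (g Fin.zero)
  ... | true  = cong suc (go f (g ∘ Fin.suc))
  ... | false = go f (g ∘ Fin.suc)

degree≡ : ∀ (G : Graph n) u → degree G u ≡ degreeIn G (allFin n) u
degree≡ G u = ∣tabulate∣ (adj G u)

minDegree≤degree : ∀ (G : Graph n) u → minDegree G ≤ degreeIn G (allFin n) u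
minDegree≤degree {n} G u = subst (minDegree G ≤_) (degree≡ G u)
  (All.lookup (Extrema.min≤xs n (map (degree G) (allFin n))) (∈.∈-map⁺ (degree G) (∈.∈-allFin u)))

seq-∑ : ∀ {n} (f : Fin n → ℝ) t → seq (∑ f) t ≡ Σℚ (λ j → seq (f j) t)
seq-∑ {zero}  f t = refl
seq-∑ {suc n} f t = cong (seq (f Fin.zero) t ℚ.+_) (seq-∑ (f ∘ Fin.suc) t)

seq-if : ∀ b (x y : ℝ) t → seq (if b then x else y) t ≡ (if b then seq x t else seq y t)
seq-if true  x y t = refl
seq-if false x y t = refl

if-0 : ∀ b {p d} → p ≡ d → (if b then p else 0ℚ) ≡ 𝟙[ b ] ℚ.* d
if-0 true  {d = d} p≡d = trans p≡d (sym (ℚ.*-identityˡ d))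
if-0 false {d = d} _   = sym (ℚ.*-zeroˡ d)

seq-degreeMatrix : ∀ (G : Graph n) i j t → seq (degreeMatrix G i j) t ≡ 𝟙[ does (i Fin.≟ j) ] ℚ.* ι (degreeIn G (allFin n) i)
seq-degreeMatrix G i j t = trans (seq-if (does (i Fin.≟ j)) (fromℤ (ℤ.+ degree G i)) 0ℝ t)
  (if-0 (does (i Fin.≟ j)) (trans (/1≡ι (degree G i)) (cong ι (degree≡ G i))))

seq-adjacencyMatrix : ∀ (G : Graph n) i j t → seq (adjacencyMatrix G i j) t ≡ 𝟙[ adj G i j ]
seq-adjacencyMatrix G i j t = trans (seq-if (adj G i j) 1ℝ 0ℝ t)
  (trans (if-0 (adj G i j) refl) (ℚ.*-identityʳ 𝟙[ adj G i j ]))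

eventually-all : ∀ {n} {P : Fin n → ℕ → Set} → (∀ i → ∃[ N ] ∀ t → N ≤ t → P i t) → ∃[ N ] ∀ t → N ≤ t → ∀ i → P i t
eventually-all {zero}  ev = 0 , λ _ _ ()
eventually-all {suc n} ev with ev Fin.zero | eventually-all (ev ∘ Fin.suc)
... | M , p | N , q = M ⊔ N , λ t M⊔N≤t → λ
  { Fin.zero    → p t (ℕ.m⊔n≤o⇒m≤o M N M⊔N≤t)
  ; (Fin.suc i) → q t (ℕ.m⊔n≤o⇒n≤o M N M⊔N≤t) i }

square-cancel-≤ : ∀ {p q} → 0ℚ ℚ.≤ q → p ℚ.* p ℚ.≤ q ℚ.* q → ℚ.∣ p ∣ ℚ.≤ q
square-cancel-≤ {p} {q} 0≤q p²≤q² = ℚ.≮⇒≥ λ q<∣p∣ → ℚ.<-irrefl refl (begin-strict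
    q ℚ.* q             ≤⟨ *-monoˡ 0≤q (ℚ.<⇒≤ q<∣p∣) ⟩
    q ℚ.* ℚ.∣ p ∣       <⟨ ℚ.*-monoˡ-<-pos ℚ.∣ p ∣ {{ℚ.positive (ℚ.≤-<-trans 0≤q q<∣p∣)}} q<∣p∣ ⟩
    ℚ.∣ p ∣ ℚ.* ℚ.∣ p ∣ ≡⟨ ∣p∣*∣p∣≡p*p p ⟩
    p ℚ.* p             ≤⟨ p²≤q² ⟩
    q ℚ.* q             ∎)
  where open ℚ.≤-Reasoning

square-mono-≤ : ∀ {p q} → ℚ.∣ p ∣ ℚ.≤ q → p ℚ.* p ℚ.≤ q ℚ.* q
square-mono-≤ {p} {q} ∣p∣≤q = begin
  p ℚ.* p             ≡⟨ ∣p∣*∣p∣≡p*p p ⟨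
  ℚ.∣ p ∣ ℚ.* ℚ.∣ p ∣ ≤⟨ *-monoˡ (ℚ.0≤∣p∣ p) ∣p∣≤q ⟩
  ℚ.∣ p ∣ ℚ.* q       ≤⟨ *-monoʳ (ℚ.≤-trans (ℚ.0≤∣p∣ p) ∣p∣≤q) ∣p∣≤q ⟩
  q ℚ.* q             ∎
  where open ℚ.≤-Reasoning

factor-positive : ∀ {d z} → 0ℚ ℚ.< d → 0ℚ ℚ.< d ℚ.* z → 0ℚ ℚ.< z
factor-positive {d} {z} 0<d 0<dz = ℚ.*-cancelˡ-<-nonNeg d {{ℚ.nonNegative (ℚ.<⇒≤ 0<d)}}
  (subst (ℚ._< d ℚ.* z) (sym (ℚ.*-zeroʳ d)) 0<dz)

0<* : ∀ {p q} → 0ℚ ℚ.< p → 0ℚ ℚ.< q → 0ℚ ℚ.< p ℚ.* q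
0<* {p} {q} 0<p 0<q = ℚ.positive⁻¹ (p ℚ.* q) {{ℚ.pos*pos⇒pos p {{ℚ.positive 0<p}} q {{ℚ.positive 0<q}}}}

module _ {n} (G : Graph n) where

  applyQ : (Fin n → ℚ) → Fin n → ℚ
  applyQ y i = ι (degreeIn G (allFin n) i) ℚ.* y i ℚ.+ Σℚ (λ j → 𝟙[ adj G i j ] ℚ.* y j)

  edgeForm≡ : ∀ y → edgeForm G y ≡ 2ℚ ℚ.* Σℚ (λ i → y i ℚ.* applyQ y i)
  edgeForm≡ y = trans (symmetrize G (λ i j → y i ℚ.* y i ℚ.+ y i ℚ.* y j) _ (λ i j → eq (y i) (y j)))
    (cong (2ℚ ℚ.*_) (Σ-cong λ i → begin
      Σℚ (λ j → 𝟙[ adj G i j ] ℚ.* (y i ℚ.* y i ℚ.+ y i ℚ.* y j))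
        ≡⟨ Σ-cong (λ j → eq′ 𝟙[ adj G i j ] (y i) (y j)) ⟩
      Σℚ (λ j → 𝟙[ adj G i j ] ℚ.* (y i ℚ.* y i) ℚ.+ y i ℚ.* (𝟙[ adj G i j ] ℚ.* y j))
        ≡⟨ Σ-+ {n} _ _ ⟩
      Σℚ (λ j → 𝟙[ adj G i j ] ℚ.* (y i ℚ.* y i)) ℚ.+ Σℚ (λ j → y i ℚ.* (𝟙[ adj G i j ] ℚ.* y j))
        ≡⟨ cong₂ ℚ._+_ (trans (Σ-*ʳ {n} (y i ℚ.* y i) _) (cong (ℚ._* (y i ℚ.* y i)) (Σ-adj G i))) (Σ-*ˡ {n} (y i) _) ⟩
      ι (degreeIn G (allFin n) i) ℚ.* (y i ℚ.* y i) ℚ.+ y i ℚ.* Σℚ (λ j → 𝟙[ adj G i j ] ℚ.* y j)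
        ≡⟨ eq″ (ι (degreeIn G (allFin n) i)) (y i) _ ⟩
      y i ℚ.* applyQ y i ∎))
    where
    open ≡-Reasoning
    eq : ∀ x z → (x ℚ.+ z) ℚ.* (x ℚ.+ z) ≡ x ℚ.* x ℚ.+ x ℚ.* z ℚ.+ (z ℚ.* z ℚ.+ z ℚ.* x)
    eq = Ring.solve-∀ ℚ-ring
    eq′ : ∀ b x z → b ℚ.* (x ℚ.* x ℚ.+ x ℚ.* z) ≡ b ℚ.* (x ℚ.* x) ℚ.+ x ℚ.* (b ℚ.* z)
    eq′ = Ring.solve-∀ ℚ-ring
    eq″ : ∀ d x s → d ℚ.* (x ℚ.* x) ℚ.+ x ℚ.* s ≡ x ℚ.* (d ℚ.* x ℚ.+ s)
    eq″ = Ring.solve-∀ ℚ-ring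

  seq-signlessLaplacian : ∀ (x : Fin n → ℝ) i t →
    seq (∑ (λ j → signlessLaplacian G i j *ℝ x j)) t ≡ applyQ (λ j → seq (x j) t) i
  seq-signlessLaplacian x i t = begin
    seq (∑ (λ j → signlessLaplacian G i j *ℝ x j)) t
      ≡⟨ seq-∑ (λ j → signlessLaplacian G i j *ℝ x j) t ⟩
    Σℚ (λ j → (seq (degreeMatrix G i j) t ℚ.+ seq (adjacencyMatrix G i j) t) ℚ.* y j)
      ≡⟨ Σ-cong (λ j → trans (cong₂ (λ u v → (u ℚ.+ v) ℚ.* y j) (seq-degreeMatrix G i j t) (seq-adjacencyMatrix G i j t))
           (eq 𝟙[ does (i Fin.≟ j) ] d 𝟙[ adj G i j ] (y j))) ⟩
    Σℚ (λ j → 𝟙[ does (i Fin.≟ j) ] ℚ.* (d ℚ.* y j) ℚ.+ 𝟙[ adj G i j ] ℚ.* y j)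
      ≡⟨ trans (Σ-+ {n} _ _) (cong (ℚ._+ Σℚ (λ j → 𝟙[ adj G i j ] ℚ.* y j)) (Σ-pick i (λ j → d ℚ.* y j))) ⟩
    applyQ y i ∎
    where
    open ≡-Reasoning
    y : Fin n → ℚ
    y j = seq (x j) t
    d = ι (degreeIn G (allFin n) i)
    eq : ∀ δ d b y → (δ ℚ.* d ℚ.+ b) ℚ.* y ≡ δ ℚ.* (d ℚ.* y) ℚ.+ b ℚ.* y
    eq = Ring.solve-∀ ℚ-ring

  -- By AM-GM, the residual of an approximate eigenvector is paid for by the gap μ κ − ν.
  module _ {μ ν κ : ℚ} (0<μ : 0ℚ ℚ.< μ) (gap : ν ℚ.< μ ℚ.* κ)
    (form-bound : ∀ y → μ ℚ.* edgeForm G y ℚ.≤ 2ℚ ℚ.* ν ℚ.* norm² y) where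

    private
      β ε₂ : ℚ
      -- Half of the gap is kept. The other half, equal to μ ε₂, pays for q being only eventually at
      -- least κ - ε₂.
      β = ℚ.½ ℚ.* (μ ℚ.* κ ℚ.- ν)
      0<β : 0ℚ ℚ.< β
      0<β = 0<* (ℚ.positive⁻¹ ℚ.½) (subst (ℚ._< μ ℚ.* κ ℚ.- ν) (ℚ.+-inverseʳ ν) (ℚ.+-monoˡ-< (ℚ.- ν) gap))
      ε₂ = proj₁ (divide 0<μ β)
      β≡με₂ : β ≡ μ ℚ.* ε₂
      β≡με₂ = proj₂ (divide 0<μ β)
      2β : μ ℚ.* κ ≡ ν ℚ.+ 2ℚ ℚ.* β
      2β = eq (μ ℚ.* κ) ν
        where
        eq : ∀ x v → x ≡ v ℚ.+ 2ℚ ℚ.* (ℚ.½ ℚ.* (x ℚ.- v))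
        eq = Ring.solve-∀ ℚ-ring

    approximate-eigenvector : ∀ (y : Fin n → ℚ) (q ε₁ : ℚ) → κ ℚ.≤ q ℚ.+ ε₂ →
      (∀ i → ℚ.∣ applyQ y i ℚ.- q ℚ.* y i ∣ ℚ.≤ ε₁) → β ℚ.* β ℚ.* norm² y ℚ.≤ μ ℚ.* μ ℚ.* (ι n ℚ.* (ε₁ ℚ.* ε₁))
    approximate-eigenvector y q ε₁ κ≤ close = begin
      -- The form bound gives β Y + μ W ≤ 0; inserted into the expansion of Σ (β y + μ e)² ≥ 0, it
      -- leaves β² Y ≤ μ² E.
      β ℚ.* β ℚ.* Y              ≤⟨ linearℚ (ℚ.+-mono-≤ amgm (*-monoˡ (0≤* (0≤ι 2) (ℚ.<⇒≤ 0<β)) descent)) (eq₃ β μ Y W E) ⟩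
      μ ℚ.* μ ℚ.* E              ≤⟨ *-monoˡ (0≤* (ℚ.<⇒≤ 0<μ) (ℚ.<⇒≤ 0<μ)) E≤ ⟩
      μ ℚ.* μ ℚ.* (ι n ℚ.* (ε₁ ℚ.* ε₁)) ∎
      where
      open ℚ.≤-Reasoning
      e : Fin n → ℚ
      e i = applyQ y i ℚ.- q ℚ.* y i
      Y W E : ℚ
      Y = norm² y
      W = Σℚ (λ i → y i ℚ.* e i)
      E = norm² e
      E≤ : E ℚ.≤ ι n ℚ.* (ε₁ ℚ.* ε₁)
      E≤ = ℚ.≤-trans (Σ-mono λ i → square-mono-≤ (close i)) (ℚ.≤-reflexive (Σ-const {n} (ε₁ ℚ.* ε₁)))
      form≡ : edgeForm G y ≡ 2ℚ ℚ.* (q ℚ.* Y ℚ.+ W)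
      form≡ = trans (edgeForm≡ y) (cong (2ℚ ℚ.*_) (trans (Σ-cong λ i → eq₁ (y i) (applyQ y i) q)
        (trans (Σ-+ {n} _ _) (cong (ℚ._+ W) (Σ-*ˡ {n} q _)))))
        where
        eq₁ : ∀ y s q → y ℚ.* s ≡ q ℚ.* (y ℚ.* y) ℚ.+ y ℚ.* (s ℚ.- q ℚ.* y)
        eq₁ = Ring.solve-∀ ℚ-ring
      0≤Y : 0ℚ ℚ.≤ Y
      0≤Y = Σ-≥0 (λ i → 0≤square (y i))
      descent : β ℚ.* Y ℚ.+ μ ℚ.* W ℚ.≤ 0ℚ
      descent = *-cancelˡ (0<ι 1) (linearℚ
        (ℚ.+-mono-≤ (subst (λ f → μ ℚ.* f ℚ.≤ 2ℚ ℚ.* ν ℚ.* Y) form≡ (form-bound y))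
                    (*-monoˡ (0≤* (0≤ι 2) 0≤Y) (*-monoˡ (ℚ.<⇒≤ 0<μ) κ≤)))
        (eq₂ μ ν κ q ε₂ β Y W 2β β≡με₂))
        where
        eq₂′ : ∀ μ v q d b Y W m → m ≡ v ℚ.+ 2ℚ ℚ.* b → 2ℚ ℚ.* (b ℚ.* Y ℚ.+ μ ℚ.* W) ℚ.+
            (2ℚ ℚ.* v ℚ.* Y ℚ.+ 2ℚ ℚ.* Y ℚ.* (μ ℚ.* q ℚ.+ b))
          ≡ 2ℚ ℚ.* 0ℚ ℚ.+ (μ ℚ.* (2ℚ ℚ.* (q ℚ.* Y ℚ.+ W)) ℚ.+ 2ℚ ℚ.* Y ℚ.* m)
        eq₂′ μ v q d b Y W _ refl = go μ v q b Y W
          where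
          go : ∀ μ v q b Y W → 2ℚ ℚ.* (b ℚ.* Y ℚ.+ μ ℚ.* W) ℚ.+ (2ℚ ℚ.* v ℚ.* Y ℚ.+ 2ℚ ℚ.* Y ℚ.* (μ ℚ.* q ℚ.+ b))
            ≡ 2ℚ ℚ.* 0ℚ ℚ.+ (μ ℚ.* (2ℚ ℚ.* (q ℚ.* Y ℚ.+ W)) ℚ.+ 2ℚ ℚ.* Y ℚ.* (v ℚ.+ 2ℚ ℚ.* b))
          go = Ring.solve-∀ ℚ-ring
        eq₂ : ∀ μ v k q d b Y W → μ ℚ.* k ≡ v ℚ.+ 2ℚ ℚ.* b → b ≡ μ ℚ.* d →
          2ℚ ℚ.* (b ℚ.* Y ℚ.+ μ ℚ.* W) ℚ.+ (2ℚ ℚ.* v ℚ.* Y ℚ.+ 2ℚ ℚ.* Y ℚ.* (μ ℚ.* (q ℚ.+ d)))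
          ≡ 2ℚ ℚ.* 0ℚ ℚ.+ (μ ℚ.* (2ℚ ℚ.* (q ℚ.* Y ℚ.+ W)) ℚ.+ 2ℚ ℚ.* Y ℚ.* (μ ℚ.* k))
        eq₂ μ v k q d b Y W m≡ b≡ = trans
          (cong (λ z → 2ℚ ℚ.* (b ℚ.* Y ℚ.+ μ ℚ.* W) ℚ.+ (2ℚ ℚ.* v ℚ.* Y ℚ.+ 2ℚ ℚ.* Y ℚ.* z))
            (trans (ℚ.*-distribˡ-+ μ q d) (cong (μ ℚ.* q ℚ.+_) (sym b≡))))
          (eq₂′ μ v q d b Y W (μ ℚ.* k) m≡)
      amgm : 0ℚ ℚ.≤ β ℚ.* β ℚ.* Y ℚ.+ (2ℚ ℚ.* β ℚ.* (μ ℚ.* W) ℚ.+ μ ℚ.* μ ℚ.* E)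
      amgm = ℚ.≤-trans (Σ-≥0 λ i → 0≤square (β ℚ.* y i ℚ.+ μ ℚ.* e i)) (ℚ.≤-reflexive
        (trans (Σ-cong λ i → eq₁ β μ (y i) (e i)) (trans (Σ-+ {n} _ _) (cong₂ ℚ._+_ (Σ-*ˡ {n} (β ℚ.* β) _)
          (trans (Σ-+ {n} _ _) (cong₂ ℚ._+_ (trans (Σ-*ˡ {n} (2ℚ ℚ.* β ℚ.* μ) _) (ℚ.*-assoc (2ℚ ℚ.* β) μ W))
              (Σ-*ˡ {n} (μ ℚ.* μ) _)))))))
        where
        eq₁ : ∀ b m y e → (b ℚ.* y ℚ.+ m ℚ.* e) ℚ.* (b ℚ.* y ℚ.+ m ℚ.* e) ≡ b ℚ.* b ℚ.* (y ℚ.* y) ℚ.+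
            (2ℚ ℚ.* b ℚ.* m ℚ.* (y ℚ.* e) ℚ.+ m ℚ.* m ℚ.* (e ℚ.* e))
        eq₁ = Ring.solve-∀ ℚ-ring
      eq₃ : ∀ b m Y W E → b ℚ.* b ℚ.* Y ℚ.+
          (b ℚ.* b ℚ.* Y ℚ.+ (2ℚ ℚ.* b ℚ.* (m ℚ.* W) ℚ.+ m ℚ.* m ℚ.* E) ℚ.+ 2ℚ ℚ.* b ℚ.* 0ℚ)
        ≡ m ℚ.* m ℚ.* E ℚ.+ (0ℚ ℚ.+ 2ℚ ℚ.* b ℚ.* (b ℚ.* Y ℚ.+ m ℚ.* W))
      eq₃ = Ring.solve-∀ ℚ-ring

    -- At every late index the rational approximation of the eigenvector has a small residual, so
    -- all its entries are small. Hence every entry of the eigenvector is zero as a real number,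
    -- contrary to the definition of an eigenvalue.
    not-eigenvalue : ∀ q → fromℚ κ ≤ℝ q → ¬ IsEigenvalue (signlessLaplacian G) q
    not-eigenvalue q κ≤q (x , x≉0 , Qx≈qx) = x≉0 λ i ε 0<ε → small i ε 0<ε
      where
      0<ε₂ : 0ℚ ℚ.< ε₂
      0<ε₂ = factor-positive 0<μ (subst (0ℚ ℚ.<_) β≡με₂ 0<β)
      small : ∀ i → x i ≈ℝ 0ℝ
      small i ε 0<ε = M ⊔ N , λ t M⊔N≤t → bound t (ℕ.m⊔n≤o⇒m≤o M N M⊔N≤t) (ℕ.m⊔n≤o⇒n≤o M N M⊔N≤t)
        where
        0<c : 0ℚ ℚ.< ι (suc n) ℚ.* μ
        0<c = 0<* (0<ι n) 0<μ
        -- Chosen so that (n + 1) μ ε₁ = β ε. The bound μ² n ε₁² is then at most β² ε², because n ≤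
        -- (n + 1)², and n + 1 is positive for every n.
        ε₁ : ℚ
        ε₁ = proj₁ (divide 0<c (β ℚ.* ε))
        βε≡ : β ℚ.* ε ≡ ι (suc n) ℚ.* μ ℚ.* ε₁
        βε≡ = proj₂ (divide 0<c (β ℚ.* ε))
        0<ε₁ : 0ℚ ℚ.< ε₁
        0<ε₁ = factor-positive 0<c (subst (0ℚ ℚ.<_) βε≡ (0<* 0<β 0<ε))
        M N : ℕ
        M = proj₁ (κ≤q ε₂ 0<ε₂)
        close : ∃[ N ] ∀ t → N ≤ t → ∀ i → _
        close = eventually-all λ i → Qx≈qx i ε₁ 0<ε₁
        N = proj₁ close
        bound : ∀ t → M ≤ t → N ≤ t → ℚ.∣ seq (x i) t ℚ.- 0ℚ ∣ ℚ.≤ ε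
        bound t M≤t N≤t = subst (λ p → ℚ.∣ p ∣ ℚ.≤ ε) (sym (ℚ.+-identityʳ (y i)))
          (square-cancel-≤ (ℚ.<⇒≤ 0<ε) (*-cancelˡ (0<* 0<β 0<β) (begin
            β ℚ.* β ℚ.* (y i ℚ.* y i)
              ≤⟨ *-monoˡ (ℚ.<⇒≤ (0<* 0<β 0<β)) (Σ-term (λ i → 0≤square (y i)) i) ⟩
            β ℚ.* β ℚ.* norm² y
              ≤⟨ approximate-eigenvector y (seq q t) ε₁ (proj₂ (κ≤q ε₂ 0<ε₂) t M≤t)
                   (λ i → subst (λ s → ℚ.∣ s ℚ.- seq q t ℚ.* y i ∣ ℚ.≤ ε₁) (seq-signlessLaplacian x i t)
                       (proj₂ close t N≤t i)) ⟩
            μ ℚ.* μ ℚ.* (ι n ℚ.* (ε₁ ℚ.* ε₁))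
              ≤⟨ ≤-by _ (0≤* (0≤+ (0≤+ (0≤* (0≤ι n) (0≤ι n)) (0≤ι n)) (0≤ι 1)) (0≤square (μ ℚ.* ε₁))) (eq₁ (ι n) μ ε₁) ⟩
            ι (suc n) ℚ.* μ ℚ.* ε₁ ℚ.* (ι (suc n) ℚ.* μ ℚ.* ε₁)
              ≡⟨ cong (λ p → p ℚ.* p) βε≡ ⟨
            β ℚ.* ε ℚ.* (β ℚ.* ε)
              ≡⟨ eq₂ β ε ⟩
            β ℚ.* β ℚ.* (ε ℚ.* ε) ∎)))
          where
          open ℚ.≤-Reasoning
          y : Fin n → ℚ
          y j = seq (x j) t
          eq₁ : ∀ n m e → (1ℚ ℚ.+ n) ℚ.* m ℚ.* e ℚ.* ((1ℚ ℚ.+ n) ℚ.* m ℚ.* e) ≡ m ℚ.* m ℚ.* (n ℚ.* (e ℚ.* e)) ℚ.+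
              (n ℚ.* n ℚ.+ n ℚ.+ 1ℚ) ℚ.* (m ℚ.* e ℚ.* (m ℚ.* e))
          eq₁ = Ring.solve-∀ ℚ-ring
          eq₂ : ∀ b e → b ℚ.* e ℚ.* (b ℚ.* e) ≡ b ℚ.* b ℚ.* (e ℚ.* e)
          eq₂ = Ring.solve-∀ ℚ-ring

-- The number of edges forced by the spectral radius

sumMap-*ʳ : ∀ (f : V → ℕ) c xs → sumMap (λ x → f x * c) xs ≡ sumMap f xs * c
sumMap-*ʳ f c []       = refl
sumMap-*ʳ f c (x ∷ xs) = trans (cong ((f x * c) +_) (sumMap-*ʳ f c xs)) (sym (ℕ.*-distribʳ-+ c (f x) _))

sumMap-mono-at : ∀ {f g : V → ℕ} {e u} xs → (∀ x → f x ≤ g x) → u ∈ xs → f u + e ≤ g u → sumMap f xs + e ≤ sumMap g xs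
sumMap-mono-at {f = f} {g} {e} (u ∷ xs) f≤g (here refl) le = linear (ℕ.+-mono-≤ le (sumMap-mono xs λ {x} _ → f≤g x))
    (eq (f u) (sumMap f xs) e (g u) (sumMap g xs))
  where
  eq : ∀ a b e c d → a + b + e + (c + d) ≡ c + d + (a + e + b)
  eq = solve-∀
sumMap-mono-at {f = f} {g} {e} (x ∷ xs) f≤g (there u∈) le = ℕ.≤-trans (ℕ.≤-reflexive (ℕ.+-assoc (f x) _ e))
  (ℕ.+-mono-≤ (f≤g x) (sumMap-mono-at xs f≤g u∈ le))

module _ {p} (G : Graph (suc p)) (1≤D : ∀ i → 1 ≤ degreeIn G (allFin (suc p)) i) where

  private
    all : List (Fin (suc p))
    all = allFin (suc p)
    D S : Fin (suc p) → ℕ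
    D = degreeIn G all
    S u = sumMap (λ j → # adj G u j * D j) all
    M : ℕ
    M = sumMap D all

    D≤p : ∀ u → D u ≤ p
    D≤p u = linear (ℕ.+-monoʳ-≤ (D u) (count-positive (not ∘ adj G u) (∈.∈-allFin u)
        (subst (T ∘ not) (sym (adj-irrefl G u)) tt)))
      (trans (cong (D u +_) (trans (count-not (adj G u) all) (length-allFin (suc p)))) (eq (D u) p))
      where
      eq : ∀ d p → d + suc p ≡ p + (d + 1)
      eq = solve-∀

    S≤ : ∀ u → S u ≤ D u * p
    S≤ u = ℕ.≤-trans (sumMap-mono all λ {j} _ → ℕ.*-monoʳ-≤ (# adj G u j) (D≤p j))
        (ℕ.≤-reflexive (sumMap-*ʳ (λ j → # adj G u j) p all))

    -- `M` minus `S u` is the degree sum of the non-neighbours of `u`: `u` itself contributes `D u`,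
    -- and each of the other p - `D u` contributes at least 1.
    S+p≤M : ∀ u → S u + p ≤ M
    S+p≤M u = linear others (trans (eq (S u) p (sumMap (λ j → # not (adj G u j) * D j) all) (D u))
        (cong₂ _+_ (trans (sym (sumMap-+ (λ j → # adj G u j * D j) (λ j → # not (adj G u j) * D j) all))
            (sumMap-cong all λ {j} _ → complement (adj G u j) (D j))) refl))
      where
      complement : ∀ b d → # b * d + # not b * d ≡ d
      complement true  d = trans (ℕ.+-identityʳ _) (ℕ.*-identityˡ d)
      complement false d = ℕ.*-identityˡ d
      eq : ∀ s p x d → s + p + (x + d) ≡ s + x + (p + d)
      eq = solve-∀
      one : ∀ j → 1 ≤ # not (adj G u j) * D j + # adj G u j
      one j with adj G u j
      ... | true  = ℕ.≤-refl
      ... | false = ℕ.≤-trans (1≤D j) (ℕ.≤-reflexive (sym (trans (ℕ.+-identityʳ _) (ℕ.*-identityˡ (D j)))))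
      at-u : 1 + (D u ∸ 1) ≤ # not (adj G u u) * D u + # adj G u u
      at-u rewrite adj-irrefl G u = ℕ.≤-reflexive
          (trans (ℕ.m+[n∸m]≡n (1≤D u)) (sym (trans (ℕ.+-identityʳ _) (ℕ.*-identityˡ (D u)))))
      others : p + D u ≤ sumMap (λ j → # not (adj G u j) * D j) all + D u
      others = subst₂ _≤_
        (trans (cong (_+ (D u ∸ 1)) (trans (sumMap-const 1 all) (trans (ℕ.*-identityʳ _) (length-allFin (suc p)))))
          (trans (sym (ℕ.+-suc p (D u ∸ 1))) (cong (p +_) (ℕ.m+[n∸m]≡n (1≤D u)))))
        (sumMap-+ (λ j → # not (adj G u j) * D j) (λ j → # adj G u j) all)
        (sumMap-mono-at all one (∈.∈-allFin u) at-u)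

  -- The row sum d + S / d is convex in d once S ≤ min (d p, M ∸ p), and is largest for d = p.
  row-bound : ∀ u → p * (D u * D u + S u) + D u * p ≤ D u * (p * p + M)
  row-bound u = go (D u) (S u) (p ∸ D u) (sym (ℕ.m+[n∸m]≡n (D≤p u))) (S≤ u) (S+p≤M u)
    where
    go : ∀ d S r → p ≡ d + r → S ≤ d * p → S + p ≤ M → p * (d * d + S) + d * p ≤ d * (p * p + M)
    -- The two bounds on S, d p and M - p, change places at p (d + 1) = M.
    go d S r p≡ S≤dp S+p≤M with ℕ.≤-total (p * suc d) M
    ... | inj₁ pd≤M = linear (ℕ.+-mono-≤ (ℕ.*-monoʳ-≤ p S≤dp) (ℕ.*-monoʳ-≤ d pd≤M)) (eq p d S M)
      where
      eq : ∀ p d S M → p * (d * d + S) + d * p + (p * (d * p) + d * M) ≡ d * (p * p + M) + (p * S + d * (p * suc d))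
      eq = solve-∀
    ... | inj₂ M≤pd = linear (ℕ.+-mono-≤ (ℕ.*-monoʳ-≤ p S+p≤M) (ℕ.*-monoʳ-≤ r M≤pd))
        (trans (cong (λ q → q * (d * d + S) + d * q + (q * M + r * (q * suc d))) p≡)
        (trans (eq d r S M) (sym (cong (λ q → d * (q * q + M) + (q * (S + q) + r * M)) p≡))))
      where
      eq : ∀ d r S M → (d + r) * (d * d + S) + d * (d + r) + ((d + r) * M + r * ((d + r) * suc d))
        ≡ d * ((d + r) * (d + r) + M) + ((d + r) * (S + (d + r)) + r * M)
      eq = solve-∀

ι-gap : ∀ {t e m} → t < e + m → ι t ℚ.- ι e ℚ.< ι m
ι-gap {t} {e} {m} t<e+m = subst₂ ℚ._<_ refl (eq (ι e) (ι m))
    (ℚ.+-monoˡ-< (ℚ.- ι e) (subst (ι t ℚ.<_) (ι-+ e m) (ι-mono-< t<e+m)))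
  where
  eq : ∀ e m → e ℚ.+ m ℚ.+ ℚ.- e ≡ m
  eq = Ring.solve-∀ ℚ-ring

-- q (G) ≤ 2 m / (n − 1) + n − 2, read as a lower bound on the number m of edges.
edge-bound : ∀ {r s} (G : Graph (suc (suc r + s))) → (∀ i → 1 ≤ degreeIn G (allFin (suc (suc r + s))) i) →
  ∀ q → fromℚ (ι (2 * suc r)) ≤ℝ q → IsEigenvalue (signlessLaplacian G) q →
  (suc r + s) * suc (suc r + s) ≤ sumMap (degreeIn G (allFin (suc (suc r + s)))) (allFin (suc (suc r + s))) + 2 * s *
      (suc r + s)
edge-bound {r} {s} G 1≤D q κ≤q eig = ℕ.≮⇒≥ λ few → not-eigenvalue G (0<ι (r + s))
    (subst (ι (p * p + M) ℚ.- ι p ℚ.<_) (ι-* p (2 * suc r))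
        (ι-gap {p * p + M} {p} {p * (2 * suc r)} (linear few (eq (suc r) s M))))
    (edgeForm-degree-bound G p (p * p + M) p 1≤D (row-bound G 1≤D)) q κ≤q eig
  where
  p M : ℕ
  p = suc r + s
  M = sumMap (degreeIn G (allFin (suc p))) (allFin (suc p))
  eq : ∀ r s M → suc ((r + s) * (r + s) + M) + (r + s) * suc (r + s) ≡ r + s + (r + s) * (2 * r) + suc (M + 2 * s * (r + s))
  eq = solve-∀

-- Pair counts for the parts X, Y and Z

block : ∀ {n} → List (Fin n) → List (Fin n) → (Fin n → Fin n → Bool) → ℕ
block xs ys b = sumMap (λ i → count (b i) ys) xs

block-none : ∀ {n} xs ys (b : Fin n → Fin n → Bool) → (∀ {i j} → i ∈ xs → j ∈ ys → ¬ T (b i j)) → block xs ys b ≡ 0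
block-none xs ys b none = trans (sumMap-cong xs λ {i} i∈ → count-none (b i) ys (none i∈))
  (trans (sumMap-const 0 xs) (ℕ.*-zeroʳ (length xs)))

block-all : ∀ {n} xs ys (b : Fin n → Fin n → Bool) → (∀ {i j} → i ∈ xs → j ∈ ys → T (b i j)) → block xs ys b
    ≡ length xs * length ys
block-all xs ys b all = trans (sumMap-cong xs λ {i} i∈ → count-all (b i) ys (all i∈)) (sumMap-const (length ys) xs)

block-≤ : ∀ {n} xs ys (b : Fin n → Fin n → Bool) → block xs ys b ≤ length xs * length ys
block-≤ xs ys b = ℕ.≤-trans (sumMap-mono xs λ {i} _ → count≤length (b i) ys) (ℕ.≤-reflexive (sumMap-const (length ys) xs))

block-mono : ∀ {n} xs ys {b c : Fin n → Fin n → Bool} → (∀ {i j} → i ∈ xs → j ∈ ys → T (b i j) → T (c i j))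
    → block xs ys b ≤ block xs ys c
block-mono xs ys b⇒c = sumMap-mono xs λ i∈ → count-mono ys (b⇒c i∈)

block-++ʳ : ∀ {n} xs ys zs (b : Fin n → Fin n → Bool) → block xs (ys ++ zs) b ≡ block xs ys b + block xs zs b
block-++ʳ xs ys zs b = trans (sumMap-cong xs λ {i} _ → count-++ (b i) ys zs)
  (sumMap-+ (λ i → count (b i) ys) (λ i → count (b i) zs) xs)

block-transpose : ∀ {n} xs ys {b : Fin n → Fin n → Bool} → (∀ i j → b i j ≡ b j i) → block xs ys b ≡ block ys xs b
block-transpose xs ys b-sym = trans (sumMap-swap _ xs ys)
  (sumMap-cong ys λ {j} _ → sumMap-cong xs λ {i} _ → cong #_ (b-sym i j))

pairs-++ : ∀ {n} xs ys (b : Fin n → Fin n → Bool) → xs ++ ys ↭ allFin n →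
  pairs b ≡ block xs xs b + block xs ys b + (block ys xs b + block ys ys b)
pairs-++ {n} xs ys b π = trans (sym (sumMap-↭ _ π)) (trans (sumMap-++ _ xs ys) (cong₂ _+_ (row xs) (row ys)))
  where
  row : ∀ zs → block zs (allFin n) b ≡ block zs xs b + block zs ys b
  row zs = trans (sumMap-cong zs λ {i} _ → sym (sumMap-↭ _ π)) (block-++ʳ zs xs ys b)

T-∧ : ∀ {b c} → T (b ∧ c) → T b × T c
T-∧ = Equivalence.to Bool.T-∧

module PartCounts {n k s} (G : Graph n) (𝒮 : Structure k s G) where

  open Structure 𝒮
  open DecMembership (Fin._≟_ {n}) using (_∈?_)

  W : List (Fin n)
  W = Y ++ Z

  W++X : W ++ X ↭ allFin n
  W++X = ↭-trans (↭-reflexive (List.++-assoc Y Z X)) cover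

  χ : Fin n → Bool
  χ i = not (does (i ∈? X))

  unique : Unique (W ++ X)
  unique = Unique-resp-↭ (↭-sym W++X) (Unique.allFin⁺ n)

  χ-X : ∀ {i} → i ∈ X → ¬ T (χ i)
  χ-X {i} i∈X χi = subst (T ∘ not) (dec-true (i ∈? X) i∈X) χi

  χ-W : ∀ {i} → i ∈ W → T (χ i)
  χ-W {i} i∈W = subst (T ∘ not) (sym (dec-false (i ∈? X) λ i∈X → AllPairs-++⁻ W unique i∈W i∈X refl)) tt

  |χ| : count χ (allFin n) ≡ length Y + length Z
  |χ| = trans (sym (sumMap-↭ _ W++X)) (trans (sumMap-++ _ W X)
    (trans (cong₂ _+_ (count-all χ W χ-W) (count-none χ X χ-X)) (trans (ℕ.+-identityʳ _) (List.length-++ Y))))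

  n≡ : n ≡ length Y + length Z + s
  n≡ = trans (sym (length-allFin n)) (trans (sym (↭.↭-length W++X))
      (trans (List.length-++ W) (cong₂ _+_ (List.length-++ Y) |X|)))

  adjacent apart : Fin n → Fin n → Bool
  adjacent = adj G
  apart i j = not (adj G i j)

  apart-sym : ∀ i j → apart i j ≡ apart j i
  apart-sym i j = cong not (adj-sym G i j)

  edges-XW : block X W adjacent ≡ s * length Y
  edges-XW = trans (block-++ʳ X Y Z adjacent) (trans (cong₂ _+_ (block-all X Y adjacent XY) (block-none X Z adjacent XZ))
    (trans (ℕ.+-identityʳ _) (cong (_* length Y) |X|)))

  xor-same : ∀ {b c} → T b → T c → ¬ T (b Bool.xor c)
  xor-same {true} {true} _ _ ()

  xor-same′ : ∀ {b c} → ¬ T b → ¬ T c → ¬ T (b Bool.xor c)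
  xor-same′ {true}          ¬b _  _ = ¬b tt
  xor-same′ {false} {true}  _  ¬c _ = ¬c tt
  xor-same′ {false} {false} _  _  ()

  across≤ : pairs (presentAcross G χ) ≤ 2 * (s * length Y)
  across≤ = begin
    pairs (presentAcross G χ)
      ≡⟨ pairs-++ W X (presentAcross G χ) W++X ⟩
    block W W (presentAcross G χ) + block W X (presentAcross G χ) +
        (block X W (presentAcross G χ) + block X X (presentAcross G χ))
      ≤⟨ ℕ.+-mono-≤ (ℕ.+-mono-≤
           (ℕ.≤-reflexive (block-none W W (presentAcross G χ) λ {i} {j} i∈ j∈ p → xor-same (χ-W i∈) (χ-W j∈)
               (proj₂ (T-∧ {adj G i j} p))))
           (block-mono W X λ {i} {j} _ _ p → proj₁ (T-∧ {adj G i j} p)))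
         (ℕ.+-mono-≤ (block-mono X W λ {i} {j} _ _ p → proj₁ (T-∧ {adj G i j} p))
           (ℕ.≤-reflexive (block-none X X (presentAcross G χ) λ {i} {j} i∈ j∈ p → xor-same′ (χ-X i∈) (χ-X j∈)
               (proj₂ (T-∧ {adj G i j} p))))) ⟩
    0 + block W X adjacent + (block X W adjacent + 0)
      ≡⟨ cong₂ _+_ (trans (block-transpose W X (adj-sym G)) edges-XW) (cong (_+ 0) edges-XW) ⟩
    2 * (s * length Y) ∎
    where open ℕ.≤-Reasoning

  outside≤ : pairs (presentOutside G χ) ≤ s * s
  outside≤ = begin
    pairs (presentOutside G χ)
      ≡⟨ pairs-++ W X (presentOutside G χ) W++X ⟩
    block W W (presentOutside G χ) + block W X (presentOutside G χ) +
        (block X W (presentOutside G χ) + block X X (presentOutside G χ))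
      ≤⟨ ℕ.+-mono-≤ (ℕ.≤-reflexive (cong₂ _+_
          (block-none W W (presentOutside G χ) (λ {i} {j} i∈ _ → ¬first {i} {j} i∈))
          (block-none W X (presentOutside G χ) (λ {i} {j} i∈ _ → ¬first {i} {j} i∈))))
         (ℕ.+-mono-≤ (ℕ.≤-reflexive (block-none X W (presentOutside G χ) λ {i} {j} _ j∈ → ¬second {i} {j} j∈))
             (block-≤ X X (presentOutside G χ))) ⟩
    length X * length X
      ≡⟨ cong₂ _*_ |X| |X| ⟩
    s * s ∎
    where
    open ℕ.≤-Reasoning
    ¬first : ∀ {i j} → i ∈ W → ¬ T (presentOutside G χ i j)
    ¬first {i} {j} i∈ p = T-not⁻ (proj₁ (T-∧ {not (χ i)} (proj₂ (T-∧ {adj G i j} p)))) (χ-W i∈)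
    ¬second : ∀ {i j} → j ∈ W → ¬ T (presentOutside G χ i j)
    ¬second {i} {j} j∈ p = T-not⁻ (proj₂ (T-∧ {not (χ i)} (proj₂ (T-∧ {adj G i j} p)))) (χ-W j∈)

  absent⇒apart : ∀ {i j} → T (absentWithin G χ i j) → T (apart i j)
  absent⇒apart {i} {j} p = proj₂ (T-∧ {not (does (i Fin.≟ j))} (proj₂ (T-∧ {χ i ∧ χ j} p)))

  -- Three disjoint families of non-adjacent ordered pairs: those absent within Y ∪ Z, the diagonal,
  -- and the pairs between X and Z in both orders.
  absent≤ : pairs (absentWithin G χ) + n + 2 * (s * length Z) ≤ pairs apart
  absent≤ = begin
    pairs (absentWithin G χ) + n + 2 * (s * length Z)
      ≡⟨ cong₂ (λ u v → u + v + 2 * (s * length Z)) (trans (pairs-++ W X (absentWithin G χ) W++X)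
           (cong₂ _+_ (cong (block W W (absentWithin G χ) +_)
               (block-none W X (absentWithin G χ) λ {i} {j} _ j∈ → ¬second {i} {j} j∈))
             (cong₂ _+_ (block-none X W (absentWithin G χ) λ {i} {j} i∈ _ → ¬first {i} {j} i∈)
                 (block-none X X (absentWithin G χ) λ {i} {j} i∈ _ → ¬first {i} {j} i∈))))
           (trans n≡ (cong (_+ s) (sym (List.length-++ Y)))) ⟩
    block W W (absentWithin G χ) + 0 + 0 + (length W + s) + 2 * (s * length Z)
      ≡⟨ eq (block W W (absentWithin G χ)) (length W) s (s * length Z) ⟩
    block W W (absentWithin G χ) + length W + s * length Z + (s * length Z + s)
      ≤⟨ ℕ.+-mono-≤ (ℕ.+-mono-≤ WW (ℕ.≤-trans XW (ℕ.≤-reflexive (block-transpose X W apart-sym)))) (ℕ.+-mono-≤ XW XX-apart) ⟩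
    block W W apart + block W X apart + (block X W apart + block X X apart)
      ≡⟨ pairs-++ W X apart W++X ⟨
    pairs apart ∎
    where
    open ℕ.≤-Reasoning
    eq : ∀ b w s z → b + 0 + 0 + (w + s) + 2 * z ≡ b + w + z + (z + s)
    eq = solve-∀
    ¬first : ∀ {i j} → i ∈ X → ¬ T (absentWithin G χ i j)
    ¬first {i} {j} i∈ p = χ-X i∈ (proj₁ (T-∧ {χ i} (proj₁ (T-∧ {χ i ∧ χ j} p))))
    ¬second : ∀ {i j} → j ∈ X → ¬ T (absentWithin G χ i j)
    ¬second {i} {j} j∈ p = χ-X j∈ (proj₂ (T-∧ {χ i} (proj₁ (T-∧ {χ i ∧ χ j} p))))
    apart-self : ∀ i → T (apart i i)
    apart-self i = subst (T ∘ not) (sym (adj-irrefl G i)) tt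
    absent-self : ∀ i → ¬ T (absentWithin G χ i i)
    absent-self i p = subst (T ∘ not) (dec-true (i Fin.≟ i) refl)
        (proj₁ (T-∧ {not (does (i Fin.≟ i))} (proj₂ (T-∧ {χ i ∧ χ i} p))))
    WW : block W W (absentWithin G χ) + length W ≤ block W W apart
    WW = ℕ.≤-trans (ℕ.≤-reflexive (trans
        (cong (block W W (absentWithin G χ) +_) (sym (trans (sumMap-const 1 W) (ℕ.*-identityʳ _))))
           (sym (sumMap-+ (λ i → count (absentWithin G χ i) W) (λ _ → 1) W))))
      (sumMap-mono W λ {i} i∈ → sumMap-mono-at W (λ j → #-mono (absent⇒apart {i} {j})) i∈
        (ℕ.≤-reflexive (trans (cong (_+ 1) (#-¬T (absent-self i))) (sym (#-T (apart-self i))))))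
    XX-apart : s ≤ block X X apart
    XX-apart = ℕ.≤-trans (ℕ.≤-reflexive (trans (sym |X|) (sym (trans (sumMap-const 1 X) (ℕ.*-identityʳ _)))))
      (sumMap-mono X λ {i} i∈ → count-positive (apart i) i∈ (apart-self i))
    XW : s * length Z ≤ block X W apart
    XW = ℕ.≤-trans (ℕ.≤-reflexive (trans (cong (_* length Z) (sym |X|))
        (sym (block-all X Z apart λ x∈ z∈ → T-not⁺ (XZ x∈ z∈)))))
      (ℕ.≤-trans (ℕ.m≤n+m _ (block X Y apart)) (ℕ.≤-reflexive (sym (block-++ʳ X Y Z apart))))

  pairs-apart : sumMap (degreeIn G (allFin n)) (allFin n) + pairs apart ≡ n * n
  pairs-apart = trans (sym (sumMap-+ (degreeIn G (allFin n)) (λ i → count (apart i) (allFin n)) (allFin n)))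
      (trans (sumMap-cong (allFin n) λ {u} _ → trans (count-not (adj G u) (allFin n)) (length-allFin n))
      (trans (sumMap-const n (allFin n)) (cong (_* n) (length-allFin n))))

  -- Density allows n + 2 s n non-adjacent ordered pairs. The diagonal takes n of them and the pairs
  -- between X and Z take 2 s |Z|, where |Z| = n - |Y| - s, so n cancels from what remains.
  absent-bounded : n * n ≤ sumMap (degreeIn G (allFin n)) (allFin n) + (n + 2 * s * n) →
    pairs (absentWithin G χ) ≤ 2 * (s * (s + length Y))
  absent-bounded dense = linear (ℕ.+-mono-≤ absent≤ dense)
    (go (pairs (absentWithin G χ)) (pairs apart) (sumMap (degreeIn G (allFin n)) (allFin n)) n (length Y)
        (length Z) n≡ (sym pairs-apart))
    where
    go : ∀ B P D n y z → n ≡ y + z + s → n * n ≡ D + P →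
      B + (P + (D + (n + 2 * s * n))) ≡ 2 * (s * (s + y)) + (B + n + 2 * (s * z) + n * n)
    go B P D n y z refl nn = trans (eq s B P D y z)
        (cong (λ m → 2 * (s * (s + y)) + (B + (y + z + s) + 2 * (s * z) + m)) (sym nn))
      where
      eq : ∀ s B P D y z → B + (P + (D + (y + z + s + 2 * s * (y + z + s)))) ≡ 2 * (s * (s + y)) +
          (B + (y + z + s) + 2 * (s * z) + (D + P))
      eq = solve-∀

-- Recognising the exceptional graphs

length-filter≡count : ∀ {P : V → Set} (P? : ∀ x → Dec (P x)) xs → length (List.filter P? xs) ≡ count (λ x → does (P? x)) xs
length-filter≡count P? []       = refl
length-filter≡count P? (x ∷ xs) with does (P? x)
... | true  = cong suc (length-filter≡count P? xs)
... | false = length-filter≡count P? xs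

sumMap-map : ∀ {V W : Set} (f : W → ℕ) (g : V → W) xs → sumMap f (map g xs) ≡ sumMap (f ∘ g) xs
sumMap-map f g []       = refl
sumMap-map f g (x ∷ xs) = cong (f (g x) +_) (sumMap-map f g xs)

sumMap-cartesianProduct : ∀ {V W : Set} (f : V × W → ℕ) xs ys →
  sumMap f (cartesianProduct xs ys) ≡ sumMap (λ x → sumMap (λ y → f (x , y)) ys) xs
sumMap-cartesianProduct f []       ys = refl
sumMap-cartesianProduct f (x ∷ xs) ys = trans (sumMap-++ f (map (x ,_) ys) (cartesianProduct xs ys))
  (cong₂ _+_ (sumMap-map f (x ,_) ys) (sumMap-cartesianProduct f xs ys))

exclusive : ∀ {A B : Set} {c} (a? : Dec A) (b? : Dec B) → (A → ¬ B) → (A → T c) → (B → T c) →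
  # does a? + # does b? ≤ # c
exclusive (yes a) (yes b) ¬ab _   _   = contradiction b (¬ab a)
exclusive (yes a) (no _)  _   a⇒c _   = ℕ.≤-reflexive (sym (#-T (a⇒c a)))
exclusive (no _)  (yes b) _   _   b⇒c = ℕ.≤-reflexive (sym (#-T (b⇒c b)))
exclusive (no _)  (no _)  _   _   _   = z≤n

-- `edges` lists each edge with its smaller end first; the listed pair and its reversal are two
-- different ordered pairs.
2*edgeCount≤pairs : ∀ (E : Graph n) → 2 * edgeCount E ≤ pairs (adj E)
2*edgeCount≤pairs {n} E = begin
  2 * edgeCount E               ≡⟨ cong (2 *_)
      (trans (length-filter≡count edge? (cartesianProduct all all)) (sumMap-cartesianProduct _ all all)) ⟩
  2 * pairs forward             ≡⟨ cong (pairs forward +_) (trans (ℕ.+-identityʳ _) (sumMap-swap _ all all)) ⟩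
  pairs forward + pairs backward ≡⟨ sumMap-+ (λ u → count (forward u) all) (λ u → count (backward u) all) all ⟨
  sumMap (λ u → count (forward u) all + count (backward u) all) all
    ≡⟨ sumMap-cong all (λ {u} _ → sumMap-+ (λ v → # forward u v) (λ v → # backward u v) all) ⟨
  sumMap (λ u → sumMap (λ v → # forward u v + # backward u v) all) all
    ≤⟨ sumMap-mono all (λ {u} _ → sumMap-mono all λ {v} _ → one-direction u v) ⟩
  pairs (adj E) ∎
  where
  open ℕ.≤-Reasoning
  all = allFin n
  edge? : ∀ (uv : Fin n × Fin n) → Dec (proj₁ uv Fin.< proj₂ uv × Adj E (proj₁ uv) (proj₂ uv))
  edge? (u , v) = (u Fin.<? v) ×-dec T? (adj E u v)
  forward backward : Fin n → Fin n → Bool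
  forward  u v = does (edge? (u , v))
  backward u v = does (edge? (v , u))
  one-direction : ∀ u v → # forward u v + # backward u v ≤ # adj E u v
  one-direction u v = exclusive (edge? (u , v)) (edge? (v , u))
    (λ (u<v , _) (v<u , _) → ℕ.<-asym u<v v<u) proj₂ (Adj-sym E ∘ proj₂)

tabulate-↑ : ∀ m {l} (f : Fin (m + l) → V) →
  List.tabulate f ≡ List.tabulate (f ∘ (Fin._↑ˡ l)) ++ List.tabulate (f ∘ (m Fin.↑ʳ_))
tabulate-↑ zero    f = refl
tabulate-↑ (suc m) f = cong (f Fin.zero ∷_) (tabulate-↑ m (f ∘ Fin.suc))

tabulate-injective : ∀ {m} (f : Fin m → V) → Unique (List.tabulate f) → ∀ i j → f i ≡ f j → i ≡ j
tabulate-injective f _             Fin.zero    Fin.zero    _  = refl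
tabulate-injective f (f₀≢ ∷ _)     Fin.zero    (Fin.suc j) eq = contradiction eq (All.tabulate⁻ f₀≢ j)
tabulate-injective f (f₀≢ ∷ _)     (Fin.suc i) Fin.zero    eq = contradiction (sym eq) (All.tabulate⁻ f₀≢ i)
tabulate-injective f (_ ∷ uniq)    (Fin.suc i) (Fin.suc j) eq = cong Fin.suc (tabulate-injective (f ∘ Fin.suc) uniq i j eq)

module _ (c : Bool) {m n} (G : Graph m) (H : Graph n) where

  combine-ˡˡ : ∀ i j → adj (combine c G H) (i Fin.↑ˡ n) (j Fin.↑ˡ n) ≡ adj G i j
  combine-ˡˡ i j rewrite Fin.splitAt-↑ˡ m i n | Fin.splitAt-↑ˡ m j n = refl

  combine-ˡʳ : ∀ i j → adj (combine c G H) (i Fin.↑ˡ n) (m Fin.↑ʳ j) ≡ c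
  combine-ˡʳ i j rewrite Fin.splitAt-↑ˡ m i n | Fin.splitAt-↑ʳ m n j = refl

  combine-ʳˡ : ∀ i j → adj (combine c G H) (m Fin.↑ʳ i) (j Fin.↑ˡ n) ≡ c
  combine-ʳˡ i j rewrite Fin.splitAt-↑ʳ m n i | Fin.splitAt-↑ˡ m j n = refl

  combine-ʳʳ : ∀ i j → adj (combine c G H) (m Fin.↑ʳ i) (m Fin.↑ʳ j) ≡ adj H i j
  combine-ʳʳ i j rewrite Fin.splitAt-↑ʳ m n i | Fin.splitAt-↑ʳ m n j = refl

≢⇒Adj-K : ∀ {m} {i j : Fin m} → i ≢ j → Adj (K m) i j
≢⇒Adj-K {i = i} {j} i≢j = subst (T ∘ not) (sym (dec-false (i Fin.≟ j) i≢j)) tt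

-- `R` stands for the edgeless or for the complete graph on X, so both families are treated
-- together. The vertices of the model are numbered in the order Y, Z, X, as the joins and unions in
-- the definitions demand.
module Recognition {n k s} (G : Graph n) (𝒮 : Structure k s G)
  (R : Graph (length (Structure.X 𝒮)))
  (R≡ : ∀ i j → adj R i j ≡ adj G (List.lookup (Structure.X 𝒮) i) (List.lookup (Structure.X 𝒮) j)) where

  open Structure 𝒮
  open PartCounts G 𝒮 using (χ; χ-W; χ-X)

  a b c : ℕ
  a = length Y
  b = length Z
  c = length X

  M : Graph (a + (b + c))
  M = K a ∨ (K b ∪ R)

  f : Fin (a + (b + c)) → Fin n
  f u = [ List.lookup Y , (λ w → [ List.lookup Z , List.lookup X ]′ (Fin.splitAt b w)) ]′ (Fin.splitAt a u)

  embedY : Fin a → Fin (a + (b + c))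
  embedY i = i Fin.↑ˡ (b + c)
  embedZ : Fin b → Fin (a + (b + c))
  embedZ j = a Fin.↑ʳ (j Fin.↑ˡ c)
  embedX : Fin c → Fin (a + (b + c))
  embedX l = a Fin.↑ʳ (b Fin.↑ʳ l)

  f-Y : ∀ i → f (embedY i) ≡ List.lookup Y i
  f-Y i rewrite Fin.splitAt-↑ˡ a i (b + c) = refl

  f-Z : ∀ j → f (embedZ j) ≡ List.lookup Z j
  f-Z j rewrite Fin.splitAt-↑ʳ a (b + c) (j Fin.↑ˡ c) | Fin.splitAt-↑ˡ b j c = refl

  f-X : ∀ l → f (embedX l) ≡ List.lookup X l
  f-X l rewrite Fin.splitAt-↑ʳ a (b + c) (b Fin.↑ʳ l) | Fin.splitAt-↑ʳ b c l = refl

  tabulate-f : List.tabulate f ≡ Y ++ Z ++ X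
  tabulate-f = trans (tabulate-↑ a f) (cong₂ _++_ (trans (List.tabulate-cong f-Y) (List.tabulate-lookup Y))
    (trans (tabulate-↑ b (f ∘ (a Fin.↑ʳ_))) (cong₂ _++_ (trans (List.tabulate-cong f-Z) (List.tabulate-lookup Z))
      (trans (List.tabulate-cong f-X) (List.tabulate-lookup X)))))

  f-permutes : List.tabulate f ↭ allFin n
  f-permutes = ↭-trans (↭-reflexive tabulate-f) cover

  f-injective : ∀ u v → f u ≡ f v → u ≡ v
  f-injective = tabulate-injective f (Unique-resp-↭ (↭-sym f-permutes) (Unique.allFin⁺ n))

  f-surjective : ∀ v → ∃[ u ] v ≡ f u
  f-surjective v = ∈.∈-tabulate⁻ (↭.∈-resp-↭ (↭-sym f-permutes) (∈.∈-allFin v))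

  f⁻¹ : Fin n → Fin (a + (b + c))
  f⁻¹ v = proj₁ (f-surjective v)

  f-f⁻¹ : ∀ v → f (f⁻¹ v) ≡ v
  f-f⁻¹ v = sym (proj₂ (f-surjective v))

  σ : Permutation n (a + (b + c))
  σ = permutation f⁻¹ f (λ u → f-injective _ u (f-f⁻¹ (f u))) f-f⁻¹

  data Part : Fin (a + (b + c)) → Set where
    isY : ∀ i → Part (embedY i)
    isZ : ∀ j → Part (embedZ j)
    isX : ∀ l → Part (embedX l)

  part : ∀ u → Part u
  part u with Fin.splitAt a u in eq
  ... | inj₁ i = subst Part (Fin.splitAt⁻¹-↑ˡ eq) (isY i)
  ... | inj₂ w with Fin.splitAt b w in eq′
  ...   | inj₁ j = subst Part (trans (cong (a Fin.↑ʳ_) (Fin.splitAt⁻¹-↑ˡ eq′)) (Fin.splitAt⁻¹-↑ʳ eq)) (isZ j)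
  ...   | inj₂ l = subst Part (trans (cong (a Fin.↑ʳ_) (Fin.splitAt⁻¹-↑ʳ eq′)) (Fin.splitAt⁻¹-↑ʳ eq)) (isX l)

  lookup∈ : ∀ (xs : List (Fin n)) i → List.lookup xs i ∈ xs
  lookup∈ xs i = ∈.∈-lookup i

  f-X∈ : ∀ l → f (embedX l) ∈ X
  f-X∈ l = subst (_∈ X) (sym (f-X l)) (lookup∈ X l)

  f-Y∈ : ∀ i → f (embedY i) ∈ Y
  f-Y∈ i = subst (_∈ Y) (sym (f-Y i)) (lookup∈ Y i)

  f-Z∈ : ∀ j → f (embedZ j) ∈ Z
  f-Z∈ j = subst (_∈ Z) (sym (f-Z j)) (lookup∈ Z j)

  pulled : ∀ {u v} → Adj G (f u) (f v) → u ≢ v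
  pulled {u} uv refl = Adj⇒≢ G uv refl

  exact : ∀ l {v} → Part v → adj M (embedX l) v ≡ adj G (f (embedX l)) (f v)
  exact l (isY i) = trans (combine-ʳˡ true (K a) _ (b Fin.↑ʳ l) i) (sym (Equivalence.to Bool.T-≡ (XY (f-X∈ l) (f-Y∈ i))))
  exact l (isZ j) = trans (combine-ʳʳ true (K a) _ (b Fin.↑ʳ l) (j Fin.↑ˡ c)) (trans (combine-ʳˡ false (K b) R l j)
    (sym (¬T⇒≡false (XZ (f-X∈ l) (f-Z∈ j)))))
    where
    ¬T⇒≡false : ∀ {x} → ¬ T x → x ≡ false
    ¬T⇒≡false {true}  ¬x = ⊥-elim (¬x tt)
    ¬T⇒≡false {false} _  = refl
  exact l (isX m) = trans (combine-ʳʳ true (K a) _ (b Fin.↑ʳ l) (b Fin.↑ʳ m)) (trans (combine-ʳʳ false (K b) R l m)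
    (trans (R≡ l m) (sym (cong₂ (adj G) (f-X l) (f-X m)))))

  contained : ∀ {u v} → Part u → Part v → Adj G (f u) (f v) → Adj M u v
  contained (isY i) (isY j) uv = subst T (sym (combine-ˡˡ true (K a) _ i j))
      (≢⇒Adj-K {i = i} {j} λ { refl → pulled uv refl })
  contained (isY i) (isZ j) uv = subst T (sym (combine-ˡʳ true (K a) _ i (j Fin.↑ˡ c))) tt
  contained (isZ i) (isY j) uv = subst T (sym (combine-ʳˡ true (K a) _ (i Fin.↑ˡ c) j)) tt
  contained (isZ i) (isZ j) uv = subst T
      (sym (trans (combine-ʳʳ true (K a) _ (i Fin.↑ˡ c) (j Fin.↑ˡ c)) (combine-ˡˡ false (K b) R i j)))
    (≢⇒Adj-K {i = i} {j} λ { refl → pulled uv refl })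
  contained (isX l) p       uv = subst T (sym (exact l p)) uv
  contained p       (isX l) uv = Adj-sym M (subst T (sym (exact l p)) (Adj-sym G uv))

  -- The edge set to delete: the edges of the model that `G` lacks. `exact` shows that none of them
  -- touches X, and `contained` that deleting them leaves exactly `G`.
  missing : Graph (a + (b + c))
  missing = record
    { adj        = λ u v → adj M u v ∧ not (adj G (f u) (f v))
    ; adj-sym    = λ u v → cong₂ (λ p q → p ∧ not q) (adj-sym M u v) (adj-sym G (f u) (f v))
    ; adj-irrefl = λ u → cong (_∧ not (adj G (f u) (f u))) (adj-irrefl M u)
    }

  missing-E₁ : ∀ {u v} → Adj missing u v → Part u → Y∪Z a b c u
  missing-E₁ uv (isY i) = inY i
  missing-E₁ uv (isZ j) = inZ j
  missing-E₁ {v = v} uv (isX l) = let h , ¬g = T-∧ {adj M (embedX l) v} uv in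
    contradiction (subst T (exact l (part v)) h) (T-not⁻ ¬g)

  missing-W : ∀ {u} → Y∪Z a b c u → T (χ (f u))
  missing-W (inY i) = χ-W (∈.∈-++⁺ˡ (f-Y∈ i))
  missing-W (inZ j) = χ-W (∈.∈-++⁺ʳ Y (f-Z∈ j))

  in-E₁ : ∀ u v → Adj missing u v → E₁ a b c M u v
  in-E₁ u v uv = proj₁ (T-∧ {adj M u v} uv) , missing-E₁ uv (part u) , missing-E₁ (Adj-sym missing {u} {v} uv) (part v)

  isomorphic : G ≅ (M ∖ missing)
  isomorphic = σ , λ u v → sym (trans (restore (contained (part (f⁻¹ u)) (part (f⁻¹ v))))
      (cong₂ (adj G) (f-f⁻¹ u) (f-f⁻¹ v)))
    where
    restore : ∀ {h g} → (T g → T h) → h ∧ not (h ∧ not g) ≡ g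
    restore {true}  {true}  _   = refl
    restore {true}  {false} _   = refl
    restore {false} {true}  g⇒h = ⊥-elim (g⇒h tt)
    restore {false} {false} _   = refl

  missing≤absent : pairs (adj missing) ≤ pairs (absentWithin G χ)
  missing≤absent = begin
    pairs (adj missing)
      ≤⟨ sumMap-mono all (λ {u} _ → sumMap-mono all λ {v} _ → #-mono (absent-f u v)) ⟩
    sumMap (λ u → sumMap (λ v → # absentWithin G χ (f u) (f v)) all) all
      ≡⟨ sumMap-cong all (λ {u} _ → reindex (λ v → # absentWithin G χ (f u) v)) ⟩
    sumMap (λ u → count (absentWithin G χ (f u)) (allFin n)) all
      ≡⟨ reindex (λ u → count (absentWithin G χ u) (allFin n)) ⟩
    pairs (absentWithin G χ) ∎
    where
    open ℕ.≤-Reasoning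
    all : List (Fin (a + (b + c)))
    all = allFin (a + (b + c))
    reindex : ∀ (h : Fin n → ℕ) → sumMap (h ∘ f) all ≡ sumMap h (allFin n)
    reindex h = trans (sym (sumMap-map h f all)) (trans (cong (sumMap h) (List.map-tabulate id f)) (sumMap-↭ h f-permutes))
    absent-f : ∀ u v → T (adj missing u v) → T (absentWithin G χ (f u) (f v))
    absent-f u v uv = let h , ¬g = T-∧ {adj M u v} uv ; _ , u∈ , v∈ = in-E₁ u v uv in
      Equivalence.from Bool.T-∧ (Equivalence.from Bool.T-∧ (missing-W u∈ , missing-W v∈) ,
        Equivalence.from Bool.T-∧ (≢⇒Adj-K (λ fu≡fv → Adj⇒≢ M h (f-injective u v fu≡fv)) , ¬g))

  -- At most t missing edges would place `G` in the family. So there are at least t + 1, and each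
  -- gives two ordered pairs absent within Y ∪ Z.
  many-absent : ∀ t → ¬ Deletions a b c M t G → 2 * suc t ≤ pairs (absentWithin G χ)
  many-absent t ¬deletion = ℕ.≤-trans (ℕ.*-monoʳ-≤ 2 (ℕ.≰⇒> λ ≤t → ¬deletion (missing , in-E₁ , ≤t , isomorphic)))
    (ℕ.≤-trans (2*edgeCount≤pairs missing) missing≤absent)

module _ {n k s} (G : Graph n) (𝒮 : Structure k s G) where

  open Structure 𝒮
  open PartCounts G 𝒮 using (χ)

  many-absent-independent : ∀ {a b c} t → length Y ≡ a → length Z ≡ b → length X ≡ c →
    (∀ {x y} → x ∈ X → y ∈ X → ¬ Adj G x y) →
    ¬ Deletions a b c (K a ∨ (K b ∪ I c)) t G → 2 * suc t ≤ pairs (absentWithin G χ)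
  many-absent-independent t refl refl refl independent = Recognition.many-absent G 𝒮 (I _)
    (λ i j → sym (Bool.¬-not λ eq → independent (∈.∈-lookup i) (∈.∈-lookup j) (subst T (sym eq) tt))) t

  many-absent-complete : ∀ {a b c} t → length Y ≡ a → length Z ≡ b → length X ≡ c →
    (∀ {x y} → x ∈ X → y ∈ X → x ≢ y → Adj G x y) →
    ¬ Deletions a b c (K a ∨ (K b ∪ K c)) t G → 2 * suc t ≤ pairs (absentWithin G χ)
  many-absent-complete t refl refl refl complete = Recognition.many-absent G 𝒮 (K _) agree t
    where
    unique-X : Unique X
    unique-X = AllPairs-++⁻ʳ Z (AllPairs-++⁻ʳ Y (Unique-resp-↭ (↭-sym cover) (Unique.allFin⁺ n)))
    agree : ∀ i j → adj (K (length X)) i j ≡ adj G (List.lookup X i) (List.lookup X j)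
    agree i j with i Fin.≟ j
    ... | yes refl = sym (adj-irrefl G (List.lookup X i))
    ... | no i≢j   = sym (Equivalence.to Bool.T-≡ (complete (∈.∈-lookup i) (∈.∈-lookup j)
      λ eq → i≢j (tabulate-injective (List.lookup X) (subst Unique (sym (List.tabulate-lookup X)) unique-X) i j eq)))

-- From vertex lists to induced subgraphs

toList≡tabulate : ∀ {m} (xs : Vec V m) → Vec.toList xs ≡ List.tabulate (Vec.lookup xs)
toList≡tabulate []       = refl
toList≡tabulate (x ∷ xs) = cong (x ∷_) (toList≡tabulate xs)

elements-partition : ∀ {n} (S : Subset n) → Vec.toList (elements (∁ S)) ++ Vec.toList (elements S) ↭ allFin n
elements-partition []            = ↭-refl
elements-partition {suc n} (inside ∷ S) = ↭-trans
  (↭-reflexive (cong₂ (λ xs ys → xs ++ Fin.zero ∷ ys) (Vec.toList-map Fin.suc (elements (∁ S)))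
      (Vec.toList-map Fin.suc (elements S))))
  (↭-trans (↭.shift Fin.zero (map Fin.suc (Vec.toList (elements (∁ S)))) _)
    (↭-prep Fin.zero (↭-trans (↭-reflexive (sym (List.map-++ Fin.suc (Vec.toList (elements (∁ S))) _)))
      (↭-trans (↭.map⁺ Fin.suc (elements-partition S)) (↭-reflexive (List.map-tabulate {n = n} id Fin.suc))))))
elements-partition {suc n} (outside ∷ S) = ↭-prep Fin.zero (↭-trans
  (↭-reflexive (trans (cong₂ _++_ (Vec.toList-map Fin.suc (elements (∁ S))) (Vec.toList-map Fin.suc (elements S)))
    (sym (List.map-++ Fin.suc (Vec.toList (elements (∁ S))) _))))
  (↭-trans (↭.map⁺ Fin.suc (elements-partition S)) (↭-reflexive (List.map-tabulate {n = n} id Fin.suc))))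

-- The vertices of the induced subgraph are positions in the enumeration of `S`, along which the
-- cycle is pulled back. Three vertices exclude the degenerate cycle that runs an edge back and
-- forth.
hamiltonian-induced : ∀ {n} (G : Graph n) (S : Subset n) → 3 ≤ ∣ S ∣ →
  HamiltonianOn G (Vec.toList (elements S)) → Hamiltonian (induced G S)
hamiltonian-induced {n} G S 3≤ (a , b , t , p , ba , π)
  with ↭.↭-map-inv e (↭-sym (↭-trans π (↭-reflexive vertices)))
  where
  e : Fin ∣ S ∣ → Fin n
  e = Vec.lookup (elements S)
  vertices : Vec.toList (elements S) ≡ map e (allFin ∣ S ∣)
  vertices = trans (toList≡tabulate (elements S)) (sym (List.map-tabulate id e))
... | v ∷ vs , refl , ρ = record
  { v        = v
  ; vs       = vs
  ; 3≤length = ℕ.≤-trans 3≤ (ℕ.≤-reflexive (trans (sym (length-allFin ∣ S ∣)) (↭.↭-length ρ)))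
  ; distinct = Unique-resp-↭ ρ (Unique.allFin⁺ ∣ S ∣)
  ; closed   = linked p ba
  ; spanning = λ u → ↭.∈-resp-↭ ρ (∈.∈-allFin u)
  }
  where
  e : Fin ∣ S ∣ → Fin n
  e = Vec.lookup (elements S)
  linked : ∀ {x b z ws} {H : Fin n → Fin n → Set} → Path (Adj G) H 0 (e x) b (map e ws) → Adj G b (e z) →
    Linked (Adj (induced G S)) (x ∷ (ws List.∷ʳ z))
  linked {ws = []}     []      xz = xz ∷ [-]
  linked {ws = w ∷ ws} (r ∷ p) bz = r ∷ linked p bz

-- Since |Y| ≤ k + s + 1, the pair counts of an exceptional graph have bounds independent of n.
module Bounds (k s : ℕ) where

  acrossBound absentBound pairsBound weight threshold : ℕ
  acrossBound = 2 * (s * (k + s + 1))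
  absentBound = 2 * (s * (s + (k + s + 1)))
  pairsBound  = absentBound + acrossBound + s * s
  weight      = acrossBound + 4 * absentBound
  -- The first summand serves the stability argument, the second the hypothesis `M-large` of
  -- `PartBound`, and `k + 3` leaves three vertices when up to k are deleted.
  threshold   = suc (stabilityBound k s) + (s + (4 * (suc weight * pairsBound) + 5)) + (2 * (k + s) + (k + 3))

-- Writing the order as r + 2 + s avoids truncated subtraction: Y ∪ Z has r + 2 vertices, and the
-- assumed lower bound on q is 2 (r + 1).
module Exceptional (k s r : ℕ) (G : Graph (suc (suc r + s))) (𝒮 : Structure k s G)
  (large : Bounds.threshold k s ≤ suc (suc r + s))
  (dense : suc (suc r + s) * suc (suc r + s) ≤ sumMap (degreeIn G (allFin (suc (suc r + s))))
      (allFin (suc (suc r + s))) + (suc (suc r + s) + 2 * s * suc (suc r + s)))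
  where

  open Structure 𝒮
  open PartCounts G 𝒮
  open Bounds k s

  order : ℕ
  order = suc (suc r + s)

  |Y|≤ : length Y ≤ k + s + 1
  |Y|≤ = case XX of λ where
    (inj₁ (eq , _)) → ℕ.≤-trans (ℕ.≤-reflexive eq) (ℕ.m≤m+n (k + s) 1)
    (inj₂ (eq , _)) → ℕ.≤-trans (ℕ.≤-reflexive eq) (ℕ.+-monoˡ-≤ 1 (ℕ.m≤m+n k s))

  across-bound : pairs (presentAcross G χ) ≤ acrossBound
  across-bound = ℕ.≤-trans across≤ (ℕ.*-monoʳ-≤ 2 (ℕ.*-monoʳ-≤ s |Y|≤))

  absent-bound : pairs (absentWithin G χ) ≤ absentBound
  absent-bound = ℕ.≤-trans (absent-bounded dense) (ℕ.*-monoʳ-≤ 2 (ℕ.*-monoʳ-≤ s (ℕ.+-monoʳ-≤ s |Y|≤)))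

  parts : length Y + length Z ≡ suc (suc r)
  parts = ℕ.+-cancelʳ-≡ s _ _ (sym n≡)

  size : 4 * (suc weight * pairsBound) + 5 ≤ 2 * suc (suc r)
  size = ℕ.≤-trans (ℕ.+-cancelˡ-≤ s _ _ (begin
      s + (4 * (suc weight * pairsBound) + 5)
        ≤⟨ ℕ.m≤n+m _ (suc (stabilityBound k s)) ⟩
      suc (stabilityBound k s) + (s + (4 * (suc weight * pairsBound) + 5))
        ≤⟨ ℕ.m≤m+n _ (2 * (k + s) + (k + 3)) ⟩
      threshold
        ≤⟨ large ⟩
      suc (suc r) + s
        ≡⟨ ℕ.+-comm (suc (suc r)) s ⟩
      s + suc (suc r) ∎))
    (ℕ.m≤m+n (suc (suc r)) _)
    where open ℕ.≤-Reasoning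

  -- Here the rounding in ⌊|X| |Y| / 4⌋ is settled: one edge more than the floor gives strictly more
  -- than |X| |Y| / 4. By integrality the difference in ordered pairs is at least 2.
  excess : ∀ {a c} → length Y ≡ a → length X ≡ c → 2 * suc (a * c / 4) ≤ pairs (absentWithin G χ) →
    pairs (presentAcross G χ) + 2 ≤ 4 * pairs (absentWithin G χ)
  excess refl refl many = begin
    pairs (presentAcross G χ) + 2   ≤⟨ ℕ.+-monoˡ-≤ 2 across≤ ⟩
    2 * (s * length Y) + 2          ≡⟨ cong (λ c → 2 * (c * length Y) + 2) |X| ⟨
    2 * (length X * length Y) + 2   ≡⟨ eq (length X) (length Y) ⟩
    2 * suc x                       ≤⟨ ℕ.*-monoʳ-≤ 2 x<4t ⟩
    2 * (4 * suc (x / 4))           ≡⟨ eq′ (suc (x / 4)) ⟩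
    4 * (2 * suc (x / 4))           ≤⟨ ℕ.*-monoʳ-≤ 4 many ⟩
    4 * pairs (absentWithin G χ)    ∎
    where
    open ℕ.≤-Reasoning
    x : ℕ
    x = length Y * length X
    eq : ∀ c y → 2 * (c * y) + 2 ≡ 2 * suc (y * c)
    eq = solve-∀
    eq′ : ∀ t → 2 * (4 * t) ≡ 4 * (2 * t)
    eq′ = solve-∀
    x<4t : x < 4 * suc (x / 4)
    x<4t = begin-strict
      x                     ≡⟨ DivMod.m≡m%n+[m/n]*n x 4 ⟩
      x % 4 + x / 4 * 4     <⟨ ℕ.+-monoˡ-< (x / 4 * 4) (DivMod.m%n<n x 4) ⟩
      4 + x / 4 * 4         ≡⟨ ℕ.*-comm (suc (x / 4)) 4 ⟩
      4 * suc (x / 4)       ∎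

  q-small : pairs (presentAcross G χ) + 2 ≤ 4 * pairs (absentWithin G χ) →
    ∀ q → fromℚ (ι (2 * suc r)) ≤ℝ q → ¬ IsEigenvalue (signlessLaplacian G) q
  -- With N = r + 2, the product μ κ = 2 N · 2 (N - 1) exceeds ν = 4 N² - 4 N - 1 by exactly 1.
  q-small excess = not-eigenvalue G (0<ι (suc r + 1 * suc (suc r)))
    (subst (ι (4 * (suc (suc r) * suc (suc r))) ℚ.- ι (4 * suc (suc r) + 1) ℚ.<_) (ι-* (2 * suc (suc r)) (2 * suc r))
      (ι-gap {4 * (suc (suc r) * suc (suc r))} {4 * suc (suc r) + 1} {2 * suc (suc r) * (2 * suc r)} (ℕ.≤-reflexive (eq r))))
    (PartBound.edgeForm-part-bound G χ weight pairsBound (suc r) (trans |χ| parts) excess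
      (ℕ.+-mono-≤ across-bound (ℕ.*-monoʳ-≤ 4 absent-bound))
      (ℕ.+-mono-≤ (ℕ.+-mono-≤ absent-bound across-bound) outside≤)
      size)
    where
    eq : ∀ r → suc (4 * (suc (suc r) * suc (suc r))) ≡ 4 * suc (suc r) + 1 + 2 * suc (suc r) * (2 * suc r)
    eq = solve-∀

  |X|≡ : length X ≡ (k + s) ∸ k
  |X|≡ = trans |X| (sym (ℕ.m+n∸m≡n k s))

  contradictory : ∀ q → fromℚ (ι (2 * suc r)) ≤ℝ q → IsEigenvalue (signlessLaplacian G) q →
    ¬ 𝓗⁽¹⁾ order k (k + s) G → ¬ 𝓛⁽¹⁾ order k (k + s) G → ⊥
  contradictory q κ≤q eigenvalue ¬𝓗 ¬𝓛 = q-small (many XX) q κ≤q eigenvalue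
    where
    open ≡-Reasoning
    |Z|-H : length Y ≡ k + s → length Z ≡ order + k ∸ 2 * (k + s)
    |Z|-H |Y| = begin
      length Z                                    ≡⟨ ℕ.m+n∸n≡m (length Z) (2 * (k + s)) ⟨
      length Z + 2 * (k + s) ∸ 2 * (k + s)        ≡⟨ cong (_∸ 2 * (k + s))
          (trans (eq (length Z) k s) (cong (λ y → y + length Z + s + k) (sym |Y|))) ⟩
      length Y + length Z + s + k ∸ 2 * (k + s)   ≡⟨ cong (λ m → m + k ∸ 2 * (k + s)) n≡ ⟨
      order + k ∸ 2 * (k + s)                     ∎
      where
      eq : ∀ z k s → z + 2 * (k + s) ≡ k + s + z + s + k
      eq = solve-∀
    |Z|-L : length Y ≡ k + 1 → length Z ≡ order ∸ (k + s) ∸ 1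
    |Z|-L |Y| = begin
      length Z                                    ≡⟨ ℕ.m+n∸n≡m (length Z) (k + s + 1) ⟨
      length Z + (k + s + 1) ∸ (k + s + 1)        ≡⟨ cong (_∸ (k + s + 1))
          (trans (eq (length Z) k s) (trans (cong (λ y → y + length Z + s) (sym |Y|)) (sym n≡))) ⟩
      order ∸ (k + s + 1)                         ≡⟨ ℕ.∸-+-assoc order (k + s) 1 ⟨
      order ∸ (k + s) ∸ 1                         ∎
      where
      eq : ∀ z k s → z + (k + s + 1) ≡ k + 1 + z + s
      eq = solve-∀
    many : (length Y ≡ k + s × (∀ {x y} → x ∈ X → y ∈ X → ¬ Adj G x y)) ⊎
           (length Y ≡ k + 1 × (∀ {x y} → x ∈ X → y ∈ X → x ≢ y → Adj G x y)) →
           pairs (presentAcross G χ) + 2 ≤ 4 * pairs (absentWithin G χ)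
    many (inj₁ (|Y| , independent)) = excess |Y| |X|≡ (many-absent-independent G 𝒮 _ |Y| (|Z|-H |Y|) |X|≡ independent ¬𝓗)
    many (inj₂ (|Y| , complete))    = excess |Y| |X|≡ (many-absent-complete G 𝒮 _ |Y| (|Z|-L |Y|) |X|≡ complete ¬𝓛)

-- Assembly for large order

k-hamiltonian : ∀ k s r → 2 ≤ s → (G : Graph (suc (suc r + s))) → Bounds.threshold k s ≤ suc (suc r + s) →
  k + s ≤ minDegree G → ∀ q → fromℚ (ι (2 * suc r)) ≤ℝ q → IsEigenvalue (signlessLaplacian G) q →
  ¬ 𝓗⁽¹⁾ (suc (suc r + s)) k (k + s) G → ¬ 𝓛⁽¹⁾ (suc (suc r + s)) k (k + s) G → k -Hamiltonian G
k-hamiltonian k s r 2≤s G large δ≤ q κ≤q eigenvalue ¬𝓗 ¬𝓛 S |S|≤k = decide (hamiltonianOn? G U)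
  where
  order : ℕ
  order = suc (suc r + s)
  U D : List (Fin order)
  U = Vec.toList (elements (∁ S))
  D = Vec.toList (elements S)
  1≤s : 1 ≤ s
  1≤s = ℕ.≤-trans (s≤s z≤n) 2≤s
  |D|≤k : length D ≤ k
  |D|≤k = ℕ.≤-trans (ℕ.≤-reflexive (Vec.length-toList (elements S))) |S|≤k
  minDeg : ∀ v → k + s ≤ degreeIn G (allFin order) v
  minDeg v = ℕ.≤-trans δ≤ (minDegree≤degree G v)
  -- The n diagonal pairs are added to both sides of `edge-bound`, since later counts of
  -- non-neighbours include them, and n - 1 is relaxed to n.
  dense : order * order ≤ sumMap (degreeIn G (allFin order)) (allFin order) + (order + 2 * s * order)
  dense = linear (ℕ.+-mono-≤ (edge-bound {r} {s} G
      (λ v → ℕ.≤-trans 1≤s (ℕ.≤-trans (ℕ.m≤n+m s k) (minDeg v))) q κ≤q eigenvalue) (z≤n {2 * s}))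
    (eq (suc r + s) s (sumMap (degreeIn G (allFin order)) (allFin order)))
    where
    eq : ∀ p s M → suc p * suc p + (M + 2 * s * p + 2 * s) ≡ M + (suc p + 2 * s * suc p) + (p * suc p + 0)
    eq = solve-∀
  k+3≤n : k + 3 ≤ order
  k+3≤n = ℕ.≤-trans (ℕ.≤-trans (ℕ.m≤n+m (k + 3) (2 * (k + s))) (ℕ.m≤n+m _ (suc (stabilityBound k s) + _))) large
  3≤|U| : 3 ≤ ∣ ∁ S ∣
  3≤|U| = ℕ.+-cancelˡ-≤ k _ _ (begin
    k + 3                 ≤⟨ k+3≤n ⟩
    order                 ≡⟨ trans (sym (length-allFin order))
        (trans (sym (↭.↭-length (elements-partition S))) (List.length-++ U)) ⟩
    length U + length D   ≤⟨ ℕ.+-monoʳ-≤ (length U) |D|≤k ⟩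
    length U + k          ≡⟨ trans (ℕ.+-comm (length U) k) (cong (k +_) (Vec.length-toList (elements (∁ S)))) ⟩
    k + ∣ ∁ S ∣           ∎)
    where open ℕ.≤-Reasoning
  decide : Dec (HamiltonianOn G U) → Hamiltonian (induced G (∁ S))
  decide (yes ham) = hamiltonian-induced G (∁ S) 3≤|U| ham
  decide (no ¬ham) = ⊥-elim (Exceptional.contradictory k s r G 𝒮 large dense q κ≤q eigenvalue ¬𝓗 ¬𝓛)
    where
    𝒮 : Structure k s G
    𝒮 = nonHamiltonian⇒structure k s 1≤s G U D (elements-partition S) |D|≤k minDeg dense
      (ℕ.≤-trans (ℕ.≤-trans (ℕ.m≤m+n (suc (stabilityBound k s)) _) (ℕ.m≤m+n _ _)) large) ¬ham

open import Data.Integer.Base as ℤ using (+_)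

bound≡ : ∀ k s r → (+ 2) ℤ.* ((+ suc (suc r + s)) ℤ.- (+ (k + s)) ℤ.+ (+ k) ℤ.- (+ 1)) ≡ + (2 * suc r)
bound≡ k s r = trans (eq (+ suc r) (+ s) (+ k)) (sym (ℤ.pos-* 2 (suc r)))
  where
  eq : ∀ r s k → (+ 2) ℤ.* ((+ 1) ℤ.+ (r ℤ.+ s) ℤ.- (k ℤ.+ s) ℤ.+ k ℤ.- (+ 1)) ≡ (+ 2) ℤ.* r
  eq = ℤ.solve-∀

theorem2p7 : ∀ (k δ : ℕ) → k + 2 ≤ δ →
    ∃[ n₀ ] ∀ (n : ℕ) → n₀ ≤ n →
    ∀ (G : Graph n) → δ ≤ minDegree G →
    ∀ (q : ℝ) → IsSignlessLaplacianSpectralRadius G q →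
    fromℤ ((+ 2) ℤ.* ((+ n) ℤ.- (+ δ) ℤ.+ (+ k) ℤ.- (+ 1))) ≤ℝ q →
    ¬ 𝓗⁽¹⁾ n k δ G → ¬ 𝓛⁽¹⁾ n k δ G →
    k -Hamiltonian G
theorem2p7 k δ k+2≤δ = Bounds.threshold k s , λ n large → for-size (ℕ.m+[n∸m]≡n k≤δ) (split-n n large) large
  where
  s : ℕ
  s = δ ∸ k
  k≤δ : k ≤ δ
  k≤δ = ℕ.≤-trans (ℕ.m≤m+n k 2) k+2≤δ
  2≤s : 2 ≤ s
  2≤s = subst (_≤ s) (ℕ.m+n∸m≡n k 2) (ℕ.∸-monoˡ-≤ k k+2≤δ)
  split-n : ∀ n → Bounds.threshold k s ≤ n → ∃[ r ] suc (suc r + s) ≡ n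
  split-n n large = n ∸ suc (suc s) , trans (cong (λ m → suc (suc m)) (ℕ.+-comm (n ∸ suc (suc s)) s)) (ℕ.m+[n∸m]≡n s+2≤n)
    where
    s+2≤n : suc (suc s) ≤ n
    s+2≤n = ℕ.≤-trans (linear (ℕ.+-mono-≤
        (z≤n {stabilityBound k s + 4 * (suc weight * pairsBound) + 2 * (k + s) + (k + 3)}) (z≤n {4}))
      (eq (stabilityBound k s) s (4 * (suc weight * pairsBound)) (2 * (k + s)) (k + 3))) large
      where
      open Bounds k s
      eq : ∀ b s x y z → suc (suc s) + (b + x + y + z + 4) ≡ suc b + (s + (x + 5)) + (y + z) + (0 + 0)
      eq = solve-∀
  -- The order and `δ` are variables here, so matching on the two equations turns them into
  -- `suc (suc r + s)` and `k + s` throughout, including the types of the graph and of the families.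
  for-size : ∀ {n δ} → k + s ≡ δ → (∃[ r ] suc (suc r + s) ≡ n) → Bounds.threshold k s ≤ n →
    ∀ (G : Graph n) → δ ≤ minDegree G → ∀ q → IsSignlessLaplacianSpectralRadius G q →
    fromℤ ((+ 2) ℤ.* ((+ n) ℤ.- (+ δ) ℤ.+ (+ k) ℤ.- (+ 1))) ≤ℝ q →
    ¬ 𝓗⁽¹⁾ n k δ G → ¬ 𝓛⁽¹⁾ n k δ G → k -Hamiltonian G
  for-size refl (r , refl) large G δ≤ q (eigenvalue , _) bound≤q =
    k-hamiltonian k s r 2≤s G large δ≤ q
      (subst (λ p → fromℚ p ≤ℝ q) (trans (cong (ℚ._/ 1) (bound≡ k s r)) (/1≡ι (2 * suc r))) bound≤q) eigenvalue
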